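{- $\mathrm{MC}^*(\cap,+,-)\in\mathrm P$.
   Context: For $k\ge1$ let $\mathbb N_\infty^k=\mathbb N^k\cup\{\infty\}$ (natural numbers include $0$). Addition on $\mathbb N^k$ is componentwise, and $\infty+m=m+\infty=\infty+\infty=\infty$ for $m\in\mathbb N^k$. Subtraction is partial: for $a,b\in\mathbb N^k$, $a-b$ is defined (componentwise) iff $a_i-b_i\in\mathbb N$ for all $i$; $\infty-m=\infty$ for $m\in\mathbb N^k$; $m-\infty$ and $\infty-\infty$ are undefined. For $A,B\subseteq\mathbb N_\infty^k$: $A\cap B$, $A\cup B$ usual, $A+B=\{a+b:a\in A,b\in B\}$, $A-B=\{a-b: a\in A,b\in B, a-b \text{ defined}\}$, $\overline A=\mathbb N_\infty^k\setminus A$. For $\emptyset\ne\mathcal O\subseteq\{\cup,\cap,\overline{\phantom{c}},+,-\}$, an $\mathcal O$-circuit over $\mathbb N_\infty^k$ is a finite acyclic directed multigraph $C=(V,E,g_C,\alpha)$ with gates of indegree $0,1,2$, a designated output gate $g_C$, input gates labeled by elements of $\mathbb N_\infty^k$, indegree-$1$ gates labeled $\overline{\phantom{c}}$ (only if $\overline{\phantom{c}}\in\mathcal O$), indegree-$2$ gates labeled by operations in $\mathcal O\setminus\{\overline{\phantom{c}}\}$; result sets $I(g)$ are defined inductively ($\{\alpha(g)\}$ for inputs, complement of the predecessor's set, or $I(g_1)\sigma I(g_2)$ with predecessors $g_1\le g_2$), and $I(C)=I(g_C)$. Circuits are encoded as bit strings listing gates in reverse topological order with labels and predecessor lists, numbers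 in binary. $\mathrm{MC}^*(\mathcal O)$ is the set of all $(C,b)$ such that for some $k\ge1$, $C$ is an $\mathcal O$-circuit over $\mathbb N_\infty^k$, $b\in\mathbb N_\infty^k$, and $b\in I(C)$. -}

module Defs where

open import Data.Bool.Base using (Bool; true; false; if_then_else_)
open import Data.Fin.Base using (Fin; toℕ)
open import Data.Fin.Induction using (spo-wellFounded)
import Data.Fin.Base as Fin
open import Data.List.Base using (List; []; _∷_; _++_; map; length; allFin)
open import Data.List.Membership.Propositional using (_∈_)
open import Data.List.Relation.Binary.Permutation.Propositional using (_↭_)
open import Data.List.Relation.Unary.AllPairs using (AllPairs)
open import Data.List.Relation.Unary.Any using (here; there)
open import Data.Maybe.Base using (Maybe; just; nothing)
open import Data.Nat.Base using (ℕ; zero; suc; _+_; _*_; _∸_; _^_; _≤_)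
open import Data.Nat.Properties using (_≤?_)
open import Data.Product.Base using (Σ-syntax; ∃; ∃-syntax; _×_; _,_; proj₁; proj₂)
open import Data.Vec.Base as Vec using (Vec; toList)
open import Data.Vec.Relation.Binary.Pointwise.Inductive using (decidable)
open import Function.Bundles using (_⇔_; _↔_)
open import Function.Definitions using (Injective)
open import Induction.WellFounded using (WellFounded; Acc; acc; module Subrelation)
open import Level using (0ℓ)
open import Relation.Binary.Construct.Closure.Transitive as ⁺ using (TransClosure)
open import Relation.Binary.PropositionalEquality
  using (_≡_; _≢_; refl; isEquivalence; resp₂)
open import Relation.Nullary.Decidable.Core using (does)
open import Relation.Nullary.Negation.Core using (¬_)
open import Relation.Unary using (Pred; ｛_｝; ∁; _∪_; _∩_)

------------------------------------------------------------------------
-- Deterministic multitape Turing machines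

Finite : Set → Set
Finite A = ∃[ n ] (A ↔ Fin n)

data Move : Set where
  left stay right : Move

record TM : Set₁ where
  field
    State          : Set
    Symbol         : Set
    state-finite   : Finite State
    symbol-finite  : Finite Symbol
    extraTapes     : ℕ
    start          : State
    blank          : Symbol
    bit            : Bool → Symbol
    bit-injective  : Injective _≡_ _≡_ bit
    bit≢blank      : ∀ b → bit b ≢ blank
    -- just true: accepting; just false: rejecting; nothing: not halted
    verdict        : State → Maybe Bool

  tapes : ℕ
  tapes = suc extraTapes

  field
    δ : State → Vec Symbol tapes → State × Vec (Symbol × Move) tapes

-- A two-way infinite tape: the cells to the left of the head (nearest first),
-- the scanned cell and the cells to its right; all cells not listed are blank.
record Tape (Γ : Set) : Set where
  constructor tape
  field
    before  : List Γ
    scanned : Γ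
    after   : List Γ

open Tape public

module Run (M : TM) where
  open TM M

  Config : Set
  Config = State × Vec (Tape Symbol) tapes

  tapeFrom : List Symbol → Tape Symbol
  tapeFrom []       = tape [] blank []
  tapeFrom (s ∷ ss) = tape [] s ss

  move : Move → Tape Symbol → Tape Symbol
  move stay  t                    = t
  move left  (tape []       s rs) = tape [] blank (s ∷ rs)
  move left  (tape (l ∷ ls) s rs) = tape ls l (s ∷ rs)
  move right (tape ls s [])       = tape (s ∷ ls) blank []
  move right (tape ls s (r ∷ rs)) = tape (s ∷ ls) r rs

  act : Symbol × Move → Tape Symbol → Tape Symbol
  act (s , m) (tape ls _ rs) = move m (tape ls s rs)

  -- Halted configurations are fixed points.
  step : Config → Config
  step (q , ts) with verdict q
  ... | just _  = q , ts
  ... | nothing =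
    let (q′ , actions) = δ q (Vec.map scanned ts)
    in  q′ , Vec.zipWith act actions ts

  steps : ℕ → Config → Config
  steps zero    c = c
  steps (suc t) c = steps t (step c)

  initial : List Bool → Config
  initial w = start , tapeFrom (map bit w) Vec.∷ Vec.replicate extraTapes (tapeFrom [])

  HaltsWithin : ℕ → List Bool → Bool → Set
  HaltsWithin t w b = verdict (proj₁ (steps t (initial w))) ≡ just b

Language : Set₁
Language = Pred (List Bool) 0ℓ

InP : Language → Set₁
InP L =
  Σ[ M ∈ TM ] ∃[ c ] ∃[ d ] ∀ w →
  ∃[ b ] (Run.HaltsWithin M (c * length w ^ d + c) w b × (L w ⇔ b ≡ true))

------------------------------------------------------------------------
-- ℕᵏ ∪ {∞}

data ℕ∞ (k : ℕ) : Set where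
  fin : Vec ℕ k → ℕ∞ k
  ∞   : ℕ∞ k

_+∞_ : ∀ {k} → ℕ∞ k → ℕ∞ k → ℕ∞ k
fin a +∞ fin b = fin (Vec.zipWith _+_ a b)
fin _ +∞ ∞     = ∞
∞     +∞ _     = ∞

-- nothing: the difference is undefined
_-∞_ : ∀ {k} → ℕ∞ k → ℕ∞ k → Maybe (ℕ∞ k)
fin a -∞ fin b = if does (decidable _≤?_ b a)
                 then just (fin (Vec.zipWith _∸_ a b))
                 else nothing
∞     -∞ fin _ = just ∞
_     -∞ ∞     = nothing

Subset : ℕ → Set₁
Subset k = Pred (ℕ∞ k) 0ℓ

_⊕_ : ∀ {k} → Subset k → Subset k → Subset k
(A ⊕ B) c = ∃[ a ] ∃[ b ] (A a × B b × a +∞ b ≡ c)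

_⊖_ : ∀ {k} → Subset k → Subset k → Subset k
(A ⊖ B) c = ∃[ a ] ∃[ b ] (A a × B b × a -∞ b ≡ just c)

------------------------------------------------------------------------
-- Circuits

data BinOp : Set where
  cup cap plus minus : BinOp

data Op : Set where
  compl : Op
  bin   : BinOp → Op

⟦_⟧ : BinOp → ∀ {k} → Subset k → Subset k → Subset k
⟦ cup   ⟧ A B = A ∪ B
⟦ cap   ⟧ A B = A ∩ B
⟦ plus  ⟧ A B = A ⊕ B
⟦ minus ⟧ A B = A ⊖ B

-- A gate of an O-circuit with gate set Fin n, given by its label and its
-- incoming edges. Two parallel edges give g₁ = g₂.
data Gate (O : List Op) (k n : ℕ) : Set where
  input  : ℕ∞ k → Gate O k n
  unary  : compl ∈ O → Fin n → Gate O k n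
  binary : (σ : BinOp) → bin σ ∈ O → (g₁ g₂ : Fin n) → g₁ Fin.≤ g₂ → Gate O k n

preds : ∀ {O k n} → Gate O k n → List (Fin n)
preds (input _)            = []
preds (unary _ g)          = g ∷ []
preds (binary _ _ g₁ g₂ _) = g₁ ∷ g₂ ∷ []

record Circuit (O : List Op) (k : ℕ) : Set where
  field
    size   : ℕ
    gate   : Fin size → Gate O k size
    output : Fin size

  _⟶_ : Fin size → Fin size → Set
  h ⟶ g = h ∈ preds (gate g)

  field
    acyclic : ∀ g → ¬ TransClosure _⟶_ g g

  ⟶-wellFounded : WellFounded _⟶_
  ⟶-wellFounded = Subrelation.wellFounded ⁺.[_] (spo-wellFounded record
    { isEquivalence = isEquivalence
    ; irrefl        = λ { {g} refl → acyclic g }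
    ; trans         = ⁺._++_
    ; <-resp-≈      = resp₂ _
    })

  evalGate : (G : Gate O k size) → (∀ {h} → h ∈ preds G → Subset k) → Subset k
  evalGate (input x)            I = ｛ x ｝
  evalGate (unary _ _)          I = ∁ (I (here refl))
  evalGate (binary σ _ _ _ _)   I = ⟦ σ ⟧ (I (here refl)) (I (there (here refl)))

  resultAcc : ∀ g → Acc _⟶_ g → Subset k
  resultAcc g (acc rs) = evalGate (gate g) (λ {h} h⟶g → resultAcc h (rs h⟶g))

  result : Fin size → Subset k
  result g = resultAcc g (⟶-wellFounded g)

  -- An enumeration of all gates in which predecessors come after the gates
  -- that use them.
  ReverseTopological : List (Fin size) → Set
  ReverseTopological order =
    order ↭ allFin size × AllPairs (λ g h → ¬ g ⟶ h) order

-- The result set I(C) of the whole circuit.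
resultSet : ∀ {O k} → Circuit O k → Subset k
resultSet C = Circuit.result C (Circuit.output C)

------------------------------------------------------------------------
-- Bit strings: every code below is prefix-free, so concatenation is uniquely
-- decodable.

increment : List Bool → List Bool
increment []           = true ∷ []
increment (false ∷ ds) = true ∷ ds
increment (true ∷ ds)  = false ∷ increment ds

-- Binary digits, least significant first, without superfluous zeros;
-- 0 has no digits.
digits : ℕ → List Bool
digits zero    = []
digits (suc n) = increment (digits n)

encodeList : ∀ {A : Set} → (A → List Bool) → List A → List Bool
encodeList f []       = false ∷ []
encodeList f (x ∷ xs) = true ∷ f x ++ encodeList f xs

encodeℕ : ℕ → List Bool
encodeℕ n = encodeList (_∷ []) (digits n)

encodeℕ∞ : ∀ {k} → ℕ∞ k → List Bool
encodeℕ∞ (fin v) = false ∷ encodeList encodeℕ (toList v)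
encodeℕ∞ ∞       = true ∷ []

encodeOp : Op → List Bool
encodeOp compl       = false ∷ []
encodeOp (bin cup)   = true ∷ false ∷ false ∷ []
encodeOp (bin cap)   = true ∷ false ∷ true  ∷ []
encodeOp (bin plus)  = true ∷ true  ∷ false ∷ []
encodeOp (bin minus) = true ∷ true  ∷ true  ∷ []

encodeLabel : ∀ {O k n} → Gate O k n → List Bool
encodeLabel (input x)          = false ∷ encodeℕ∞ x
encodeLabel (unary _ _)        = true ∷ encodeOp compl
encodeLabel (binary σ _ _ _ _) = true ∷ encodeOp (bin σ)

encodeFin : ∀ {n} → Fin n → List Bool
encodeFin g = encodeℕ (toℕ g)

module _ {O k} (C : Circuit O k) where
  open Circuit C

  encodeEntry : Fin size → List Bool
  encodeEntry g = encodeFin g ++ encodeLabel (gate g) ++ encodeList encodeFin (preds (gate g))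

  encode : List (Fin size) → ℕ∞ k → List Bool
  encode order b = encodeList encodeEntry order ++ encodeFin output ++ encodeℕ∞ b

  -- A circuit may have several reverse topological orders; a listing along any
  -- of them is an encoding.
  Encodes : List Bool → ℕ∞ k → Set
  Encodes w b = ∃[ order ] (ReverseTopological order × w ≡ encode order b)

------------------------------------------------------------------------
-- The membership problem

MC* : List Op → Language
MC* O w =
  ∃[ k ] (1 ≤ k × Σ[ C ∈ Circuit O k ] ∃[ b ] (Encodes C w b × resultSet C b))

{-# OPTIONS --safe #-}
module Submission where

-- Without union and complement the result set of every gate has at most one
-- element, and each gate adds at most one binary digit to the numbers that
-- occur in these elements, so the circuit can be evaluated gate by gate. A list
-- of n gates is numbered correctly iff each of 0, …, n - 1 is among its gate
-- numbers, since they are then a permutation of 0, …, n - 1.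
--
-- The evaluation is carried out by programs on three stacks. A program for a
-- function replaces the (prefix-free) code of the argument on top of the first
-- stack by the code of the result and leaves everything below it and the other
-- stacks as they were. Hence such programs can be composed, paired and applied
-- under a context without renaming tapes, and a loop takes polynomial time as
-- soon as the number of its rounds and the sizes of the intermediate data are
-- bounded by a polynomial.

open import Data.Bool.Base using (Bool; true; false; if_then_else_; not; _∧_; _∨_; _xor_)
open import Data.Bool.ListAction using (all; any)
open import Data.Bool.Properties using (∧-identityʳ; ∧-assoc; ∨-assoc)
open import Data.Fin.Base as Fin using (Fin; toℕ; fromℕ<)
open import Data.Fin.Patterns using (0F; 1F; 2F)
open import Data.Fin.Properties as Fin using (1↔⊤; 2↔Bool; +↔⊎; toℕ-injective; toℕ-fromℕ<; toℕ<n)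
open import Data.List.Base using (List; []; _∷_; _++_; map; length; head; drop; null; foldl; reverse; _ʳ++_; foldr; _∷ʳ_; allFin)
open import Data.List.Membership.Propositional using (_∈_)
open import Data.List.Membership.Propositional.Properties using (∈-map⁺; ∈-map⁻; ∈-allFin; ∈-∃++)
open import Data.List.Membership.Propositional.Properties.WithK using (unique⇒irrelevant)
open import Data.List.Properties using (length-map; ++-assoc; ++-identityʳ; foldl-++; length-++; length-reverse; reverse-involutive; ʳ++-defn; reverse-foldr; reverse-foldl; unfold-reverse; ∷-injective; length-tabulate; map-∘; map-cong)
open import Data.List.Relation.Binary.Permutation.Propositional using (_↭_; ↭-sym; ↭-trans; ↭-reflexive; prep; ↭⇒↭ₛ)
open import Data.List.Relation.Binary.Permutation.Propositional.Properties using (∈-resp-↭; ↭-length; ↭-map-inv) renaming (shift to ↭-shift)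
import Data.List.Relation.Binary.Permutation.Setoid.Properties as Permutationₛ
import Data.List.Relation.Binary.Pointwise as Listwise
open import Data.List.Relation.Unary.All as All using (All; []; _∷_)
import Data.List.Relation.Unary.All.Properties as All
open import Data.List.Relation.Unary.AllPairs using (AllPairs; []; _∷_)
open import Data.List.Relation.Unary.Any using (here; there)
open import Data.List.Relation.Unary.Unique.Propositional using (Unique)
import Data.List.Relation.Unary.Unique.Propositional.Properties as Unique
open import Data.Maybe.Base using (Maybe; just; nothing; fromMaybe; is-nothing; maybe′; is-just)
open import Data.Maybe.Properties using (just-injective)
open import Data.Nat.Base using (ℕ; zero; suc; _+_; _*_; _^_; _≤_; z≤n; s≤s; _∸_; _<_)
open import Data.Nat.Properties
open import Data.Nat.Tactic.RingSolver using (solve-∀)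
open import Data.Product.Base using (Σ; Σ-syntax; ∃-syntax; _×_; _,_; proj₁; proj₂; map₁; swap; uncurry)
open import Data.Sum.Base using (_⊎_; inj₁; inj₂; [_,_]′)
open import Data.Sum.Function.Propositional using (_⊎-↔_)
open import Data.Unit.Base using (⊤; tt)
open import Data.Vec.Base as Vec using (Vec; []; _∷_; lookup; _[_]≔_; _[_]%=_; toList)
open import Data.Vec.Relation.Binary.Pointwise.Inductive using (Pointwise; []; _∷_; decidable)
open import Function.Base using (_∘_; id; flip; case_of_)
open import Function.Bundles using (_↔_; mk↔ₛ′; _⇔_; mk⇔; Equivalence)
open import Function.Construct.Composition using (_↔-∘_)
open import Function.Construct.Symmetry using (↔-sym)
open import Induction.WellFounded using (Acc; module Acc)
import Relation.Binary.Construct.Closure.Transitive as ⁺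
open import Relation.Binary.PropositionalEquality
open import Relation.Nullary.Decidable using (dec-true; dec-false)
open import Relation.Nullary.Decidable.Core using (Dec; yes; no; does)
open import Relation.Nullary.Negation.Core using (¬_; contradiction)
open import Defs

-- Machine fragments

-- Evaluating the circuit is easy; the difficulty is a time bound that survives iteration. A
-- polynomial-time step repeated once per gate may still double or square its data every time, so
-- loops and folds take a bound on all intermediate states as an argument. For the values of the
-- gates this bound counts digits: repeated doubling yields exponentially large numbers, but only
-- linearly many digits. The second difficulty is that the language consists of exact encodings. Two
-- things are absent from the string and have to be recovered: the dimension, read off the first
-- vector that occurs (1 if every point is ∞), and acyclicity, which follows once every predecessor
-- is listed below its gate. A universe of types reproduces the given encoding, and its traversals
-- find the end of a code from the type alone. Membership of b in a set with at most one element is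
-- tested as nonemptiness of the intersection with {b}.

finite-⊤ : Finite ⊤
finite-⊤ = 1 , ↔-sym 1↔⊤

finite-Bool : Finite Bool
finite-Bool = 2 , ↔-sym 2↔Bool

finite-⊎ : ∀ {A B} → Finite A → Finite B → Finite (A ⊎ B)
finite-⊎ (m , f) (n , g) = m + n , ↔-sym +↔⊎ ↔-∘ (f ⊎-↔ g)

finite-via : ∀ {A B} → A ↔ B → Finite B → Finite A
finite-via f (n , g) = n , g ↔-∘ f

Maybe↔ : ∀ {A : Set} → Maybe A ↔ (⊤ ⊎ A)
Maybe↔ = mk↔ₛ′ (λ { nothing → inj₁ tt ; (just x) → inj₂ x }) [ (λ _ → nothing) , just ]′
  (λ { (inj₁ tt) → refl ; (inj₂ _) → refl }) (λ { nothing → refl ; (just _) → refl })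

ΣBool↔ : ∀ {B : Bool → Set} → Σ Bool B ↔ (B false ⊎ B true)
ΣBool↔ = mk↔ₛ′ (λ { (false , x) → inj₁ x ; (true , x) → inj₂ x }) [ (false ,_) , (true ,_) ]′
  (λ { (inj₁ _) → refl ; (inj₂ _) → refl }) (λ { (false , _) → refl ; (true , _) → refl })

Cell : Set
Cell = Maybe Bool

Tapes : Set
Tapes = Vec (Tape Cell) 3

Action : Set
Action = Cell × Move

-- The clauses of `Run.move` for the fixed alphabet `Cell`: fragments are combined before any `TM`
-- exists, and `act≗perform` later identifies the two.
shift : Move → Tape Cell → Tape Cell
shift stay  t                    = t
shift left  (tape []       s rs) = tape [] nothing (s ∷ rs)
shift left  (tape (l ∷ ls) s rs) = tape ls l (s ∷ rs)
shift right (tape ls s [])       = tape (s ∷ ls) nothing []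
shift right (tape ls s (r ∷ rs)) = tape (s ∷ ls) r rs

perform : Action → Tape Cell → Tape Cell
perform (s , m) (tape ls _ rs) = shift m (tape ls s rs)

-- inj₂ e leaves the control with the answer e.
record Fragment : Set₁ where
  field
    Q      : Set
    finite : Finite Q
    start  : Q
    δ      : Q → Vec Cell 3 → (Q ⊎ Bool) × Vec Action 3

  control : Q → Tapes → Q ⊎ Bool
  control q ts = proj₁ (δ q (Vec.map scanned ts))

  after-step : Q → Tapes → Tapes
  after-step q ts = Vec.zipWith perform (proj₂ (δ q (Vec.map scanned ts))) ts

open Fragment

-- The number of steps is only an upper bound.
data Reach (F : Fragment) : Q F → Tapes → ℕ → Bool → Tapes → Set where
  leave : ∀ {q ts n e} → control F q ts ≡ inj₂ e → Reach F q ts (suc n) e (after-step F q ts)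
  go    : ∀ {q q′ ts n e ts′} → control F q ts ≡ inj₁ q′ →
          Reach F q′ (after-step F q ts) n e ts′ → Reach F q ts (suc n) e ts′

-- The number of trailing blanks is left open and may be zero: popping the last listed cell moves
-- the head onto a blank that was not listed before, and a later push keeps it listed.
data Shows : List Cell → List Bool → Set where
  blanks : ∀ {ss} → All (_≡ nothing) ss → Shows ss []
  _∷_    : ∀ b {ss bs} → Shows ss bs → Shows (just b ∷ ss) (b ∷ bs)

-- A tape is used as a stack: its top is under the head, and whatever is to
-- the left of the head is garbage.
IsStack : Tape Cell → List Bool → Set
IsStack t bs = Shows (scanned t ∷ after t) bs

Stacks : Set
Stacks = Vec (List Bool) 3

Represents : Tapes → Stacks → Set
Represents = Pointwise IsStack

Reach-weaken : ∀ {F q ts m n e ts′} → m ≤ n → Reach F q ts m e ts′ → Reach F q ts n e ts′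
Reach-weaken (s≤s m≤n) (leave eq) = leave eq
Reach-weaken (s≤s m≤n) (go eq r)  = go eq (Reach-weaken m≤n r)

-- Fragments for stack operations, sequencing and loops

onTape : Fin 3 → Action → Vec Cell 3 → Vec Action 3
onTape i a ss = Vec.map (_, stay) ss [ i ]≔ a

onTape-effect : ∀ i a (ts : Tapes) →
  Vec.zipWith perform (onTape i a (Vec.map scanned ts)) ts ≡ ts [ i ]%= perform a
onTape-effect 0F a (_ ∷ _ ∷ _ ∷ []) = refl
onTape-effect 1F a (_ ∷ _ ∷ _ ∷ []) = refl
onTape-effect 2F a (_ ∷ _ ∷ _ ∷ []) = refl

Represents-update : ∀ i {ts S f g} → (∀ t {bs} → IsStack t bs → IsStack (f t) (g bs)) →
  Represents ts S → Represents (ts [ i ]%= f) (S [ i ]%= g)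
Represents-update 0F {t ∷ _}         h (p ∷ ps)         = h t p ∷ ps
Represents-update 1F {_ ∷ t ∷ _}     h (p ∷ q ∷ ps)     = p ∷ h t q ∷ ps
Represents-update 2F {_ ∷ _ ∷ t ∷ _} h (p ∷ q ∷ r ∷ ps) = p ∷ q ∷ h t r ∷ ps

scanned-top : ∀ t {bs} → IsStack t bs → scanned t ≡ head bs
scanned-top _ (blanks (eq ∷ _)) = eq
scanned-top _ (b ∷ _)           = refl

scanned-lookup : ∀ i {ts S} → Represents ts S → lookup (Vec.map scanned ts) i ≡ head (lookup S i)
scanned-lookup 0F {t ∷ _ ∷ _ ∷ []} (p ∷ _)         = scanned-top t p
scanned-lookup 1F {_ ∷ t ∷ _ ∷ []} (_ ∷ p ∷ _)     = scanned-top t p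
scanned-lookup 2F {_ ∷ _ ∷ t ∷ []} (_ ∷ _ ∷ p ∷ _) = scanned-top t p

ret′ : Bool → Fragment
ret′ e = record
  { Q = ⊤ ; finite = finite-⊤ ; start = tt
  ; δ = λ _ ss → inj₂ e , Vec.map (_, stay) ss }

pop′ : Fin 3 → Fragment
pop′ i = record
  { Q = ⊤ ; finite = finite-⊤ ; start = tt
  ; δ = λ _ ss → inj₂ (fromMaybe false (lookup ss i)) , onTape i (nothing , right) ss }

empty?′ : Fin 3 → Fragment
empty?′ i = record
  { Q = ⊤ ; finite = finite-⊤ ; start = tt
  ; δ = λ _ ss → inj₂ (is-nothing (lookup ss i)) , Vec.map (_, stay) ss }

-- An action writes before it moves, so a push has two phases: the first rewrites the old top
-- unchanged and steps left, the second overwrites the garbage found there.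
push′ : Fin 3 → Bool → Fragment
push′ i b = record
  { Q = Bool ; finite = finite-Bool ; start = false
  ; δ = λ { false ss → inj₁ true , onTape i (lookup ss i , left) ss
          ; true  ss → inj₂ b    , onTape i (just b , stay) ss } }

-- The answer of the first fragment survives as the index of the continuation that is entered; the
-- states of both continuations are therefore included.
bind′ : Fragment → (Bool → Fragment) → Fragment
bind′ F G = record
  { Q      = Q F ⊎ Σ Bool (Q ∘ G)
  ; finite = finite-⊎ (finite F) (finite-via ΣBool↔ (finite-⊎ (finite (G false)) (finite (G true))))
  ; start  = inj₁ (start F)
  ; δ      = λ { (inj₁ q)       ss → map₁ (inj₁ ∘ [ inj₁ , (λ e → inj₂ (e , start (G e))) ]′) (δ F q ss)
               ; (inj₂ (e , q)) ss → map₁ [ (λ q′ → inj₁ (inj₂ (e , q′))) , inj₂ ]′ (δ (G e) q ss) } }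

loop′ : Fragment → Fragment
loop′ F = record
  { Q      = Q F
  ; finite = finite F
  ; start  = start F
  ; δ      = λ q ss → map₁ [ inj₁ , (λ e → if e then inj₁ (start F) else inj₂ false) ]′ (δ F q ss) }

module _ {F : Fragment} {G : Bool → Fragment} where

  reach-second : ∀ {e q ts n e′ ts′} → Reach (G e) q ts n e′ ts′ → Reach (bind′ F G) (inj₂ (e , q)) ts n e′ ts′
  reach-second (leave eq) = leave (cong [ _ , inj₂ ]′ eq)
  reach-second (go eq r)  = go (cong [ _ , inj₂ ]′ eq) (reach-second r)

  reach-first : ∀ {q ts m e ts′ n e′ ts″} → Reach F q ts m e ts′ → Reach (G e) (start (G e)) ts′ n e′ ts″ →
    Reach (bind′ F G) (inj₁ q) ts (m + n) e′ ts″
  reach-first {n = n} (leave {n = k} eq) r′ =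
    go (cong (inj₁ ∘ [ inj₁ , _ ]′) eq) (Reach-weaken (m≤n+m n k) (reach-second r′))
  reach-first (go eq r) r′ = go (cong (inj₁ ∘ [ inj₁ , _ ]′) eq) (reach-first r r′)

module _ {F : Fragment} where

  reach-stop : ∀ {q ts n ts′} → Reach F q ts n false ts′ → Reach (loop′ F) q ts n false ts′
  reach-stop (leave eq) = leave (cong [ inj₁ , _ ]′ eq)
  reach-stop (go eq r)  = go (cong [ inj₁ , _ ]′ eq) (reach-stop r)

  reach-again : ∀ {q ts m ts′ n e ts″} → Reach F q ts m true ts′ → Reach (loop′ F) (start F) ts′ n e ts″ →
    Reach (loop′ F) q ts (m + n) e ts″
  reach-again {n = n} (leave {n = k} eq) r′ = go (cong [ inj₁ , _ ]′ eq) (Reach-weaken (m≤n+m n k) r′)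
  reach-again (go eq r) r′ = go (cong [ inj₁ , _ ]′ eq) (reach-again r r′)

-- Structured programs on three stacks

infixl 1 _>>=_ _>>_

-- Popping an empty stack answers false; loop P repeats P as long as it answers true.
data Program : Set where
  ret    : Bool → Program
  pop    : Fin 3 → Program
  empty? : Fin 3 → Program
  push   : Fin 3 → Bool → Program
  _>>=_  : Program → (Bool → Program) → Program
  loop   : Program → Program

_>>_ : Program → Program → Program
P >> R = P >>= λ _ → R

compile : Program → Fragment
compile (ret e)    = ret′ e
compile (pop i)    = pop′ i
compile (empty? i) = empty?′ i
compile (push i b) = push′ i b
compile (P >>= R)  = bind′ (compile P) (λ e → compile (R e))
compile (loop P)   = loop′ (compile P)

-- Quantified over all tapes representing `S`: the garbage before the head and the blanks after the
-- stack depend on the history, and no program may rely on them.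
record Runs (P : Program) (S : Stacks) (n : ℕ) (e : Bool) (S′ : Stacks) : Set where
  constructor mkRuns
  field
    reaches : ∀ {ts} → Represents ts S →
              ∃[ ts′ ] (Reach (compile P) (start (compile P)) ts n e ts′ × Represents ts′ S′)

open Runs

runs-weaken : ∀ {P S m n e S′} → m ≤ n → Runs P S m e S′ → Runs P S n e S′
runs-weaken m≤n run .reaches rep with ts′ , r , rep′ ← run .reaches rep = ts′ , Reach-weaken m≤n r , rep′

runs-ret : ∀ {e S} → Runs (ret e) S 1 e S
runs-ret .reaches {t ∷ u ∷ v ∷ []} rep = _ , leave refl , rep

topBit : List Bool → Bool
topBit bs = fromMaybe false (head bs)

pop-stack : ∀ t {bs} → IsStack t bs → IsStack (perform (nothing , right) t) (drop 1 bs)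
pop-stack (tape _ _ [])      (blanks _)           = blanks (refl ∷ [])
pop-stack (tape _ _ (_ ∷ _)) (blanks (_ ∷ p))     = blanks p
pop-stack (tape _ _ [])      (b ∷ blanks _)       = blanks (refl ∷ [])
pop-stack (tape _ _ (_ ∷ _)) (b ∷ p)              = p

runs-pop : ∀ i {S} → Runs (pop i) S 1 (topBit (lookup S i)) (S [ i ]%= drop 1)
runs-pop i .reaches {ts} rep =
    _ , leave (cong (inj₂ ∘ fromMaybe false) (scanned-lookup i rep))
  , subst (λ ts′ → Represents ts′ _) (sym (onTape-effect i _ ts)) (Represents-update i pop-stack rep)

runs-empty? : ∀ i {S} → Runs (empty? i) S 1 (is-nothing (head (lookup S i))) S
runs-empty? i .reaches {t ∷ u ∷ v ∷ []} rep = _ , leave (cong (inj₂ ∘ is-nothing) (scanned-lookup i rep)) , rep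

push-tape : Bool → Tape Cell → Tape Cell
push-tape b t = perform (just b , stay) (perform (scanned t , left) t)

push-stack : ∀ b t {bs} → IsStack t bs → IsStack (push-tape b t) (b ∷ bs)
push-stack b (tape [] _ _)      p = b ∷ p
push-stack b (tape (_ ∷ _) _ _) p = b ∷ p

push-effect : ∀ i b ts → after-step (push′ i b) true (after-step (push′ i b) false ts) ≡ ts [ i ]%= push-tape b
push-effect 0F b (_ ∷ _ ∷ _ ∷ []) = refl
push-effect 1F b (_ ∷ _ ∷ _ ∷ []) = refl
push-effect 2F b (_ ∷ _ ∷ _ ∷ []) = refl

runs-push : ∀ i b {S} → Runs (push i b) S 2 b (S [ i ]%= (b ∷_))
runs-push i b .reaches {ts} rep = _ , go refl (leave refl)
  , subst (λ ts′ → Represents ts′ _) (sym (push-effect i b ts)) (Represents-update i (push-stack b) rep)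

runs->>= : ∀ {P R S m e S′ n e′ S″} → Runs P S m e S′ → Runs (R e) S′ n e′ S″ → Runs (P >>= R) S (m + n) e′ S″
runs->>= runP runR .reaches rep
  with _ , r , rep′ ← runP .reaches rep with _ , r′ , rep″ ← runR .reaches rep′ =
  _ , reach-first r r′ , rep″

runs-stop : ∀ {P S n S′} → Runs P S n false S′ → Runs (loop P) S n false S′
runs-stop run .reaches rep with _ , r , rep′ ← run .reaches rep = _ , reach-stop r , rep′

runs-again : ∀ {P S m S′ n e S″} → Runs P S m true S′ → Runs (loop P) S′ n e S″ → Runs (loop P) S (m + n) e S″
runs-again runP runL .reaches rep
  with _ , r , rep′ ← runP .reaches rep with _ , r′ , rep″ ← runL .reaches rep′ =
  _ , reach-again r r′ , rep″

-- Growth of a stack is bounded by the running time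

perform-length : ∀ a t → length (after (perform a t)) ≤ suc (length (after t))
perform-length (_ , stay)  t                    = n≤1+n _
perform-length (_ , left)  (tape [] _ rs)       = ≤-refl
perform-length (_ , left)  (tape (_ ∷ _) _ rs)  = ≤-refl
perform-length (_ , right) (tape _ _ [])        = z≤n
perform-length (_ , right) (tape _ _ (_ ∷ rs))  = m≤n+m _ 2

shows-length : ∀ {ss bs} → Shows ss bs → length bs ≤ length ss
shows-length (blanks _) = z≤n
shows-length (_ ∷ p)    = s≤s (shows-length p)

mainLength : Tapes → ℕ
mainLength ts = length (after (Vec.head ts))

step-length : ∀ F q ts → mainLength (after-step F q ts) ≤ suc (mainLength ts)
step-length F q (t ∷ ts) with proj₂ (δ F q (Vec.map scanned (t ∷ ts)))
... | a ∷ _ = perform-length a t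

reach-length : ∀ {F q ts n e ts′} → Reach F q ts n e ts′ → mainLength ts′ ≤ n + mainLength ts
reach-length {F} {q} {ts} {suc n} (leave _) = ≤-trans (step-length F q ts) (s≤s (m≤n+m _ n))
reach-length {F} {q} {ts} {suc n} (go _ r)  =
  ≤-trans (reach-length r) (≤-trans (+-monoʳ-≤ n (step-length F q ts)) (≤-reflexive (+-suc n _)))

tapeOf : List Bool → Tape Cell
tapeOf []       = tape [] nothing []
tapeOf (b ∷ bs) = tape [] (just b) (map just bs)

tapeOf-isStack : ∀ bs → IsStack (tapeOf bs) bs
tapeOf-isStack []       = blanks (refl ∷ [])
tapeOf-isStack (b ∷ bs) = b ∷ shows bs
  where
  shows : ∀ bs → Shows (map just bs) bs
  shows []       = blanks []
  shows (b ∷ bs) = b ∷ shows bs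

tapeOf-length : ∀ bs → length (after (tapeOf bs)) ≤ length bs
tapeOf-length []       = z≤n
tapeOf-length (b ∷ bs) = m≤n⇒m≤1+n (≤-reflexive (length-map just bs))

-- The program is run on tapes that list no surplus blanks after a nonempty stack. Each step lists
-- at most one further cell after the head, and the scanned cell accounts for the successor.
runs-length : ∀ {P x s t n e x′ s′ t′} → Runs P (x ∷ s ∷ t ∷ []) n e (x′ ∷ s′ ∷ t′ ∷ []) → length x′ ≤ suc (n + length x)
runs-length {x = x} {s} {t} {n} run
  with (_ ∷ _) , r , (p ∷ _) ← run .reaches {tapeOf x ∷ tapeOf s ∷ tapeOf t ∷ []} (tapeOf-isStack x ∷ tapeOf-isStack s ∷ tapeOf-isStack t ∷ []) =
  ≤-trans (shows-length p) (s≤s (≤-trans (reach-length r) (+-monoʳ-≤ n (tapeOf-length x))))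

-- From a fragment to a Turing machine

machine : Fragment → TM
machine F = record
  { State         = Q F ⊎ Bool
  ; Symbol        = Cell
  ; state-finite  = finite-⊎ (finite F) finite-Bool
  ; symbol-finite = finite-via Maybe↔ (finite-⊎ finite-⊤ finite-Bool)
  ; extraTapes    = 2
  ; start         = inj₁ (start F)
  ; blank         = nothing
  ; bit           = just
  ; bit-injective = just-injective
  ; bit≢blank     = λ _ ()
  ; verdict       = [ (λ _ → nothing) , just ]′
  ; δ             = λ { (inj₁ q) ss → δ F q ss ; (inj₂ b) ss → inj₂ b , Vec.map (_, stay) ss } }

module _ (F : Fragment) where
  open Run (machine F)

  act≗perform : ∀ a t → act a t ≡ perform a t
  act≗perform (_ , stay)  _                    = refl
  act≗perform (_ , left)  (tape [] _ _)        = refl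
  act≗perform (_ , left)  (tape (_ ∷ _) _ _)   = refl
  act≗perform (_ , right) (tape _ _ [])        = refl
  act≗perform (_ , right) (tape _ _ (_ ∷ _))   = refl

  zipWith-act : ∀ {n} (as : Vec Action n) ts → Vec.zipWith act as ts ≡ Vec.zipWith perform as ts
  zipWith-act []       []       = refl
  zipWith-act (a ∷ as) (t ∷ ts) = cong₂ _∷_ (act≗perform a t) (zipWith-act as ts)

  step-next : ∀ q ts → step (inj₁ q , ts) ≡ (control F q ts , after-step F q ts)
  step-next q ts = cong (control F q ts ,_) (zipWith-act (proj₂ (δ F q (Vec.map scanned ts))) ts)

  steps-halted : ∀ n e ts → steps n (inj₂ e , ts) ≡ (inj₂ e , ts)
  steps-halted zero    e ts = refl
  steps-halted (suc n) e ts = steps-halted n e ts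

  reach-steps : ∀ {q ts n e ts′} → Reach F q ts n e ts′ → steps n (inj₁ q , ts) ≡ (inj₂ e , ts′)
  reach-steps {q} {ts} {suc n} {e} (leave eq) =
    trans (cong (steps n) (trans (step-next q ts) (cong (_, after-step F q ts) eq))) (steps-halted n e _)
  reach-steps {q} {ts} {suc n} (go eq r) =
    trans (cong (steps n) (trans (step-next q ts) (cong (_, after-step F q ts) eq))) (reach-steps r)

module _ (P : Program) where
  open Run (machine (compile P))

  initial-isStack : ∀ w → IsStack (tapeFrom (map just w)) w
  initial-isStack []      = tapeOf-isStack []
  initial-isStack (b ∷ w) = tapeOf-isStack (b ∷ w)

  runs-halts : ∀ {w n e S} → Runs P (w ∷ [] ∷ [] ∷ []) n e S → HaltsWithin n w e
  runs-halts {w} run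
    with _ , r , _ ← run .reaches {tapeFrom (map just w) ∷ tapeFrom [] ∷ tapeFrom [] ∷ []}
      (initial-isStack w ∷ blanks (refl ∷ []) ∷ blanks (refl ∷ []) ∷ []) =
    cong (TM.verdict (machine (compile P)) ∘ proj₁) (reach-steps (compile P) r)

-- Polynomials

-- Syntax instead of functions: monotonicity and the bound by a power then hold for every time bound
-- by induction, and composition is a constructor.
data Poly : Set where
  con           : ℕ → Poly
  var           : Poly
  _:+_ _:*_ _:∘_ : Poly → Poly → Poly

infixl 6 _:+_
infixl 7 _:*_
infixr 9 _:∘_
infix  8 _at_

_at_ : Poly → ℕ → ℕ
con c    at n = c
var      at n = n
(p :+ q) at n = p at n + q at n
(p :* q) at n = p at n * q at n
(p :∘ q) at n = p at (q at n)

at-mono : ∀ p {m n} → m ≤ n → p at m ≤ p at n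
at-mono (con c)  le = ≤-refl
at-mono var      le = le
at-mono (p :+ q) le = +-mono-≤ (at-mono p le) (at-mono q le)
at-mono (p :* q) le = *-mono-≤ (at-mono p le) (at-mono q le)
at-mono (p :∘ q) le = at-mono p (at-mono q le)

-- Powers of 2 + n, rather than of n, bound constants and are closed under sums.
at-bound : ∀ p → ∃[ d ] ∀ n → p at n ≤ (2 + n) ^ d
at-bound (con c) = c , λ n → ≤-trans (<⇒≤ (n<2^n c)) (^-monoˡ-≤ c (m≤m+n 2 n))
  where
  n<2^n : ∀ n → suc n ≤ 2 ^ n
  n<2^n zero    = s≤s z≤n
  n<2^n (suc n) = ≤-trans (+-mono-≤ (m^n>0 2 n) (n<2^n n)) (≤-reflexive (cong (2 ^ n +_) (sym (+-identityʳ _))))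
at-bound var = 1 , λ n → ≤-trans (m≤n+m n 2) (≤-reflexive (sym (*-identityʳ (2 + n))))
at-bound (p :+ q) with d , hp ← at-bound p with e , hq ← at-bound q = suc (d + e) , λ n →
  ≤-trans (+-mono-≤ (≤-trans (hp n) (^-monoʳ-≤ (2 + n) (m≤m+n d e))) (≤-trans (hq n) (^-monoʳ-≤ (2 + n) (m≤n+m e d))))
  (≤-trans (≤-reflexive (cong ((2 + n) ^ (d + e) +_) (sym (+-identityʳ _)))) (*-monoˡ-≤ ((2 + n) ^ (d + e)) (m≤m+n 2 n)))
at-bound (p :* q) with d , hp ← at-bound p with e , hq ← at-bound q = d + e , λ n →
  ≤-trans (*-mono-≤ (hp n) (hq n)) (≤-reflexive (sym (^-distribˡ-+-* (2 + n) d e)))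
at-bound (p :∘ q) with d , hp ← at-bound p with e , hq ← at-bound q = suc (suc e) * d , λ n →
  ≤-trans (hp (q at n))
  (≤-trans (^-monoˡ-≤ d (≤-trans (+-monoʳ-≤ 2 (hq n)) (step n e)))
           (≤-reflexive (^-*-assoc (2 + n) (suc (suc e)) d)))
  where
  -- With X = (2 + n) ^ e ≥ 1 one has 2 + X ≤ 4 X, and the factor 4 is paid by two more powers of 2
  -- + n.
  step : ∀ n e → 2 + (2 + n) ^ e ≤ (2 + n) ^ suc (suc e)
  step n e = begin
    2 + X                 ≤⟨ +-monoˡ-≤ X (*-monoʳ-≤ 2 (m^n>0 (2 + n) e)) ⟩
    2 * X + X             ≤⟨ m≤m+n (2 * X + X) X ⟩
    2 * X + X + X         ≡⟨ lemma X ⟩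
    2 * (2 * X)           ≤⟨ *-mono-≤ (m≤m+n 2 n) (*-monoˡ-≤ X (m≤m+n 2 n)) ⟩
    (2 + n) ^ suc (suc e) ∎
    where
    open ≤-Reasoning
    X = (2 + n) ^ e
    lemma : ∀ X → 2 * X + X + X ≡ 2 * (2 * X)
    lemma = solve-∀

-- The form that `InP` asks for. If n ≥ 1, then 2 + n ≤ 3 n; the additive constant takes care of n =
-- 0.
at-bound′ : ∀ p → ∃[ c ] ∃[ d ] ∀ n → p at n ≤ c * n ^ d + c
at-bound′ p with d , h ← at-bound p = 3 ^ d , d , λ n → ≤-trans (h n) (bound d n)
  where
  bound : ∀ d n → (2 + n) ^ d ≤ 3 ^ d * n ^ d + 3 ^ d
  bound d zero    = ≤-trans (^-monoˡ-≤ d (m≤m+n 2 1)) (m≤n+m _ _)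
  bound d (suc n) = ≤-trans (^-monoˡ-≤ d (≤-trans (m≤m+n (3 + n) (n + n)) (≤-reflexive (lemma n))))
    (≤-trans (≤-reflexive (^-distribʳ-* d 3 (suc n))) (m≤m+n _ _))
    where
    lemma : ∀ n → 3 + n + (n + n) ≡ 3 * suc n
    lemma = solve-∀
    ^-distribʳ-* : ∀ d a b → (a * b) ^ d ≡ a ^ d * b ^ d
    ^-distribʳ-* zero    a b = refl
    ^-distribʳ-* (suc d) a b = trans (cong (a * b *_) (^-distribʳ-* d a b)) (assoc a b (a ^ d) (b ^ d))
      where
      assoc : ∀ a b x y → a * b * (x * y) ≡ a * x * (b * y)
      assoc = solve-∀

-- A universe of data types with prefix-free codes

infixr 4 _⊠_
infixr 3 _⊞_

data U : Set where
  unit bool : U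
  _⊠_ _⊞_   : U → U → U
  opt list  : U → U

El : U → Set
El unit     = ⊤
El bool     = Bool
El (u ⊠ v)  = El u × El v
El (u ⊞ v)  = El u ⊎ El v
El (opt u)  = Maybe (El u)
El (list u) = List (El u)

-- Chosen to reproduce the given encoding bit by bit: the tags of `_⊞_` are those of points, labels
-- and operations, and a number is the `list bool` of its digits. Pairs need no separator because
-- every code is prefix-free.
enc : ∀ {u} → El u → List Bool
enc {unit}   _        = []
enc {bool}   b        = b ∷ []
enc {u ⊠ v}  (x , y)  = enc x ++ enc y
enc {u ⊞ v}  (inj₁ x) = false ∷ enc x
enc {u ⊞ v}  (inj₂ y) = true ∷ enc y
enc {opt u}  nothing  = false ∷ []
enc {opt u}  (just x) = true ∷ enc x
enc {list u} xs       = encodeList enc xs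

size : ∀ {u} → El u → ℕ
size x = length (enc x)

-- Moving typed data between the stacks

Does : Program → Stacks → ℕ → Stacks → Set
Does P S n S′ = ∃[ e ] Runs P S n e S′

does-weaken : ∀ {P S m n S′} → m ≤ n → Does P S m S′ → Does P S n S′
does-weaken m≤n (e , run) = e , runs-weaken m≤n run

does->> : ∀ {P R S m S′ n S″} → Does P S m S′ → Does R S′ n S″ → Does (P >> R) S (m + n) S″
does->> (_ , runF) (e , runG) = e , runs->>= runF runG

does-≡ : ∀ {P S m S′ T n T′} → S ≡ T → m ≤ n → S′ ≡ T′ → Does P S m S′ → Does P T n T′
does-≡ refl m≤n refl = does-weaken m≤n

Aux : Set
Aux = Vec (List Bool) 2

-- Reads exactly one code of type `u` off the first stack and performs `act` on each bit. The type
-- serves as the parser, so nothing marks the end of the code; `act` leaves the first stack alone,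
-- so the position is never lost.
module Walk
  (act : Bool → Program) (φ : Aux → Bool → Aux) (c : ℕ)
  (does : ∀ b r aux → Does (act b) (r ∷ aux) c (r ∷ φ aux b)) where

  walkBit : Program
  walkBit = pop 0F >>= λ b → act b >> ret b

  runs-walkBit : ∀ b {r aux} → Runs walkBit ((b ∷ r) ∷ aux) (2 + c) b (r ∷ φ aux b)
  runs-walkBit b {r} {aux} = runs-weaken (≤-reflexive (cong suc (+-comm c 1)))
    (runs->>= (runs-pop 0F) (runs->>= (proj₂ (does b r aux)) runs-ret))

  walk : U → Program
  walk unit     = ret false
  walk bool     = walkBit
  walk (u ⊠ v)  = walk u >> walk v
  walk (u ⊞ v)  = walkBit >>= λ b → if b then walk v else walk u
  walk (opt u)  = walkBit >>= λ b → if b then walk u else ret false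
  walk (list u) = loop (walkBit >>= λ b → if b then walk u >> ret true else ret false)

  -- The time per bit. The walk is charged `suc (size x)` units, since even a type with an empty
  -- code costs a step.
  unitCost : U → ℕ
  unitCost unit     = 1
  unitCost bool     = 2 + c
  unitCost (u ⊠ v)  = unitCost u + unitCost v
  unitCost (u ⊞ v)  = (2 + c) + (unitCost u + unitCost v)
  unitCost (opt u)  = (3 + c) + unitCost u
  unitCost (list u) = (3 + c) + unitCost u

  does-walk : ∀ {u} (x : El u) r aux →
    Does (walk u) ((enc x ++ r) ∷ aux) (unitCost u * suc (size x)) (r ∷ foldl φ aux (enc x))

  runs-walkList : ∀ {u} (xs : List (El u)) r aux →
    Runs (walk (list u)) ((enc xs ++ r) ∷ aux) (unitCost (list u) * suc (size xs)) false
        (r ∷ foldl φ aux (enc xs))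

  does-walk {unit} x r aux = false , runs-ret
  does-walk {bool} b r aux = b , runs-weaken (m≤m*n (2 + c) 2) (runs-walkBit b)
  does-walk {u ⊠ v} (x , y) r aux = does-≡
    (cong (_∷ aux) (sym (++-assoc (enc x) (enc y) r)))
    (begin
      unitCost u * suc (size x) + unitCost v * suc (size y)
        ≤⟨ m≤m+n _ (unitCost u * size y + unitCost v * size x) ⟩
      unitCost u * suc (size x) + unitCost v * suc (size y) + (unitCost u * size y + unitCost v * size x)
        ≡⟨ lemma (unitCost u) (unitCost v) (size x) (size y) ⟩
      (unitCost u + unitCost v) * suc (size x + size y)
        ≡⟨ cong (λ n → (unitCost u + unitCost v) * suc n) (sym (length-++ (enc x))) ⟩
      (unitCost u + unitCost v) * suc (length (enc x ++ enc y)) ∎)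
    (cong (r ∷_) (sym (foldl-++ φ aux (enc x) (enc y))))
    (does->> (does-walk x (enc y ++ r) aux) (does-walk y r (foldl φ aux (enc x))))
    where
    open ≤-Reasoning
    lemma : ∀ k l m n → k * suc m + l * suc n + (k * n + l * m) ≡ (k + l) * suc (m + n)
    lemma = solve-∀
  does-walk {u ⊞ v} (inj₁ x) r aux with e , run ← does-walk x r (φ aux false) =
    e , runs-weaken (lemma′ (2 + c) (unitCost u) (unitCost v) (size x)) (runs->>= (runs-walkBit false) run)
    where
    lemma : ∀ d k l n → d + k * suc n + ((k + l + d) + (d * n + l * suc n)) ≡ (d + (k + l)) * suc (suc n)
    lemma = solve-∀
    lemma′ : ∀ d k l n → d + k * suc n ≤ (d + (k + l)) * suc (suc n)
    lemma′ d k l n = ≤-trans (m≤m+n _ _) (≤-reflexive (lemma d k l n))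
  does-walk {u ⊞ v} (inj₂ y) r aux with e , run ← does-walk y r (φ aux true) =
    e , runs-weaken (lemma′ (2 + c) (unitCost u) (unitCost v) (size y)) (runs->>= (runs-walkBit true) run)
    where
    lemma : ∀ d k l n → d + l * suc n + ((k + l + d) + (d * n + k * suc n)) ≡ (d + (k + l)) * suc (suc n)
    lemma = solve-∀
    lemma′ : ∀ d k l n → d + l * suc n ≤ (d + (k + l)) * suc (suc n)
    lemma′ d k l n = ≤-trans (m≤m+n _ _) (≤-reflexive (lemma d k l n))
  does-walk {opt u} nothing r aux = false ,
    runs-weaken (lemma′ (2 + c) (unitCost u)) (runs->>= (runs-walkBit false) runs-ret)
    where
    lemma : ∀ d k → d + 1 + (d + k + k + 1) ≡ (suc d + k) * 2
    lemma = solve-∀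
    lemma′ : ∀ d k → d + 1 ≤ (suc d + k) * 2
    lemma′ d k = ≤-trans (m≤m+n _ _) (≤-reflexive (lemma d k))
  does-walk {opt u} (just x) r aux with e , run ← does-walk x r (φ aux true) =
    e , runs-weaken (lemma′ (2 + c) (unitCost u) (size x)) (runs->>= (runs-walkBit true) run)
    where
    lemma : ∀ d k n → d + k * suc n + (suc d * suc n + 1 + k) ≡ (suc d + k) * suc (suc n)
    lemma = solve-∀
    lemma′ : ∀ d k n → d + k * suc n ≤ (suc d + k) * suc (suc n)
    lemma′ d k n = ≤-trans (m≤m+n _ _) (≤-reflexive (lemma d k n))
  does-walk {list u} xs r aux = false , runs-walkList xs r aux

  runs-walkList {u} [] r aux =
    runs-weaken (lemma′ (2 + c) (unitCost u)) (runs-stop (runs->>= (runs-walkBit false) runs-ret))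
    where
    lemma : ∀ d k → d + 1 + (d + k + k + 1) ≡ (suc d + k) * 2
    lemma = solve-∀
    lemma′ : ∀ d k → d + 1 ≤ (suc d + k) * 2
    lemma′ d k = ≤-trans (m≤m+n _ _) (≤-reflexive (lemma d k))
  runs-walkList {u} (x ∷ xs) r aux
    with e , run ← does-walk x (enc xs ++ r) (φ aux true) =
    subst₂ (λ R A → Runs (walk (list u)) ((true ∷ R) ∷ aux) _ false (r ∷ A))
      (sym (++-assoc (enc x) (enc xs) r))
      (sym (foldl-++ φ (φ aux true) (enc x) (enc xs)))
    (runs-weaken (≤-trans (m≤m+n _ _) (≤-reflexive (trans (lemma (2 + c) (unitCost u) (size x) (size xs))
                  (cong (λ n → unitCost (list u) * suc (suc n)) (sym (length-++ (enc x)))))))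
      (runs-again (runs->>= (runs-walkBit true) (runs->>= run (runs-ret {true})))
                 (runs-walkList xs r (foldl φ (φ aux true) (enc x)))))
    where
    lemma : ∀ d k m n → d + (k * suc m + 1) + (suc d + k) * suc n + suc d * m ≡ (suc d + k) * suc (suc (m + n))
    lemma = solve-∀

-- Bits moved to another stack arrive in reverse, and a reversed code need not be prefix-free. Hence
-- each shelved bit gets a marker `true` on top of it, and `false` closes the block.
flags : List Bool → List Bool → List Bool
flags []       s = false ∷ s
flags (c ∷ cs) s = true ∷ c ∷ flags cs s

flag : List Bool → Bool → List Bool
flag s b = true ∷ b ∷ s

foldl-flag : ∀ bs cs s → foldl flag (flags cs s) bs ≡ flags (bs ʳ++ cs) s
foldl-flag []       cs s = refl
foldl-flag (b ∷ bs) cs s = foldl-flag bs (b ∷ cs) s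

foldl-∷ : ∀ (bs : List Bool) r → foldl (flip _∷_) r (reverse bs) ≡ bs ++ r
foldl-∷ bs r = trans (ʳ++-defn (reverse bs)) (cong (_++ r) (reverse-involutive bs))

-- The converse of a walk: a marked block is consumed from stack `i` with no knowledge of its type.
-- `emb` inserts stack `i` among the others, whose relevant contents `Z` evolve by `ψ`.
module Unwind
  (i : Fin 3) {Z : Set} (emb : Z → List Bool → Stacks)
  (lookup-emb : ∀ z l → lookup (emb z l) i ≡ l) (update-emb : ∀ z l f → emb z l [ i ]%= f ≡ emb z (f l))
  (act : Bool → Program) (ψ : Z → Bool → Z) (c : ℕ)
  (does : ∀ z b l → Does (act b) (emb z l) c (emb (ψ z b) l)) where

  unwind : Program
  unwind = loop (pop i >>= λ m → if m then pop i >>= act >> ret true else ret false)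

  runs-pops : ∀ z b l → Runs (pop i) (emb z (b ∷ l)) 1 b (emb z l)
  runs-pops z b l = subst₂ (Runs (pop i) (emb z (b ∷ l)) 1)
    (cong topBit (lookup-emb z (b ∷ l))) (update-emb z (b ∷ l) (drop 1)) (runs-pop i)

  runs-unwind : ∀ cs z s → Runs unwind (emb z (flags cs s)) (suc (length cs) * (4 + c)) false (emb (foldl ψ z cs) s)
  runs-unwind []       z s = runs-weaken (m≤m+n 2 (2 + c + 0)) (runs-stop (runs->>= (runs-pops z false s) runs-ret))
  runs-unwind (b ∷ cs) z s = runs-weaken (+-monoˡ-≤ (suc (length cs) * (4 + c)) (≤-trans (≤-reflexive (lemma c)) (n≤1+n (3 + c))))
    (runs-again
      (runs->>= (runs-pops z true (b ∷ flags cs s))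
        (runs->>= (runs->>= (runs-pops z b (flags cs s)) (proj₂ (does z b (flags cs s)))) runs-ret))
      (runs-unwind cs (ψ z b) s))
    where
    lemma : ∀ c → 1 + (1 + c + 1) ≡ 3 + c
    lemma = solve-∀

-- Shelving data on the auxiliary stacks and bringing it back

module Skip = Walk (λ _ → ret false) (λ aux _ → aux) 1 (λ _ _ _ → false , runs-ret)

module Send (j : Fin 2) = Walk
  (λ b → push (Fin.suc j) b >> push (Fin.suc j) true) (λ aux b → aux [ j ]%= (b ∷_) [ j ]%= (true ∷_)) 4
  (λ b r aux → true , runs->>= (runs-push (Fin.suc j) b) (runs-push (Fin.suc j) true))

sendCost : U → ℕ
sendCost u = Send.unitCost 0F u + Send.unitCost 1F u

foldl-const : ∀ {A B : Set} (x : A) (ys : List B) → foldl (λ x _ → x) x ys ≡ x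
foldl-const x []       = refl
foldl-const x (_ ∷ ys) = foldl-const x ys

does-skip : ∀ {u} (x : El u) r aux → Does (Skip.walk u) ((enc x ++ r) ∷ aux) (Skip.unitCost u * suc (size x)) (r ∷ aux)
does-skip x r aux = does-≡ refl ≤-refl (cong (r ∷_) (foldl-const aux (enc x))) (Skip.does-walk x r aux)

send : Fin 2 → U → Program
send j u = push (Fin.suc j) false >> Send.walk j u

does-send₁ : ∀ {u} (x : El u) r s t → Does (send 0F u) ((enc x ++ r) ∷ s ∷ t ∷ [])
  (2 + sendCost u * suc (size x)) (r ∷ flags (reverse (enc x)) s ∷ t ∷ [])
does-send₁ {u} x r s t = does-≡ refl (+-monoʳ-≤ 2 (*-monoˡ-≤ (suc (size x)) (m≤m+n (Send.unitCost 0F u) (Send.unitCost 1F u))))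
  (cong (r ∷_) (trans (fold (enc x) (false ∷ s)) (cong (λ l → l ∷ t ∷ []) (foldl-flag (enc x) [] s))))
  (does->> (_ , runs-push 1F false) (Send.does-walk 0F x r ((false ∷ s) ∷ t ∷ [])))
  where
  fold : ∀ bs s → foldl (λ aux b → aux [ 0F ]%= (b ∷_) [ 0F ]%= (true ∷_)) (s ∷ t ∷ []) bs ≡ foldl flag s bs ∷ t ∷ []
  fold []       s = refl
  fold (b ∷ bs) s = fold bs (true ∷ b ∷ s)

does-send₂ : ∀ {u} (x : El u) r s t → Does (send 1F u) ((enc x ++ r) ∷ s ∷ t ∷ [])
  (2 + sendCost u * suc (size x)) (r ∷ s ∷ flags (reverse (enc x)) t ∷ [])
does-send₂ {u} x r s t = does-≡ refl (+-monoʳ-≤ 2 (*-monoˡ-≤ (suc (size x)) (m≤n+m (Send.unitCost 1F u) (Send.unitCost 0F u))))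
  (cong (r ∷_) (trans (fold (enc x) (false ∷ t)) (cong (λ l → s ∷ l ∷ []) (foldl-flag (enc x) [] t))))
  (does->> (_ , runs-push 2F false) (Send.does-walk 1F x r (s ∷ (false ∷ t) ∷ [])))
  where
  fold : ∀ bs t → foldl (λ aux b → aux [ 1F ]%= (b ∷_) [ 1F ]%= (true ∷_)) (s ∷ t ∷ []) bs ≡ s ∷ foldl flag t bs ∷ []
  fold []       t = refl
  fold (b ∷ bs) t = fold bs (true ∷ b ∷ t)

around₁ around₂ : List Bool × List Bool → List Bool → Stacks
around₁ (m , t) l = m ∷ l ∷ t ∷ []
around₂ (m , s) l = m ∷ s ∷ l ∷ []

module Restore₁ = Unwind 1F around₁ (λ _ _ → refl) (λ _ _ _ → refl)
  (push 0F) (λ (m , t) b → b ∷ m , t) 2 (λ _ b _ → b , runs-push 0F b)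

module Restore₂ = Unwind 2F around₂ (λ _ _ → refl) (λ _ _ _ → refl)
  (push 0F) (λ (m , s) b → b ∷ m , s) 2 (λ _ b _ → b , runs-push 0F b)

module Duplicate = Unwind 1F around₁ (λ _ _ → refl) (λ _ _ _ → refl)
  (λ b → push 0F b >> (push 2F b >> push 2F true)) (λ (m , t) b → b ∷ m , flag t b) 6
  (λ _ b _ → true , runs->>= (runs-push 0F b) (runs->>= (runs-push 2F b) (runs-push 2F true)))

module Transfer = Unwind 2F around₂ (λ _ _ → refl) (λ _ _ _ → refl)
  (λ b → push 1F b >> push 1F true) (λ (m , s) b → m , flag s b) 4
  (λ _ b _ → true , runs->>= (runs-push 1F b) (runs-push 1F true))

foldl-× : ∀ {A B C : Set} (f : A → C → A) (g : B → C → B) x y zs →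
  foldl (λ (x , y) z → f x z , g y z) (x , y) zs ≡ (foldl f x zs , foldl g y zs)
foldl-× f g x y []       = refl
foldl-× f g x y (z ∷ zs) = foldl-× f g (f x z) (g y z) zs

does-restore₁ : ∀ bs r s t → Does Restore₁.unwind (r ∷ flags (reverse bs) s ∷ t ∷ []) (suc (length bs) * 6) ((bs ++ r) ∷ s ∷ t ∷ [])
does-restore₁ bs r s t = does-≡ refl (≤-reflexive (cong (λ n → suc n * 6) (length-reverse bs)))
  (cong (λ z → around₁ z s) (trans (foldl-× (flip _∷_) (λ t _ → t) r t (reverse bs))
    (cong₂ _,_ (foldl-∷ bs r) (foldl-const t (reverse bs)))))
  (_ , Restore₁.runs-unwind (reverse bs) (r , t) s)

does-restore₂ : ∀ bs r s t → Does Restore₂.unwind (r ∷ s ∷ flags (reverse bs) t ∷ []) (suc (length bs) * 6) ((bs ++ r) ∷ s ∷ t ∷ [])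
does-restore₂ bs r s t = does-≡ refl (≤-reflexive (cong (λ n → suc n * 6) (length-reverse bs)))
  (cong (λ z → around₂ z t) (trans (foldl-× (flip _∷_) (λ s _ → s) r s (reverse bs))
    (cong₂ _,_ (foldl-∷ bs r) (foldl-const s (reverse bs)))))
  (_ , Restore₂.runs-unwind (reverse bs) (r , s) t)

does-duplicate : ∀ bs r s t → Does Duplicate.unwind (r ∷ flags (reverse bs) s ∷ (false ∷ t) ∷ [])
  (suc (length bs) * 10) ((bs ++ r) ∷ s ∷ flags bs t ∷ [])
does-duplicate bs r s t = does-≡ refl (≤-reflexive (cong (λ n → suc n * 10) (length-reverse bs)))
  (cong (λ z → around₁ z s) (trans (foldl-× (flip _∷_) flag r (false ∷ t) (reverse bs))
    (cong₂ _,_ (foldl-∷ bs r) (trans (foldl-flag (reverse bs) [] t) (cong (λ l → flags l t) (reverse-involutive bs))))))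
  (_ , Duplicate.runs-unwind (reverse bs) (r , false ∷ t) s)

does-transfer : ∀ bs r s t → Does Transfer.unwind (r ∷ (false ∷ s) ∷ flags bs t ∷ [])
  (suc (length bs) * 8) (r ∷ flags (reverse bs) s ∷ t ∷ [])
does-transfer bs r s t = does-≡ refl ≤-refl
  (cong (λ z → around₂ z t) (trans (foldl-× (λ m _ → m) flag r (false ∷ s) bs)
    (cong₂ _,_ (foldl-const r bs) (foldl-flag bs [] s))))
  (_ , Transfer.runs-unwind bs (r , false ∷ s) t)

-- Polynomial-time functions

record FP {a b : U} (f : El a → El b) : Set where
  field
    program : Program
    time    : Poly
    correct : ∀ x r s t → Does program ((enc x ++ r) ∷ s ∷ t ∷ []) (time at size x) ((enc (f x) ++ r) ∷ s ∷ t ∷ [])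

open FP

-- The result is written bit by bit, so its size is bounded by the running time.
outBound : ∀ {a b} {f : El a → El b} → FP f → Poly
outBound F = con 1 :+ (time F :+ var)

size-out : ∀ {a b} {f : El a → El b} (F : FP f) x → size (f x) ≤ outBound F at size x
size-out {f = f} F x with e , run ← correct F x [] [] [] =
  subst₂ (λ y z → length y ≤ suc (time F at size x + length z)) (++-identityʳ (enc (f x))) (++-identityʳ (enc x))
    (runs-length run)

FP-cong : ∀ {a b} {f g : El a → El b} → (∀ x → f x ≡ g x) → FP f → FP g
FP-cong eq F = record
  { program = program F
  ; time    = time F
  ; correct = λ x r s t → subst (λ y → Does (program F) _ _ ((enc y ++ r) ∷ s ∷ t ∷ [])) (eq x) (correct F x r s t) }

-- Values of different types may have the same code, for instance differently nested pairs; then the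
-- stacks are left as they are.
FP-cast : ∀ {a b} {f : El a → El b} → (∀ x → enc (f x) ≡ enc x) → FP f
FP-cast eq = record
  { program = ret false
  ; time    = con 1
  ; correct = λ x r s t → does-≡ refl ≤-refl (cong (λ y → (y ++ r) ∷ s ∷ t ∷ []) (sym (eq x))) (_ , runs-ret) }

FP-id : ∀ {a} → FP (λ (x : El a) → x)
FP-id = FP-cast (λ _ → refl)

infixr 9 _∘FP_

_∘FP_ : ∀ {a b c} {g : El b → El c} {f : El a → El b} → FP g → FP f → FP (λ x → g (f x))
_∘FP_ {f = f} G F = record
  { program = program F >> program G
  ; time    = time F :+ time G :∘ outBound F
  ; correct = λ x r s t → does-weaken (+-monoʳ-≤ (time F at size x) (at-mono (time G) (size-out F x)))
      (does->> (correct F x r s t) (correct G (f x) r s t)) }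

pushAll : List Bool → Program
pushAll []       = ret false
pushAll (b ∷ bs) = pushAll bs >> push 0F b

does-pushAll : ∀ bs r aux → Does (pushAll bs) (r ∷ aux) (1 + length bs * 2) ((bs ++ r) ∷ aux)
does-pushAll []       r aux = _ , runs-ret
does-pushAll (b ∷ bs) r aux = does-weaken (≤-reflexive (cong suc (+-comm (length bs * 2) 2)))
  (does->> (does-pushAll bs r aux) (_ , runs-push 0F b))

FP-prefix : ∀ {a b} {f : El a → El b} bs → (∀ x → enc (f x) ≡ bs ++ enc x) → FP f
FP-prefix bs eq = record
  { program = pushAll bs
  ; time    = con (1 + length bs * 2)
  ; correct = λ x r s t → does-≡ refl ≤-refl
      (cong (λ l → l ∷ s ∷ t ∷ []) (trans (sym (++-assoc bs (enc x) r)) (cong (_++ r) (sym (eq x)))))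
      (does-pushAll bs (enc x ++ r) (s ∷ t ∷ [])) }

size-× : ∀ {u v} (x : El u) (y : El v) → size {u ⊠ v} (x , y) ≡ size x + size y
size-× x y = length-++ (enc x)

size-≤₁ : ∀ {u v} (x : El u) (y : El v) → size x ≤ size {u ⊠ v} (x , y)
size-≤₁ x y = ≤-trans (m≤m+n (size x) (size y)) (≤-reflexive (sym (size-× x y)))

size-≤₂ : ∀ {u v} (x : El u) (y : El v) → size y ≤ size {u ⊠ v} (x , y)
size-≤₂ x y = ≤-trans (m≤n+m (size y) (size x)) (≤-reflexive (sym (size-× x y)))

infixr 5 _≫_
_≫_ : ∀ {P R S m S′ n S″} → Does P S m S′ → Does R S′ n S″ → Does (P >> R) S (m + n) S″
_≫_ = does->>

FP-proj₂ : ∀ {a b} → FP {a ⊠ b} {b} proj₂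
FP-proj₂ {a} {b} = record
  { program = Skip.walk a
  ; time    = con (Skip.unitCost a) :* (con 1 :+ var)
  ; correct = λ (x , y) r s t → does-≡
      (cong (λ l → l ∷ s ∷ t ∷ []) (sym (++-assoc (enc x) (enc y) r)))
      (*-monoʳ-≤ (Skip.unitCost a) (s≤s (size-≤₁ x y))) refl
      (does-skip x (enc y ++ r) (s ∷ t ∷ [])) }

FP-first : ∀ {a b c} {f : El a → El b} → FP f → FP {a ⊠ c} {b ⊠ c} (map₁ f)
FP-first {f = f} F = record
  { program = program F
  ; time    = time F
  ; correct = λ (x , y) r s t → does-≡
      (cong (λ l → l ∷ s ∷ t ∷ []) (sym (++-assoc (enc x) (enc y) r)))
      (at-mono (time F) (size-≤₁ x y))
      (cong (λ l → l ∷ s ∷ t ∷ []) (sym (++-assoc (enc (f x)) (enc y) r)))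
      (correct F x (enc y ++ r) s t) }

FP-dip : ∀ {a b c} {f : El a → El b} → FP f → FP {c ⊠ a} {c ⊠ b} (λ (z , x) → z , f x)
FP-dip {c = c} {f} F = record
  { program = send 0F c >> (program F >> Restore₁.unwind)
  ; time    = con 2 :+ con (sendCost c) :* (con 1 :+ var) :+ (time F :+ (con 1 :+ var) :* con 6)
  ; correct = λ (z , x) r s t → does-≡
      (cong (λ l → l ∷ s ∷ t ∷ []) (sym (++-assoc (enc z) (enc x) r)))
      (+-mono-≤ (+-monoʳ-≤ 2 (*-monoʳ-≤ (sendCost c) (s≤s (size-≤₁ z x))))
        (+-mono-≤ (at-mono (time F) (size-≤₂ z x)) (*-monoˡ-≤ 6 (s≤s (size-≤₁ z x)))))
      (cong (λ l → l ∷ s ∷ t ∷ []) (sym (++-assoc (enc z) (enc (f x)) r)))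
      (does-send₁ z (enc x ++ r) s t ≫ correct F x r _ t ≫ does-restore₁ (enc z) (enc (f x) ++ r) s t) }

FP-swap : ∀ {a b} → FP {a ⊠ b} {b ⊠ a} swap
FP-swap {a} {b} = record
  { program = send 0F a >> (send 1F b >> (Restore₁.unwind >> Restore₂.unwind))
  ; time    = con 2 :+ con (sendCost a) :* (con 1 :+ var) :+ (con 2 :+ con (sendCost b) :* (con 1 :+ var)
              :+ ((con 1 :+ var) :* con 6 :+ (con 1 :+ var) :* con 6))
  ; correct = λ (x , y) r s t → does-≡
      (cong (λ l → l ∷ s ∷ t ∷ []) (sym (++-assoc (enc x) (enc y) r)))
      (+-mono-≤ (+-monoʳ-≤ 2 (*-monoʳ-≤ (sendCost a) (s≤s (size-≤₁ x y))))
        (+-mono-≤ (+-monoʳ-≤ 2 (*-monoʳ-≤ (sendCost b) (s≤s (size-≤₂ x y))))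
          (+-mono-≤ (*-monoˡ-≤ 6 (s≤s (size-≤₁ x y))) (*-monoˡ-≤ 6 (s≤s (size-≤₂ x y))))))
      (cong (λ l → l ∷ s ∷ t ∷ []) (sym (++-assoc (enc y) (enc x) r)))
      (does-send₁ x (enc y ++ r) s t ≫ does-send₂ y r _ t ≫ does-restore₁ (enc x) r s _ ≫ does-restore₂ (enc y) _ s t) }

-- Unwinding the shelved code restores it and at the same time leaves a second copy on the third
-- stack. That copy is in the opposite order, so it is turned round once more by `Transfer` before
-- it can be restored on top of the first.
FP-dup : ∀ {a} → FP {a} {a ⊠ a} (λ x → x , x)
FP-dup {a} = record
  { program = send 0F a >> (push 2F false >> (Duplicate.unwind >> (push 1F false >> (Transfer.unwind >> Restore₁.unwind))))
  ; time    = con 2 :+ con (sendCost a) :* (con 1 :+ var) :+ (con 2 :+ ((con 1 :+ var) :* con 10 :+ (con 2 :+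
              ((con 1 :+ var) :* con 8 :+ (con 1 :+ var) :* con 6))))
  ; correct = λ x r s t → does-≡ refl ≤-refl
      (cong (λ l → l ∷ s ∷ t ∷ []) (sym (++-assoc (enc x) (enc x) r)))
      (does-send₁ x r s t ≫ (_ , runs-push 2F false) ≫ does-duplicate (enc x) r s t
        ≫ (_ , runs-push 1F false) ≫ does-transfer (enc x) _ s t ≫ does-restore₁ (enc x) _ s t) }

-- One popped bit selects the case, and what remains must again be the code of some typed value.
-- Stated through codes, this serves booleans, options, sums and lists alike; behind the marker of a
-- nonempty list stands the code of its head, tail and context.
FP-branch : ∀ {a a₀ a₁ b} {f : El a → El b} {f₀ : El a₀ → El b} {f₁ : El a₁ → El b} →
  (∀ x → (∃[ y ] (enc x ≡ false ∷ enc y × f x ≡ f₀ y)) ⊎ (∃[ y ] (enc x ≡ true ∷ enc y × f x ≡ f₁ y))) →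
  FP f₀ → FP f₁ → FP f
FP-branch {f = f} view F₀ F₁ = record
  { program = pop 0F >>= λ b → if b then program F₁ else program F₀
  ; time    = con 1 :+ (time F₀ :+ time F₁)
  ; correct = branch }
  where
  branch : ∀ x r s t → Does (pop 0F >>= λ b → if b then program F₁ else program F₀) ((enc x ++ r) ∷ s ∷ t ∷ [])
    (1 + (time F₀ at size x + time F₁ at size x)) ((enc (f x) ++ r) ∷ s ∷ t ∷ [])
  branch x r s t with view x
  ... | inj₁ (y , eq , eq′) rewrite eq | eq′ with e , run ← correct F₀ y r s t =
    e , runs-weaken (s≤s (≤-trans (at-mono (time F₀) (n≤1+n (size y))) (m≤m+n _ _))) (runs->>= (runs-pop 0F) run)
  ... | inj₂ (y , eq , eq′) rewrite eq | eq′ with e , run ← correct F₁ y r s t =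
    e , runs-weaken (s≤s (≤-trans (at-mono (time F₁) (n≤1+n (size y))) (m≤n+m _ _))) (runs->>= (runs-pop 0F) run)

-- Here `n` bounds the rounds and `m` the size of every state on the way. Both are needed: few
-- rounds are no help if the state may double in each of them.
data Trace {a b : U} (body : El a → El b ⊎ El a) (m : ℕ) : ℕ → El a → El b → Set where
  stop : ∀ {n x y} → size x ≤ m → body x ≡ inj₁ y → Trace body m (suc n) x y
  next : ∀ {n x x′ y} → size x ≤ m → body x ≡ inj₂ x′ → Trace body m n x′ y → Trace body m (suc n) x y

-- The tag of the sum, popped after each round, is the answer that `loop` tests: `inj₂` has tag
-- `true` and continues.
FP-loop : ∀ {a b} {body : El a → El b ⊎ El a} {f : El a → El b} → FP {a} {b ⊞ a} body → (p : Poly) →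
  (∀ x → Trace body (p at size x) (p at size x) x (f x)) → FP f
FP-loop {a} {b} {body} {f} F p trace = record
  { program = loop (program F >> pop 0F)
  ; time    = p :* (time F :∘ p :+ con 1)
  ; correct = λ x r s t → _ , iterate (trace x) r s t }
  where
  iterate : ∀ {m n x y} → Trace body m n x y → ∀ r s t →
    Runs (loop (program F >> pop 0F)) ((enc x ++ r) ∷ s ∷ t ∷ []) (n * (time F at m + 1)) false ((enc y ++ r) ∷ s ∷ t ∷ [])
  iterate {m} {suc n} {x} (stop le eq) r s t with e , run ← correct F x r s t rewrite eq =
    runs-weaken (≤-trans (+-monoˡ-≤ 1 (at-mono (time F) le)) (m≤m+n _ _)) (runs-stop (runs->>= run (runs-pop 0F)))
  iterate {m} {suc n} {x} (next le eq tr) r s t with e , run ← correct F x r s t rewrite eq =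
    runs-again (runs-weaken (+-monoˡ-≤ 1 (at-mono (time F) le)) (runs->>= run (runs-pop 0F))) (iterate tr r s t)

-- Closure properties

FP-proj₁ : ∀ {a b} → FP {a ⊠ b} {a} proj₁
FP-proj₁ = FP-proj₂ ∘FP FP-swap

⟨_,_⟩ : ∀ {a b c} {f : El a → El b} {g : El a → El c} → FP f → FP g → FP {a} {b ⊠ c} (λ x → f x , g x)
⟨ F , G ⟩ = FP-dip G ∘FP FP-first F ∘FP FP-dup

-- The argument is read as a pair with `tt`, whose code is empty, and projected away; the code of
-- `y` is then put in front of nothing.
FP-const : ∀ {a b} (y : El b) → FP {a} (λ _ → y)
FP-const {a} {b} y = FP-prefix {unit} {b} (enc y) (λ _ → sym (++-identityʳ (enc y))) ∘FP FP-proj₂ {a} {unit}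
  ∘FP FP-cast {a} {a ⊠ unit} {λ x → x , tt} (λ x → ++-identityʳ (enc x))

FP-inj₁ : ∀ {a b} → FP {a} {a ⊞ b} inj₁
FP-inj₁ = FP-prefix (false ∷ []) (λ _ → refl)

FP-inj₂ : ∀ {a b} → FP {b} {a ⊞ b} inj₂
FP-inj₂ = FP-prefix (true ∷ []) (λ _ → refl)

FP-just : ∀ {a} → FP {a} {opt a} just
FP-just = FP-prefix (true ∷ []) (λ _ → refl)

FP-∷ : ∀ {a} → FP {a ⊠ list a} {list a} (uncurry _∷_)
FP-∷ = FP-prefix (true ∷ []) (λ _ → refl)

module _ {c d : U} where

  FP-if : {f : Bool × El c → El d} → FP (λ z → f (false , z)) → FP (λ z → f (true , z)) → FP {bool ⊠ c} f
  FP-if = FP-branch λ { (false , z) → inj₁ (z , refl , refl) ; (true , z) → inj₂ (z , refl , refl) }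

  FP-opt : ∀ {a} {f : Maybe (El a) × El c → El d} →
    FP (λ z → f (nothing , z)) → FP {a ⊠ c} (λ (x , z) → f (just x , z)) → FP {opt a ⊠ c} f
  FP-opt = FP-branch λ { (nothing , z) → inj₁ (z , refl , refl) ; (just x , z) → inj₂ ((x , z) , refl , refl) }

  FP-sum : ∀ {a b} {f : (El a ⊎ El b) × El c → El d} →
    FP {a ⊠ c} (λ (x , z) → f (inj₁ x , z)) → FP {b ⊠ c} (λ (y , z) → f (inj₂ y , z)) → FP {(a ⊞ b) ⊠ c} f
  FP-sum = FP-branch λ { (inj₁ x , z) → inj₁ ((x , z) , refl , refl) ; (inj₂ y , z) → inj₂ ((y , z) , refl , refl) }

  FP-list : ∀ {a} {f : List (El a) × El c → El d} →
    FP (λ z → f ([] , z)) → FP {a ⊠ list a ⊠ c} (λ (x , xs , z) → f (x ∷ xs , z)) → FP {list a ⊠ c} f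
  FP-list = FP-branch λ
    { ([] , z)     → inj₁ (z , refl , refl)
    ; (x ∷ xs , z) → inj₂ ((x , xs , z) , cong (true ∷_) (++-assoc (enc x) (enc xs) (enc z)) , refl) }

FP-ite : ∀ {a d} {g : El a → Bool} {h k : El a → El d} → FP g → FP h → FP k → FP (λ x → if g x then h x else k x)
FP-ite {h = h} {k} G H K = FP-if {f = λ (b , x) → if b then h x else k x} K H ∘FP ⟨ G , FP-id ⟩

-- Types without lists, hence with boundedly many values. A function on them is a decision tree over
-- the bits of the argument, however it is defined; this disposes of all digit tables.
data Finitary : U → Set where
  unit : Finitary unit
  bool : Finitary bool
  _⊠_  : ∀ {u v} → Finitary u → Finitary v → Finitary (u ⊠ v)
  _⊞_  : ∀ {u v} → Finitary u → Finitary v → Finitary (u ⊞ v)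
  opt  : ∀ {u} → Finitary u → Finitary (opt u)

FP-finitary : ∀ {u c d} {f : El u × El c → El d} → Finitary u → (∀ x → FP (λ z → f (x , z))) → FP {u ⊠ c} f
FP-finitary unit F = F tt ∘FP FP-proj₂
FP-finitary bool F = FP-if (F false) (F true)
FP-finitary {u ⊠ v} {c} {f = f} (p ⊠ q) F =
  FP-finitary {f = λ (x , y , z) → f ((x , y) , z)} p (λ x → FP-finitary q (λ y → F (x , y)))
  ∘FP FP-cast {(u ⊠ v) ⊠ c} {u ⊠ v ⊠ c} (λ ((x , y) , z) → sym (++-assoc (enc x) (enc y) (enc z)))
FP-finitary (p ⊞ q) F = FP-sum (FP-finitary p (λ x → F (inj₁ x))) (FP-finitary q (λ y → F (inj₂ y)))
FP-finitary (opt p) F = FP-opt (F nothing) (FP-finitary p (λ x → F (just x)))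

FP-finite : ∀ {u d} → Finitary u → (f : El u → El d) → FP f
FP-finite p f = FP-finitary {c = unit} {f = λ (x , _) → f x} p (λ x → FP-const (f x)) ∘FP ⟨ FP-id , FP-const tt ⟩

finitary-bound : ∀ {u} → Finitary u → ∃[ k ] ∀ (x : El u) → size x ≤ k
finitary-bound unit = 0 , λ _ → z≤n
finitary-bound bool = 1 , λ _ → ≤-refl
finitary-bound (p ⊠ q) with k , h ← finitary-bound p with l , h′ ← finitary-bound q =
  k + l , λ (x , y) → ≤-trans (≤-reflexive (size-× x y)) (+-mono-≤ (h x) (h′ y))
finitary-bound (p ⊞ q) with k , h ← finitary-bound p with l , h′ ← finitary-bound q =
  suc (k + l) , λ { (inj₁ x) → s≤s (≤-trans (h x) (m≤m+n k l)) ; (inj₂ y) → s≤s (≤-trans (h′ y) (m≤n+m l k)) }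
finitary-bound (opt p) with k , h ← finitary-bound p = suc k , λ { nothing → s≤s z≤n ; (just x) → s≤s (h x) }

-- Sizes of lists

module _ {u : U} where

  size-∷ : ∀ (x : El u) xs → size {list u} (x ∷ xs) ≡ suc (size x + size {list u} xs)
  size-∷ x xs = cong suc (length-++ (enc x))

  -- The successor is the second terminator, which disappears when the lists are joined.
  size-++ : ∀ (xs ys : List (El u)) → suc (size {list u} (xs ++ ys)) ≡ size {list u} xs + size {list u} ys
  size-++ []       ys = refl
  size-++ (x ∷ xs) ys = begin
    suc (size {list u} (x ∷ xs ++ ys))                   ≡⟨ cong suc (size-∷ x (xs ++ ys)) ⟩
    suc (suc (size x + size {list u} (xs ++ ys)))        ≡⟨ cong suc (+-suc (size x) _) ⟨
    suc (size x + suc (size {list u} (xs ++ ys)))        ≡⟨ cong (λ n → suc (size x + n)) (size-++ xs ys) ⟩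
    suc (size x + (size {list u} xs + size {list u} ys)) ≡⟨ cong suc (+-assoc (size x) _ _) ⟨
    suc (size x + size {list u} xs + size {list u} ys)   ≡⟨ cong (_+ size {list u} ys) (size-∷ x xs) ⟨
    size {list u} (x ∷ xs) + size {list u} ys            ∎
    where open ≡-Reasoning

  size-ʳ++ : ∀ (xs ys : List (El u)) → suc (size {list u} (xs ʳ++ ys)) ≡ size {list u} xs + size {list u} ys
  size-ʳ++ []       ys = refl
  size-ʳ++ (x ∷ xs) ys = begin
    suc (size {list u} (xs ʳ++ (x ∷ ys)))                ≡⟨ size-ʳ++ xs (x ∷ ys) ⟩
    size {list u} xs + size {list u} (x ∷ ys)            ≡⟨ cong (size {list u} xs +_) (size-∷ x ys) ⟩
    size {list u} xs + suc (size x + size {list u} ys)   ≡⟨ lemma (size {list u} xs) (size x) (size {list u} ys) ⟩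
    suc (size x + size {list u} xs) + size {list u} ys   ≡⟨ cong (_+ size {list u} ys) (size-∷ x xs) ⟨
    size {list u} (x ∷ xs) + size {list u} ys            ∎
    where
    open ≡-Reasoning
    lemma : ∀ a b c → a + suc (b + c) ≡ suc (b + a) + c
    lemma = solve-∀

  size-reverse : ∀ (xs : List (El u)) → size {list u} (reverse xs) ≡ size {list u} xs
  size-reverse xs = suc-injective (trans (size-ʳ++ xs []) (+-comm (size {list u} xs) 1))

  size-nonempty : ∀ (xs : List (El u)) → 1 ≤ size {list u} xs
  size-nonempty []       = s≤s z≤n
  size-nonempty (_ ∷ xs) = s≤s z≤n

  size-++ˡ : ∀ (xs ys : List (El u)) → size {list u} xs ≤ size {list u} (xs ++ ys)
  size-++ˡ xs ys = ≤-pred (≤-trans (≤-trans (≤-reflexive (+-comm 1 _)) (+-monoʳ-≤ (size {list u} xs) (size-nonempty ys)))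
    (≤-reflexive (sym (size-++ xs ys))))

  size-++ʳ : ∀ (xs ys : List (El u)) → size {list u} ys ≤ size {list u} (xs ++ ys)
  size-++ʳ xs ys = ≤-pred (≤-trans (+-monoˡ-≤ (size {list u} ys) (size-nonempty xs)) (≤-reflexive (sym (size-++ xs ys))))

  length≤size : ∀ (xs : List (El u)) → suc (length xs) ≤ size {list u} xs
  length≤size []       = ≤-refl
  length≤size (x ∷ xs) = s≤s (≤-trans (length≤size xs) (≤-trans (m≤n+m _ (size x)) (≤-reflexive (sym (length-++ (enc x))))))

  size-head : ∀ (x : El u) xs → size x ≤ size {list u} (x ∷ xs)
  size-head x xs = ≤-trans (m≤n⇒m≤1+n (m≤m+n _ _)) (≤-reflexive (sym (size-∷ x xs)))

  size-tail : ∀ (x : El u) xs → size {list u} xs ≤ size {list u} (x ∷ xs)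
  size-tail x xs = ≤-trans (m≤n⇒m≤1+n (m≤n+m _ _)) (≤-reflexive (sym (size-∷ x xs)))

-- Recursion on lists

trace-weaken : ∀ {a b body m n n′ x y} → n ≤ n′ → Trace {a} {b} body m n x y → Trace {a} {b} body m n′ x y
trace-weaken (s≤s le) (stop sz eq)    = stop sz eq
trace-weaken (s≤s le) (next sz eq tr) = next sz eq (trace-weaken le tr)

module _ {c s x : U} {step : El c → El s → El x → El s} where

  foldBody : El (list x ⊠ c ⊠ s) → El (s ⊞ (list x ⊠ c ⊠ s))
  foldBody ([]     , z , t) = inj₁ t
  foldBody (y ∷ ys , z , t) = inj₂ (ys , z , step z t y)

  -- Each intermediate state is the fold over a prefix of the list, so bounding the result for all
  -- lists bounds all of them. Inside, `us` is the prefix already consumed.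
  FP-foldl : FP {c ⊠ s ⊠ x} {s} (λ (z , t , y) → step z t y) → (p : Poly) →
    (∀ z t ys → size {s} (foldl (step z) t ys) ≤ p at (size z + (size {list x} ys + size t))) →
    FP {c ⊠ s ⊠ list x} {s} (λ (z , t , ys) → foldl (step z) t ys)
  FP-foldl F p bound =
    FP-loop {list x ⊠ c ⊠ s} {s} {foldBody} {λ (ys , z , t) → foldl (step z) t ys} body P whole
      ∘FP ⟨ FP-proj₂ ∘FP FP-proj₂ , ⟨ FP-proj₁ , FP-proj₁ ∘FP FP-proj₂ ⟩ ⟩
    where
    P : Poly
    -- One summand for each part of the state: the remaining list, the parameter and the fold so
    -- far. The first one also bounds the rounds.
    P = var :+ (var :+ p)
    body : FP {list x ⊠ c ⊠ s} {s ⊞ (list x ⊠ c ⊠ s)} foldBody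
    body = FP-list (FP-inj₁ ∘FP FP-proj₂)
      (FP-inj₂ ∘FP ⟨ FP-proj₁ ∘FP FP-proj₂ , ⟨ FP-proj₁ ∘FP FP-proj₂ ∘FP FP-proj₂ ,
        F ∘FP ⟨ FP-proj₁ ∘FP FP-proj₂ ∘FP FP-proj₂ , ⟨ FP-proj₂ ∘FP FP-proj₂ ∘FP FP-proj₂ , FP-proj₁ ⟩ ⟩ ⟩ ⟩)
    size-state : ∀ ys z t → size {list x ⊠ c ⊠ s} (ys , z , t) ≡ size {list x} ys + (size z + size t)
    size-state ys z t = trans (size-× {list x} ys (z , t)) (cong (size {list x} ys +_) (size-× z t))
    tr : ∀ z t us ys N → size {list x} (us ++ ys) + (size z + size t) ≤ N →
      Trace foldBody (P at N) (suc (length ys)) (ys , z , foldl (step z) t us) (foldl (step z) t (us ++ ys))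
    bd : ∀ z t us ys N → size {list x} (us ++ ys) + (size z + size t) ≤ N →
      size {list x ⊠ c ⊠ s} (ys , z , foldl (step z) t us) ≤ P at N
    bd z t us ys N le = ≤-trans (≤-reflexive (size-state ys z _))
      (+-mono-≤ (≤-trans (≤-trans (size-++ʳ us ys) (m≤m+n _ _)) le)
        (+-mono-≤ (≤-trans (≤-trans (m≤m+n (size z) (size t)) (m≤n+m (size z + size t) (size {list x} (us ++ ys)))) le)
          (≤-trans (bound z t us) (at-mono p (≤-trans (≤-trans (≤-reflexive (lemma (size z) (size {list x} us) (size t)))
            (+-monoˡ-≤ (size z + size t) (size-++ˡ us ys))) le)))))
      where
      lemma : ∀ a b c → a + (b + c) ≡ b + (a + c)
      lemma = solve-∀
    tr z t us []       N le = stop (bd z t us [] N le) (cong inj₁ (sym (foldl-++ (step z) t us [])))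
    tr z t us (y ∷ ys) N le = next (bd z t us (y ∷ ys) N le)
      (cong (λ w → inj₂ (ys , z , w)) (sym (foldl-++ (step z) t us (y ∷ []))))
      (subst (Trace foldBody (P at N) (suc (length ys)) _) (cong (foldl (step z) t) (++-assoc us (y ∷ []) ys))
        (tr z t (us ++ y ∷ []) ys N (subst (λ l → size {list x} l + _ ≤ N) (sym (++-assoc us (y ∷ []) ys)) le)))
    whole : ∀ w → Trace foldBody (P at size w) (P at size w) w (foldl (step (proj₁ (proj₂ w))) (proj₂ (proj₂ w)) (proj₁ w))
    whole (ys , z , t) = trace-weaken
      (≤-trans (≤-trans (length≤size ys) (size-≤₁ {list x} {c ⊠ s} ys (z , t))) (m≤m+n _ _))
      (tr z t [] ys _ (≤-reflexive (sym (size-state ys z t))))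

FP-reverse : ∀ {a} → FP {list a} {list a} reverse
FP-reverse {a} = FP-foldl {unit} {list a} {a} {λ _ → flip _∷_} (FP-∷ ∘FP FP-swap ∘FP FP-proj₂) var
    (λ _ t ys → ≤-trans (n≤1+n _) (≤-reflexive (size-ʳ++ ys t)))
  ∘FP ⟨ FP-const tt , ⟨ FP-const [] , FP-id ⟩ ⟩

FP-foldr : ∀ {c s x} {step : El c → El x → El s → El s} →
  FP {c ⊠ s ⊠ x} {s} (λ (z , t , y) → step z y t) → (p : Poly) →
  (∀ z t ys → size {s} (foldr (step z) t ys) ≤ p at (size z + (size {list x} ys + size t))) →
  FP {c ⊠ s ⊠ list x} {s} (λ (z , t , ys) → foldr (step z) t ys)
FP-foldr {c} {s} {x} {step} F p bound = FP-cong
  (λ (z , t , ys) → reverse-foldl (flip (step z)) t ys)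
  (FP-foldl {step = λ z → flip (step z)} F p
    (λ z t ys → subst₂ (λ w n → size {s} w ≤ p at (size z + (n + size t)))
      (reverse-foldr (step z) t ys) (size-reverse {x} ys) (bound z t (reverse ys)))
  ∘FP ⟨ FP-proj₁ , ⟨ FP-proj₁ ∘FP FP-proj₂ , FP-reverse ∘FP FP-proj₂ ∘FP FP-proj₂ ⟩ ⟩)

-- A Mealy machine. Its states will be carries, borrows and the verdict on the coordinates already
-- passed.
mealy : ∀ {S X Y : Set} → (S → X → S × Y) → S → List X → S × List Y
mealy step t []       = t , []
mealy step t (x ∷ xs) =
  let (t′ , y) = step t x ; (t″ , ys) = mealy step t′ xs in t″ , y ∷ ys

module _ {c s x y : U} {step : El c → El s → El x → El s × El y} where

  mealyAcc : El c → El (s ⊠ list y) → El x → El (s ⊠ list y)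
  mealyAcc z (t , acc) v = let (t′ , w) = step z t v in t′ , w ∷ acc

  foldl-mealy : ∀ z t acc vs → foldl (mealyAcc z) (t , acc) vs ≡
    (proj₁ (mealy (step z) t vs) , proj₂ (mealy (step z) t vs) ʳ++ acc)
  foldl-mealy z t acc []       = refl
  foldl-mealy z t acc (v ∷ vs) = foldl-mealy z (proj₁ (step z t v)) (proj₂ (step z t v) ∷ acc) vs

  -- The state has bounded size, so each output is polynomial in the parameter and a single input
  -- item. No further size bound has to be supplied, in contrast to general folds.
  FP-mealy : Finitary s → FP {c ⊠ s ⊠ x} {s ⊠ y} (λ (z , t , v) → step z t v) →
    FP {c ⊠ s ⊠ list x} {s ⊠ list y} (λ (z , t , vs) → mealy (step z) t vs)
  FP-mealy fs F = FP-cong eq (FP-dip FP-reverse ∘FP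
      FP-foldl {step = mealyAcc} acc P bound ∘FP ⟨ FP-proj₁ , ⟨ ⟨ FP-proj₁ ∘FP FP-proj₂ , FP-const [] ⟩ , FP-proj₂ ∘FP FP-proj₂ ⟩ ⟩)
    where
    eq : ∀ ((z , t , vs) : El (c ⊠ s ⊠ list x)) → let (t′ , acc) = foldl (mealyAcc z) (t , []) vs in
      (t′ , reverse acc) ≡ mealy (step z) t vs
    eq (z , t , vs) rewrite foldl-mealy z t [] vs = cong (proj₁ (mealy (step z) t vs) ,_) (reverse-involutive _)
    acc : FP {c ⊠ (s ⊠ list y) ⊠ x} {s ⊠ list y} (λ (z , t , v) → mealyAcc z t v)
    acc = ⟨ FP-proj₁ ∘FP FP-proj₁ , FP-∷ ∘FP ⟨ FP-proj₂ ∘FP FP-proj₁ , FP-proj₂ ⟩ ⟩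
      ∘FP ⟨ F ∘FP ⟨ FP-proj₁ , ⟨ FP-proj₁ ∘FP FP-proj₁ ∘FP FP-proj₂ , FP-proj₂ ∘FP FP-proj₂ ⟩ ⟩ ,
            FP-proj₂ ∘FP FP-proj₁ ∘FP FP-proj₂ ⟩
    k : ℕ
    k = proj₁ (finitary-bound fs)
    small : ∀ t → size t ≤ k
    small = proj₂ (finitary-bound fs)
    B P : Poly
    -- Bounds one output item together with its list marker.
    B = con 1 :+ outBound F :∘ (con k :+ var)
    P = con k :+ (var :+ var :* B)
    size-output : ∀ z t v N → size z + size v ≤ N → suc (size {y} (proj₂ (step z t v))) ≤ B at N
    size-output z t v N le = s≤s (≤-trans (size-≤₂ (proj₁ (step z t v)) (proj₂ (step z t v)))
      (≤-trans (size-out F (z , t , v)) (at-mono (outBound F) (≤-trans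
        (≤-reflexive (trans (size-× z (t , v)) (trans (cong (size z +_) (size-× t v)) (lemma (size z) (size t) (size v)))))
        (+-mono-≤ (small t) le)))))
      where
      lemma : ∀ a b c → a + (b + c) ≡ b + (a + c)
      lemma = solve-∀
    inv : ∀ z t ws vs N → size z + size {list x} vs ≤ N →
      size {s ⊠ list y} (foldl (mealyAcc z) (t , ws) vs) ≤ k + (size {list y} ws + length vs * (B at N))
    inv z t ws [] N le = ≤-trans (≤-reflexive (size-× {s} {list y} t ws)) (+-mono-≤ (small t) (m≤m+n _ 0))
    inv z t ws (v ∷ vs) N le = ≤-trans
      (inv z (proj₁ (step z t v)) (proj₂ (step z t v) ∷ ws) vs N (≤-trans (+-monoʳ-≤ (size z) (size-tail v vs)) le))
      (+-monoʳ-≤ k (≤-trans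
        (+-monoˡ-≤ (length vs * (B at N)) (≤-trans (≤-reflexive (size-∷ (proj₂ (step z t v)) ws))
          (+-monoˡ-≤ (size {list y} ws) (size-output z t v N (≤-trans (+-monoʳ-≤ (size z) (size-head v vs)) le)))))
        (≤-reflexive (lemma (B at N) (size {list y} ws) (length vs * (B at N))))))
      where
      lemma : ∀ a b c → a + b + c ≡ b + (a + c)
      lemma = solve-∀
    bound : ∀ z t vs → size {s ⊠ list y} (foldl (mealyAcc z) t vs) ≤ P at (size z + (size {list x} vs + size t))
    bound z (t , ws) vs = ≤-trans (inv z t ws vs N (+-monoʳ-≤ (size z) (m≤m+n _ _)))
      (+-monoʳ-≤ k (+-mono-≤ (≤-trans (size-≤₂ t ws) (≤-trans (m≤n+m _ (size {list x} vs)) (m≤n+m _ (size z))))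
        (*-monoˡ-≤ (B at N) (≤-trans (≤-trans (n≤1+n _) (length≤size vs)) (≤-trans (m≤m+n _ _) (m≤n+m _ (size z)))))))
      where N = size z + (size {list x} vs + size {s ⊠ list y} (t , ws))

FP-map : ∀ {c x y} {f : El c → El x → El y} → FP {c ⊠ x} (λ (z , v) → f z v) →
  FP {c ⊠ list x} {list y} (λ (z , vs) → map (f z) vs)
FP-map {c} {x} {y} {f} F = FP-cong (λ (z , vs) → mealy-map z vs)
  (FP-proj₂ ∘FP FP-mealy {step = step} unit ⟨ FP-const tt , F ∘FP ⟨ FP-proj₁ , FP-proj₂ ∘FP FP-proj₂ ⟩ ⟩
    ∘FP ⟨ FP-proj₁ , ⟨ FP-const tt , FP-proj₂ ⟩ ⟩)
  where
  step : El c → ⊤ → El x → ⊤ × El y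
  step z _ v = tt , f z v
  mealy-map : ∀ z vs → proj₂ (mealy (step z) tt vs) ≡ map (f z) vs
  mealy-map z []       = refl
  mealy-map z (v ∷ vs) = cong (f z v ∷_) (mealy-map z vs)

FP-∧ : FP {bool ⊠ bool} {bool} (uncurry _∧_)
FP-∧ = FP-finite (bool ⊠ bool) _

FP-∨ : FP {bool ⊠ bool} {bool} (uncurry _∨_)
FP-∨ = FP-finite (bool ⊠ bool) _

FP-not : FP not
FP-not = FP-finite bool _

module _ {c x : U} {p : El c → El x → Bool} (F : FP {c ⊠ x} (λ (z , v) → p z v)) where

  FP-all : FP {c ⊠ list x} (λ (z , vs) → all (p z) vs)
  FP-all = FP-cong (λ (z , vs) → folds z true vs)
    (FP-foldl {step = λ z b v → b ∧ p z v} (FP-∧ ∘FP ⟨ FP-proj₁ ∘FP FP-proj₂ , F ∘FP ⟨ FP-proj₁ , FP-proj₂ ∘FP FP-proj₂ ⟩ ⟩)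
      (con 1) (λ _ _ _ → ≤-refl) ∘FP ⟨ FP-proj₁ , ⟨ FP-const true , FP-proj₂ ⟩ ⟩)
    where
    folds : ∀ z b vs → foldl (λ b v → b ∧ p z v) b vs ≡ b ∧ all (p z) vs
    folds z b []       = sym (∧-identityʳ b)
    folds z b (v ∷ vs) = trans (folds z (b ∧ p z v) vs) (∧-assoc b _ _)

  FP-any : FP {c ⊠ list x} (λ (z , vs) → any (p z) vs)
  FP-any = FP-cong (λ (z , vs) → folds z false vs)
    (FP-foldl {step = λ z b v → b ∨ p z v} (FP-∨ ∘FP ⟨ FP-proj₁ ∘FP FP-proj₂ , F ∘FP ⟨ FP-proj₁ , FP-proj₂ ∘FP FP-proj₂ ⟩ ⟩)
      (con 1) (λ _ _ _ → ≤-refl) ∘FP ⟨ FP-proj₁ , ⟨ FP-const false , FP-proj₂ ⟩ ⟩)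
    where
    folds : ∀ z b vs → foldl (λ b v → b ∨ p z v) b vs ≡ b ∨ any (p z) vs
    folds z true  []       = refl
    folds z false []       = refl
    folds z b     (v ∷ vs) = trans (folds z (b ∨ p z v) vs) (∨-assoc b _ _)

-- Parallel traversal of two lists

-- Pads instead of truncating: missing high digits can be read as 0, while for vectors and digit
-- strings a difference in length stays visible.
align : ∀ {A : Set} → List A → List A → List (Maybe A × Maybe A)
align []       []       = []
align []       (y ∷ ys) = (nothing , just y) ∷ align [] ys
align (x ∷ xs) []       = (just x , nothing) ∷ align xs []
align (x ∷ xs) (y ∷ ys) = (just x , just y) ∷ align xs ys

module _ {u : U} where

  private
    pairs state : U
    pairs = list (opt u ⊠ opt u)
    state = list u ⊠ list u ⊠ pairs

  alignBody : El state → El (pairs ⊞ state)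
  alignBody ([]     , []     , acc) = inj₁ (reverse acc)
  alignBody ([]     , y ∷ ys , acc) = inj₂ ([] , ys , (nothing , just y) ∷ acc)
  alignBody (x ∷ xs , []     , acc) = inj₂ (xs , [] , (just x , nothing) ∷ acc)
  alignBody (x ∷ xs , y ∷ ys , acc) = inj₂ (xs , ys , (just x , just y) ∷ acc)

  FP-alignBody : FP {state} {pairs ⊞ state} alignBody
  FP-alignBody = FP-list
    (FP-list (FP-inj₁ ∘FP FP-reverse)
      (FP-inj₂ ∘FP ⟨ FP-const [] , ⟨ FP-proj₁ ∘FP FP-proj₂ ,
        FP-∷ ∘FP ⟨ ⟨ FP-const nothing , FP-just ∘FP FP-proj₁ ⟩ , FP-proj₂ ∘FP FP-proj₂ ⟩ ⟩ ⟩))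
    (FP-list {f = λ (ys , x , xs , acc) → alignBody (x ∷ xs , ys , acc)}
      (FP-inj₂ ∘FP ⟨ FP-proj₁ ∘FP FP-proj₂ , ⟨ FP-const [] ,
        FP-∷ ∘FP ⟨ ⟨ FP-just ∘FP FP-proj₁ , FP-const nothing ⟩ , FP-proj₂ ∘FP FP-proj₂ ⟩ ⟩ ⟩)
      (FP-inj₂ ∘FP ⟨ FP-proj₁ ∘FP FP-proj₂ ∘FP FP-proj₂ ∘FP FP-proj₂ , ⟨ FP-proj₁ ∘FP FP-proj₂ ,
        FP-∷ ∘FP ⟨ ⟨ FP-just ∘FP FP-proj₁ ∘FP FP-proj₂ ∘FP FP-proj₂ , FP-just ∘FP FP-proj₁ ⟩ ,
          FP-proj₂ ∘FP FP-proj₂ ∘FP FP-proj₂ ∘FP FP-proj₂ ⟩ ⟩ ⟩)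
     ∘FP ⟨ FP-proj₁ ∘FP FP-proj₂ ∘FP FP-proj₂ , ⟨ FP-proj₁ , ⟨ FP-proj₁ ∘FP FP-proj₂ , FP-proj₂ ∘FP FP-proj₂ ∘FP FP-proj₂ ⟩ ⟩ ⟩)

  -- Dominates the size of a state and does not increase.
  potential : El state → ℕ
  potential (xs , ys , acc) = 3 * size {list u} xs + 3 * size {list u} ys + size {pairs} acc

  size≤potential : ∀ s → size {state} s ≤ potential s
  size≤potential (xs , ys , acc) = ≤-trans
    (≤-reflexive (trans (size-× {list u} {list u ⊠ pairs} xs (ys , acc))
      (cong (size {list u} xs +_) (size-× {list u} {pairs} ys acc))))
    (≤-trans (m≤m+n _ _) (≤-reflexive (lemma (size {list u} xs) (size {list u} ys) (size {pairs} acc))))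
    where
    lemma : ∀ a b c → a + (b + c) + (2 * a + 2 * b) ≡ 3 * a + 3 * b + c
    lemma = solve-∀

  -- The factor 3 in `potential` pays for the tags: an item of size a gives up 3 (a + 1) and adds a
  -- + 3 to the accumulator when it has no partner; with a partner of size b, a + b + 3 is added.
  align-trace : ∀ xs ys acc m → potential (xs , ys , acc) ≤ m →
    Trace {state} {pairs} alignBody m (suc (length xs + length ys)) (xs , ys , acc) (acc ʳ++ align xs ys)
  align-trace [] [] acc m le = stop (≤-trans (size≤potential ([] , [] , acc)) le) refl
  align-trace [] (y ∷ ys) acc m le = next (≤-trans (size≤potential ([] , y ∷ ys , acc)) le) refl
    (align-trace [] ys _ m (≤-trans potential-≤ le))
    where
    lemma : ∀ a b c → 3 + 3 * b + suc (suc (suc a) + c) + 2 * a ≡ 3 + 3 * suc (a + b) + c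
    lemma = solve-∀
    potential-≤ : potential ([] , ys , (nothing , just y) ∷ acc) ≤ potential ([] , y ∷ ys , acc)
    potential-≤ = subst₂ (λ p q → 3 + 3 * size {list u} ys + p ≤ 3 + 3 * q + size {pairs} acc)
      (sym (size-∷ {opt u ⊠ opt u} (nothing , just y) acc)) (sym (size-∷ y ys))
      (≤-trans (m≤m+n _ (2 * size y)) (≤-reflexive (lemma (size y) (size {list u} ys) (size {pairs} acc))))
  align-trace (x ∷ xs) [] acc m le = next (≤-trans (size≤potential (x ∷ xs , [] , acc)) le) refl
    (align-trace xs [] _ m (≤-trans potential-≤ le))
    where
    lemma : ∀ a b c → 3 * b + 3 + suc (suc (a + 1) + c) + 2 * a ≡ 3 * suc (a + b) + 3 + c
    lemma = solve-∀
    potential-≤ : potential (xs , [] , (just x , nothing) ∷ acc) ≤ potential (x ∷ xs , [] , acc)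
    potential-≤ = subst₂ (λ p q → 3 * size {list u} xs + 3 + p ≤ 3 * q + 3 + size {pairs} acc)
      (sym (trans (size-∷ {opt u ⊠ opt u} (just x , nothing) acc)
        (cong (λ n → suc (n + size {pairs} acc)) (size-× {opt u} {opt u} (just x) nothing))))
      (sym (size-∷ x xs))
      (≤-trans (m≤m+n _ (2 * size x)) (≤-reflexive (lemma (size x) (size {list u} xs) (size {pairs} acc))))
  align-trace (x ∷ xs) (y ∷ ys) acc m le = next (≤-trans (size≤potential (x ∷ xs , y ∷ ys , acc)) le) refl
    (trace-weaken (s≤s (+-monoʳ-≤ (length xs) (n≤1+n (length ys)))) (align-trace xs ys _ m (≤-trans potential-≤ le)))
    where
    lemma : ∀ a b c d e → 3 * c + 3 * d + suc (suc (a + suc b) + e) + (3 + 2 * a + 2 * b) ≡ 3 * suc (a + c) + 3 * suc (b + d) + e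
    lemma = solve-∀
    potential-≤ : potential (xs , ys , (just x , just y) ∷ acc) ≤ potential (x ∷ xs , y ∷ ys , acc)
    potential-≤ = subst₂ (λ p q → 3 * size {list u} xs + 3 * size {list u} ys + p ≤ 3 * size {list u} (x ∷ xs) + 3 * q + size {pairs} acc)
      (sym (trans (size-∷ {opt u ⊠ opt u} (just x , just y) acc)
        (cong (λ n → suc (n + size {pairs} acc)) (size-× {opt u} {opt u} (just x) (just y)))))
      (sym (size-∷ y ys))
      (subst (λ q → 3 * size {list u} xs + 3 * size {list u} ys + suc (size {opt u} (just x) + size {opt u} (just y) + size {pairs} acc) ≤ 3 * q + 3 * suc (size y + size {list u} ys) + size {pairs} acc) (sym (size-∷ x xs))
        (≤-trans (m≤m+n _ (3 + 2 * size x + 2 * size y))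
          (≤-reflexive (lemma (size x) (size y) (size {list u} xs) (size {list u} ys) (size {pairs} acc)))))

  FP-align : FP {list u ⊠ list u} {pairs} (uncurry align)
  FP-align = FP-loop {f = λ (xs , ys , acc) → acc ʳ++ align xs ys} FP-alignBody (con 3 :* var) whole
      ∘FP ⟨ FP-proj₁ , ⟨ FP-proj₂ , FP-const [] ⟩ ⟩
    where
    whole : ∀ ((xs , ys , acc) : El state) →
      Trace {state} {pairs} alignBody (3 * size {state} (xs , ys , acc)) (3 * size {state} (xs , ys , acc)) (xs , ys , acc) (acc ʳ++ align xs ys)
    whole (xs , ys , acc) = trace-weaken steps (align-trace xs ys acc _ (≤-trans (m≤m+n _ (2 * size {pairs} acc)) (≤-reflexive eq)))
      where
      lemma : ∀ a b c → 3 * a + 3 * b + c + 2 * c ≡ 3 * (a + (b + c))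
      lemma = solve-∀
      eq : potential (xs , ys , acc) + 2 * size {pairs} acc ≡ 3 * size {state} (xs , ys , acc)
      eq = trans (lemma (size {list u} xs) (size {list u} ys) (size {pairs} acc)) (cong (3 *_) (sym
        (trans (size-× {list u} {list u ⊠ pairs} xs (ys , acc)) (cong (size {list u} xs +_) (size-× {list u} {pairs} ys acc)))))
      steps : suc (length xs + length ys) ≤ 3 * size {state} (xs , ys , acc)
      steps = ≤-trans (+-mono-≤ (length≤size xs) (≤-trans (n≤1+n _) (length≤size ys)))
        (≤-trans (≤-trans (≤-reflexive (sym (size-× {list u} {list u} xs ys)))
          (≤-trans (size-≤₁ {list u ⊠ list u} {pairs} (xs , ys) acc)
            (≤-reflexive (cong length (++-assoc (enc xs) (enc ys) (enc acc)))))) (m≤n*m _ 3))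

-- Parsing

-- The fuel of `parseList` makes the recursion structural. It never runs out, since each item uses
-- up at least its marker bit. Items are accumulated in reverse to match the loop that computes this
-- function.
parse : ∀ u → List Bool → Maybe (El u × List Bool)
parseList : ∀ u → ℕ → List (El u) → List Bool → Maybe (List (El u) × List Bool)

parse unit     bs           = just (tt , bs)
parse bool     []           = nothing
parse bool     (b ∷ bs)     = just (b , bs)
parse (u ⊠ v)  bs           = maybe′ (λ (x , bs′) → maybe′ (λ (y , bs″) → just ((x , y) , bs″)) nothing (parse v bs′)) nothing (parse u bs)
parse (u ⊞ v)  []           = nothing
parse (u ⊞ v)  (false ∷ bs) = maybe′ (λ (x , bs′) → just (inj₁ x , bs′)) nothing (parse u bs)
parse (u ⊞ v)  (true ∷ bs)  = maybe′ (λ (y , bs′) → just (inj₂ y , bs′)) nothing (parse v bs)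
parse (opt u)  []           = nothing
parse (opt u)  (false ∷ bs) = just (nothing , bs)
parse (opt u)  (true ∷ bs)  = maybe′ (λ (x , bs′) → just (just x , bs′)) nothing (parse u bs)
parse (list u) bs           = parseList u (suc (length bs)) [] bs

parseList u zero    acc bs           = nothing
parseList u (suc n) acc []           = nothing
parseList u (suc n) acc (false ∷ bs) = just (reverse acc , bs)
parseList u (suc n) acc (true ∷ bs)  = maybe′ (λ (x , bs′) → parseList u n (x ∷ acc) bs′) nothing (parse u bs)

-- Also needed for the running time: it shows that what a parsed item leaves over is a proper part
-- of the unread string.
parse-sound : ∀ u bs {x r} → parse u bs ≡ just (x , r) → bs ≡ enc x ++ r
parseList-sound : ∀ u n acc bs {xs r} → parseList u n acc bs ≡ just (xs , r) → ∃[ ys ] (xs ≡ acc ʳ++ ys × bs ≡ enc {list u} ys ++ r)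

parse-sound unit bs refl = refl
parse-sound bool (b ∷ bs) refl = refl
parse-sound (u ⊠ v) bs eq with parse u bs in eq₁
... | just (x , bs′) with parse v bs′ in eq₂
parse-sound (u ⊠ v) bs refl | just (x , bs′) | just (y , bs″) =
  trans (parse-sound u bs eq₁) (trans (cong (enc x ++_) (parse-sound v bs′ eq₂)) (sym (++-assoc (enc x) (enc y) bs″)))
parse-sound (u ⊞ v) (false ∷ bs) eq with parse u bs in eq₁
parse-sound (u ⊞ v) (false ∷ bs) refl | just (x , bs′) = cong (false ∷_) (parse-sound u bs eq₁)
parse-sound (u ⊞ v) (true ∷ bs) eq with parse v bs in eq₁
parse-sound (u ⊞ v) (true ∷ bs) refl | just (y , bs′) = cong (true ∷_) (parse-sound v bs eq₁)
parse-sound (opt u) (false ∷ bs) refl = refl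
parse-sound (opt u) (true ∷ bs) eq with parse u bs in eq₁
parse-sound (opt u) (true ∷ bs) refl | just (x , bs′) = cong (true ∷_) (parse-sound u bs eq₁)
parse-sound (list u) bs eq with ys , refl , eq′ ← parseList-sound u (suc (length bs)) [] bs eq = eq′

parseList-sound u (suc n) acc (false ∷ bs) refl = [] , refl , refl
parseList-sound u (suc n) acc (true ∷ bs) eq with parse u bs in eq₁
... | just (x , bs′) with ys , eq₂ , eq₃ ← parseList-sound u n (x ∷ acc) bs′ eq =
  x ∷ ys , eq₂ , cong (true ∷_) (trans (parse-sound u bs eq₁)
    (trans (cong (enc x ++_) eq₃) (sym (++-assoc (enc x) (enc ys) _))))

parse-complete : ∀ u (x : El u) r → parse u (enc x ++ r) ≡ just (x , r)
parseList-complete : ∀ u n acc (xs : List (El u)) r → suc (length xs) ≤ n → parseList u n acc (enc xs ++ r) ≡ just (acc ʳ++ xs , r)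

parse-complete unit x r = refl
parse-complete bool b r = refl
parse-complete (u ⊠ v) (x , y) r
  rewrite ++-assoc (enc x) (enc y) r | parse-complete u x (enc y ++ r) | parse-complete v y r = refl
parse-complete (u ⊞ v) (inj₁ x) r rewrite parse-complete u x r = refl
parse-complete (u ⊞ v) (inj₂ y) r rewrite parse-complete v y r = refl
parse-complete (opt u) nothing r = refl
parse-complete (opt u) (just x) r rewrite parse-complete u x r = refl
parse-complete (list u) xs r = parseList-complete u _ [] xs r
  (≤-trans (length≤size xs) (≤-trans (m≤m+n _ _) (≤-trans (≤-reflexive (sym (length-++ (enc xs)))) (n≤1+n _))))

parseList-complete u (suc n) acc []       r le = refl
parseList-complete u (suc n) acc (x ∷ xs) r (s≤s le)
  rewrite ++-assoc (enc x) (enc xs) r | parse-complete u x (enc xs ++ r) = parseList-complete u n (x ∷ acc) xs r le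

FP-maybe : ∀ {a b c} {f : El a → Maybe (El b)} {g : El a → El b → El c} {z : El a → El c} →
  FP f → FP {b ⊠ a} (λ (y , x) → g x y) → FP z → FP (λ x → maybe′ (g x) (z x) (f x))
FP-maybe {g = g} {z} F G Z = FP-opt {f = λ (m , x) → maybe′ (g x) (z x) m} Z G ∘FP ⟨ F , FP-id ⟩

size-bits : ∀ (bs : List Bool) → size {list bool} bs ≡ suc (2 * length bs)
size-bits []       = refl
size-bits (b ∷ bs) = trans (cong (suc ∘ suc) (size-bits bs)) (lemma (length bs))
  where
  lemma : ∀ n → suc (suc (suc (2 * n))) ≡ suc (2 * suc n)
  lemma = solve-∀

module _ {u : U} where

  private
    result state : U
    result = opt (list u ⊠ list bool)
    state  = list u ⊠ list bool

  parseItem : Bool → El state → El (result ⊞ state)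
  parseItem false (acc , bs) = inj₁ (just (reverse acc , bs))
  parseItem true  (acc , bs) = maybe′ (λ (x , bs′) → inj₂ (x ∷ acc , bs′)) (inj₁ nothing) (parse u bs)

  parseBody : El state → El (result ⊞ state)
  parseBody (acc , [])     = inj₁ nothing
  parseBody (acc , b ∷ bs) = parseItem b (acc , bs)

  FP-parseBody : FP {list bool} {opt (u ⊠ list bool)} (parse u) → FP {state} {result ⊞ state} parseBody
  FP-parseBody F = FP-list {f = λ (bs , acc) → parseBody (acc , bs)} (FP-const (inj₁ nothing))
      (FP-if {f = λ (b , s) → parseItem b s}
        (FP-inj₁ ∘FP FP-just ∘FP ⟨ FP-reverse ∘FP FP-proj₁ , FP-proj₂ ⟩)
        (FP-maybe (F ∘FP FP-proj₂)
          (FP-inj₂ ∘FP ⟨ FP-∷ ∘FP ⟨ FP-proj₁ ∘FP FP-proj₁ , FP-proj₁ ∘FP FP-proj₂ ⟩ , FP-proj₂ ∘FP FP-proj₁ ⟩)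
          (FP-const (inj₁ nothing)))
       ∘FP ⟨ FP-proj₁ , FP-swap ∘FP FP-proj₂ ⟩)
    ∘FP FP-swap

  -- Unread bits form a `list bool` and count twice, parsed ones count once. So the state shrinks
  -- with every item.
  parse-trace : ∀ n acc bs m → suc (length bs) ≤ n → size {state} (acc , bs) ≤ m →
    Trace {state} {result} parseBody m n (acc , bs) (parseList u n acc bs)
  parse-trace (suc n) acc []           m le sz = stop sz refl
  parse-trace (suc n) acc (false ∷ bs) m le sz = stop sz refl
  parse-trace (suc n) acc (true ∷ bs)  m (s≤s le) sz with parse u bs in eq
  ... | nothing         = stop sz (cong (maybe′ _ _) eq)
  ... | just (x , bs′) with refl ← parse-sound u bs eq = next sz (cong (maybe′ _ _) eq)
    (parse-trace n (x ∷ acc) bs′ m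
      (≤-trans (s≤s (≤-trans (m≤n+m _ _) (≤-reflexive (sym (length-++ (enc x)))))) le)
      (≤-trans (≤-trans (m≤m+n _ (suc (size x))) (≤-reflexive eq′)) sz))
    where
    lemma : ∀ a b c → suc (a + b) + suc (2 * c) + suc a ≡ b + suc (2 * suc (a + c))
    lemma = solve-∀
    eq′ : size {state} (x ∷ acc , bs′) + suc (size x) ≡ size {state} (acc , true ∷ (enc x ++ bs′))
    eq′ = begin
      size {state} (x ∷ acc , bs′) + suc (size x)
        ≡⟨ cong (_+ suc (size x)) (size-× {list u} {list bool} (x ∷ acc) bs′) ⟩
      size {list u} (x ∷ acc) + size {list bool} bs′ + suc (size x)
        ≡⟨ cong₂ (λ m n → m + n + suc (size x)) (size-∷ x acc) (size-bits bs′) ⟩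
      suc (size x + size {list u} acc) + suc (2 * length bs′) + suc (size x)
        ≡⟨ lemma (size x) (size {list u} acc) (length bs′) ⟩
      size {list u} acc + suc (2 * suc (size x + length bs′))
        ≡⟨ cong (λ n → size {list u} acc + suc (2 * suc n)) (length-++ (enc x)) ⟨
      size {list u} acc + suc (2 * suc (length (enc x ++ bs′)))
        ≡⟨ cong (size {list u} acc +_) (size-bits (true ∷ enc x ++ bs′)) ⟨
      size {list u} acc + size {list bool} (true ∷ enc x ++ bs′)
        ≡⟨ size-× {list u} {list bool} acc (true ∷ enc x ++ bs′) ⟨
      size {state} (acc , true ∷ (enc x ++ bs′)) ∎
      where open ≡-Reasoning

FP-parse : ∀ u → FP {list bool} {opt (u ⊠ list bool)} (parse u)
FP-parse unit = FP-just ∘FP ⟨ FP-const tt , FP-id ⟩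
FP-parse bool = FP-cong (λ { ([] , _) → refl ; (_ ∷ _ , _) → refl })
    (FP-list {f = λ (bs , _) → parse bool bs} (FP-const nothing) (FP-just ∘FP ⟨ FP-proj₁ , FP-proj₁ ∘FP FP-proj₂ ⟩))
  ∘FP ⟨ FP-id , FP-const tt ⟩
FP-parse (u ⊠ v) = FP-maybe (FP-parse u)
  (FP-maybe (FP-parse v ∘FP FP-proj₂ ∘FP FP-proj₁)
    (FP-just ∘FP ⟨ ⟨ FP-proj₁ ∘FP FP-proj₁ ∘FP FP-proj₂ , FP-proj₁ ∘FP FP-proj₁ ⟩ , FP-proj₂ ∘FP FP-proj₁ ⟩)
    (FP-const nothing))
  (FP-const nothing)
FP-parse (u ⊞ v) = FP-list {f = λ (bs , _) → parse (u ⊞ v) bs} (FP-const nothing)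
    (FP-if {f = λ (b , bs) → parse (u ⊞ v) (b ∷ bs)}
      (FP-maybe (FP-parse u) (FP-just ∘FP ⟨ FP-inj₁ ∘FP FP-proj₁ , FP-proj₂ ⟩ ∘FP FP-proj₁) (FP-const nothing))
      (FP-maybe (FP-parse v) (FP-just ∘FP ⟨ FP-inj₂ ∘FP FP-proj₁ , FP-proj₂ ⟩ ∘FP FP-proj₁) (FP-const nothing))
     ∘FP ⟨ FP-proj₁ , FP-proj₁ ∘FP FP-proj₂ ⟩)
  ∘FP ⟨ FP-id , FP-const tt ⟩
FP-parse (opt u) = FP-list {f = λ (bs , _) → parse (opt u) bs} (FP-const nothing)
    (FP-if {f = λ (b , bs) → parse (opt u) (b ∷ bs)}
      (FP-just ∘FP ⟨ FP-const nothing , FP-id ⟩)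
      (FP-maybe (FP-parse u) (FP-just ∘FP ⟨ FP-just ∘FP FP-proj₁ , FP-proj₂ ⟩ ∘FP FP-proj₁) (FP-const nothing))
     ∘FP ⟨ FP-proj₁ , FP-proj₁ ∘FP FP-proj₂ ⟩)
  ∘FP ⟨ FP-id , FP-const tt ⟩
FP-parse (list u) = FP-loop {list u ⊠ list bool} {opt (list u ⊠ list bool)} {parseBody}
    {λ (acc , bs) → parseList u (suc (length bs)) acc bs}
    (FP-parseBody (FP-parse u)) var
    (λ (acc , bs) → trace-weaken (≤-trans (length≤size bs) (size-≤₂ {list u} acc bs)) (parse-trace (suc (length bs)) acc bs _ ≤-refl ≤-refl))
  ∘FP ⟨ FP-const [] , FP-id ⟩

-- From polynomial-time functions to P

-- The shelving format is itself the code of a bit list; intake therefore amounts to marking the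
-- bits of the raw input.
flags-enc : ∀ w → flags w [] ≡ enc {list bool} w
flags-enc []      = refl
flags-enc (b ∷ w) = cong (λ l → true ∷ b ∷ l) (flags-enc w)

-- The input word is not self-delimiting. This is the one place where the end of data is recognised
-- by a blank cell.
takeIn : Program
takeIn = loop (empty? 0F >>= λ e → if e then ret false else (pop 0F >>= λ b → push 1F b >> push 1F true >> ret true))

runs-takeIn : ∀ w cs → Runs takeIn (w ∷ flags cs [] ∷ [] ∷ []) (suc (length w) * 7) false ([] ∷ flags (w ʳ++ cs) [] ∷ [] ∷ [])
runs-takeIn []      cs = runs-weaken (m≤m+n 2 5) (runs-stop (runs->>= (runs-empty? 0F) runs-ret))
runs-takeIn (b ∷ w) cs = runs-again
  (runs->>= (runs-empty? 0F) (runs->>= (runs-pop 0F) (runs->>= (runs->>= (runs-push 1F b) (runs-push 1F true)) runs-ret)))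
  (runs-takeIn w (b ∷ cs))

module Feed = Unwind 1F around₁ (λ _ _ → refl) (λ _ _ _ → refl)
  (λ b → push 0F b >> push 0F true) (λ (m , t) b → flag m b , t) 4
  (λ _ b _ → true , runs->>= (runs-push 0F b) (runs-push 0F true))

does-feed : ∀ w → Does Feed.unwind ((false ∷ []) ∷ flags (w ʳ++ []) [] ∷ [] ∷ []) (suc (length w) * 8) (enc {list bool} w ∷ [] ∷ [] ∷ [])
does-feed w = does-≡ refl (≤-reflexive (cong (λ n → suc n * 8) (length-reverse w)))
  (cong (λ z → around₁ z []) (trans (foldl-× flag (λ t _ → t) (false ∷ []) [] (reverse w))
    (cong₂ _,_ (trans (foldl-flag (reverse w) [] []) (trans (cong (λ l → flags l []) (reverse-involutive w)) (flags-enc w)))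
               (foldl-const [] (reverse w)))))
  (_ , Feed.runs-unwind (reverse w) (false ∷ [] , []) [])

intake : Program
intake = push 1F false >> (takeIn >> (push 0F false >> Feed.unwind))

does-intake : ∀ w → Does intake (w ∷ [] ∷ [] ∷ []) (2 + (suc (length w) * 7 + (2 + suc (length w) * 8))) (enc {list bool} w ∷ [] ∷ [] ∷ [])
does-intake w = (_ , runs-push 1F false) ≫ (_ , runs-takeIn w []) ≫ (_ , runs-push 0F false) ≫ does-feed w

module Decider {f : List Bool → Bool} (F : FP {list bool} {bool} f) where

  decider : Program
  decider = intake >> FP.program F >> pop 0F

  deciderTime : Poly
  deciderTime =
    -- The argument of `FP.time F` is the size of the marked input: two bits for each bit and a
    -- terminator.
    con 2 :+ ((con 1 :+ var) :* con 7 :+ (con 2 :+ (con 1 :+ var) :* con 8)) :+ FP.time F :∘ (con 1 :+ con 2 :* var) :+ con 1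

  runs-decider : ∀ w → Runs decider (w ∷ [] ∷ [] ∷ []) (deciderTime at length w) (f w) ([] ∷ [] ∷ [] ∷ [])
  runs-decider w = runs->>= (proj₂ (does->> (does-intake w)
    (does-≡ (cong (λ l → l ∷ [] ∷ [] ∷ []) (++-identityʳ (enc {list bool} w))) (≤-reflexive (cong (FP.time F at_) (size-bits w))) refl
      (FP.correct F w [] [] [])))) (runs-pop 0F)

FP→InP : ∀ {L : Language} {f : List Bool → Bool} → FP {list bool} {bool} f → (∀ w → L w ⇔ f w ≡ true) → InP L
FP→InP {L} {f} F iff = bounded (at-bound′ deciderTime)
  where
  open Decider F
  bounded : (∃[ c ] ∃[ d ] ∀ n → deciderTime at n ≤ c * n ^ d + c) → InP L
  bounded (c , d , h) = machine (compile decider) , c , d , λ w →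
    f w , runs-halts decider (runs-weaken (h (length w)) (runs-decider w)) , iff w

-- Arithmetic on binary numbers

bitOf : Maybe Bool → Bool
bitOf = fromMaybe false

-- Full adder and full subtractor. The first component is the carry (a majority) or the borrow, the
-- second the digit (a parity).
addBit subBit : Bool → Maybe Bool × Maybe Bool → Bool × Bool
addBit c (x , y) = let a = bitOf x ; b = bitOf y in (a ∧ b) ∨ (c ∧ (a ∨ b)) , (a xor b) xor c
subBit c (x , y) = let a = bitOf x ; b = bitOf y in (b ∧ c) ∨ (not a ∧ (b ∨ c)) , (a xor b) xor c

add : List Bool → List Bool → List Bool
add xs ys = let (c , zs) = mealy addBit false (align xs ys) in zs ∷ʳ c

-- The final borrow tells whether the difference is negative.
sub : List Bool → List Bool → Bool × List Bool
sub xs ys = mealy subBit false (align xs ys)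

sameBit : Maybe Bool × Maybe Bool → Bool
sameBit (just true  , just true)  = true
sameBit (just false , just false) = true
sameBit _                         = false

-- Compares digit strings. This is adequate for gate numbers, which well-formedness forces to be
-- canonical.
sameNum : List Bool → List Bool → Bool
sameNum xs ys = all sameBit (align xs ys)

-- No superfluous zeros: the last digit, if any, is 1.
canonical : List Bool → Bool
canonical = foldl (λ _ b → b) true

incBit : Bool → Bool → Bool × Bool
incBit c b = c ∧ b , c xor b

-- Shaped after the given encoding: `unit` is ∞ in `point` and complement in `operation`, and the
-- two booleans are the last two bits of the code of a binary operation.
num vec point operation label entry circuit value env : U
num       = list bool
vec       = list num
point     = vec ⊞ unit
operation = unit ⊞ (bool ⊠ bool)
label     = point ⊞ operation
entry     = num ⊠ label ⊠ list num
circuit   = list entry ⊠ num ⊠ point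
value     = opt point
env       = list (num ⊠ value)

-- Polynomial time of the arithmetic

FP-∷ʳ : ∀ {a} → FP {list a ⊠ a} {list a} (uncurry _∷ʳ_)
FP-∷ʳ = FP-cong (λ (xs , x) → trans (unfold-reverse x (reverse xs)) (cong (_∷ʳ x) (reverse-involutive xs)))
  (FP-reverse ∘FP FP-∷ ∘FP ⟨ FP-proj₂ , FP-reverse ∘FP FP-proj₁ ⟩)

FP-mealy₀ : ∀ {s x y} {step : El s → El x → El s × El y} → Finitary s → FP {s ⊠ x} {s ⊠ y} (uncurry step) →
  ∀ t → FP {list x} {s ⊠ list y} (mealy step t)
FP-mealy₀ {step = step} fs F t =
  FP-mealy {unit} {step = λ _ → step} fs (F ∘FP FP-proj₂) ∘FP ⟨ FP-const tt , ⟨ FP-const t , FP-id ⟩ ⟩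

bitPairs : Finitary (opt bool ⊠ opt bool)
bitPairs = opt bool ⊠ opt bool

FP-add : FP {num ⊠ num} {num} (uncurry add)
FP-add = FP-∷ʳ ∘FP FP-swap ∘FP FP-mealy₀ bool (FP-finite (bool ⊠ bitPairs) (uncurry addBit)) false ∘FP FP-align

FP-sub : FP {num ⊠ num} {bool ⊠ num} (uncurry sub)
FP-sub = FP-mealy₀ bool (FP-finite (bool ⊠ bitPairs) (uncurry subBit)) false ∘FP FP-align

FP-all₀ : ∀ {x} {p : El x → Bool} → FP p → FP {list x} (all p)
FP-all₀ {p = p} F = FP-all {unit} {p = λ _ → p} (F ∘FP FP-proj₂) ∘FP ⟨ FP-const tt , FP-id ⟩

FP-sameNum : FP {num ⊠ num} {bool} (uncurry sameNum)
FP-sameNum = FP-all₀ (FP-finite bitPairs sameBit) ∘FP FP-align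

FP-canonical : FP {num} {bool} canonical
FP-canonical = FP-foldl {unit} {bool} {bool} {λ _ _ b → b} (FP-proj₂ ∘FP FP-proj₂) (con 1) (λ _ _ _ → ≤-refl)
  ∘FP ⟨ FP-const tt , ⟨ FP-const true , FP-id ⟩ ⟩

mealy-incBit-false : ∀ ds → mealy incBit false ds ≡ (false , ds)
mealy-incBit-false []       = refl
mealy-incBit-false (d ∷ ds) rewrite mealy-incBit-false ds = refl

increment-mealy : ∀ ds → (let (c , es) = mealy incBit true ds in if c then es ∷ʳ true else es) ≡ increment ds
increment-mealy [] = refl
increment-mealy (false ∷ ds) rewrite mealy-incBit-false ds = refl
increment-mealy (true ∷ ds) with mealy incBit true ds | increment-mealy ds
... | true  , es | eq = cong (false ∷_) eq
... | false , es | eq = cong (false ∷_) eq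

FP-increment : FP {num} {num} increment
FP-increment = FP-cong increment-mealy
  (FP-ite FP-proj₁ (FP-∷ʳ ∘FP ⟨ FP-proj₂ , FP-const true ⟩) FP-proj₂
    ∘FP FP-mealy₀ bool (FP-finite (bool ⊠ bool) (uncurry incBit)) true)

-- Operations on points; nothing stands for the empty set

numOf : Maybe (List Bool) → List Bool
numOf = fromMaybe []

addNums : Maybe (List Bool) × Maybe (List Bool) → List Bool
addNums (x , y) = add (numOf x) (numOf y)

subNums : Bool → Maybe (List Bool) × Maybe (List Bool) → Bool × List Bool
subNums ok (x , y) = let (b , d) = sub (numOf x) (numOf y) in ok ∧ not b , d

vadd : El vec → El vec → El vec
vadd u v = map addNums (align u v)

vsub : El vec → El vec → Bool × El vec
vsub u v = mealy subNums true (align u v)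

capP plusP minusP : El point → El point → El value
capP (inj₁ u) (inj₁ v) = if proj₁ (vsub u v) ∧ proj₁ (vsub v u) then just (inj₁ u) else nothing
capP (inj₂ _) (inj₂ _) = just (inj₂ tt)
capP _        _        = nothing
plusP (inj₁ u) (inj₁ v) = just (inj₁ (vadd u v))
plusP _        _        = just (inj₂ tt)
minusP (inj₁ u) (inj₁ v) = if proj₁ (vsub u v) then just (inj₁ (proj₂ (vsub u v))) else nothing
minusP (inj₂ _) (inj₁ _) = just (inj₂ tt)
minusP _        (inj₂ _) = nothing

applyP : Bool × Bool → El point → El point → El value
-- The code of union, which `shape` rejects; the value is a mere default.
applyP (false , false) x y = nothing
applyP (false , true)  x y = capP x y
applyP (true  , false) x y = plusP x y
applyP (true  , true)  x y = minusP x y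

-- Polynomial time of the operations on points

FP-numOf : FP {opt num} {num} numOf
FP-numOf = FP-cong (λ { nothing → refl ; (just _) → refl })
  (FP-opt {f = λ (m , _) → numOf m} (FP-const []) FP-proj₁ ∘FP ⟨ FP-id , FP-const tt ⟩)

FP-vadd : FP {vec ⊠ vec} {vec} (uncurry vadd)
FP-vadd = FP-map {unit} {f = λ _ → addNums} (FP-add ∘FP ⟨ FP-numOf ∘FP FP-proj₁ , FP-numOf ∘FP FP-proj₂ ⟩ ∘FP FP-proj₂)
  ∘FP ⟨ FP-const tt , FP-align ⟩

FP-vsub : FP {vec ⊠ vec} {bool ⊠ vec} (uncurry vsub)
FP-vsub = FP-mealy₀ {step = subNums} bool
  (⟨ FP-∧ ∘FP ⟨ FP-proj₁ , FP-not ∘FP FP-proj₁ ∘FP FP-proj₂ ⟩ , FP-proj₂ ∘FP FP-proj₂ ⟩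
    ∘FP ⟨ FP-proj₁ , FP-sub ∘FP ⟨ FP-numOf ∘FP FP-proj₁ , FP-numOf ∘FP FP-proj₂ ⟩ ∘FP FP-proj₂ ⟩) true
  ∘FP FP-align

FP-capP : FP {point ⊠ point} {value} (uncurry capP)
FP-capP = FP-sum
  (FP-sum {f = λ (y , u) → capP (inj₁ u) y}
    (FP-ite (FP-∧ ∘FP ⟨ FP-proj₁ ∘FP FP-vsub ∘FP FP-swap , FP-proj₁ ∘FP FP-vsub ⟩)
      (FP-just ∘FP FP-inj₁ ∘FP FP-proj₂) (FP-const nothing))
    (FP-const nothing) ∘FP FP-swap)
  (FP-sum {f = λ (y , _) → capP (inj₂ tt) y} (FP-const nothing) (FP-const (just (inj₂ tt))) ∘FP FP-swap)

FP-plusP : FP {point ⊠ point} {value} (uncurry plusP)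
FP-plusP = FP-sum
  (FP-sum {f = λ (y , u) → plusP (inj₁ u) y} (FP-just ∘FP FP-inj₁ ∘FP FP-vadd ∘FP FP-swap) (FP-const (just (inj₂ tt))) ∘FP FP-swap)
  (FP-const (just (inj₂ tt)))

FP-minusP : FP {point ⊠ point} {value} (uncurry minusP)
FP-minusP = FP-sum
  (FP-sum {f = λ (y , u) → minusP (inj₁ u) y}
    (FP-ite (FP-proj₁ ∘FP FP-vsub ∘FP FP-swap)
      (FP-just ∘FP FP-inj₁ ∘FP FP-proj₂ ∘FP FP-vsub ∘FP FP-swap) (FP-const nothing))
    (FP-const nothing) ∘FP FP-swap)
  (FP-sum {f = λ (y , _) → minusP (inj₂ tt) y} (FP-const (just (inj₂ tt))) (FP-const nothing) ∘FP FP-swap)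

FP-applyP : FP {(bool ⊠ bool) ⊠ point ⊠ point} {value} (λ (o , x , y) → applyP o x y)
FP-applyP = FP-finitary (bool ⊠ bool) λ
  { (false , false) → FP-const nothing ; (false , true) → FP-capP ; (true , false) → FP-plusP ; (true , true) → FP-minusP }

-- Evaluation of a listed circuit, from the last gate to the first

-- An absent gate and a gate with empty result both give `nothing`. In a listing that passes
-- `ordered` the operands are always present.
lookupNum : El num → El env → El value
lookupNum n = foldr (λ (m , x) t → if sameNum n m then x else t) nothing

evalOp : El operation → List (El num) → El env → El value
evalOp (inj₂ o) (p ∷ q ∷ _) ρ =
  maybe′ (λ x → maybe′ (λ y → applyP o x y) nothing (lookupNum q ρ)) nothing (lookupNum p ρ)
evalOp _        _           ρ = nothing

evalGateCode : El label → List (El num) → El env → El value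
evalGateCode (inj₁ x) ps ρ = just x
evalGateCode (inj₂ o) ps ρ = evalOp o ps ρ

evalEntry : El entry → El env → El value
evalEntry (_ , l , ps) = evalGateCode l ps

extend : El entry → El env → El env
extend e ρ = (proj₁ e , evalEntry e ρ) ∷ ρ

evalAll : List (El entry) → El env
evalAll = foldr extend []

FP-lookupNum : FP {num ⊠ env} {value} (uncurry lookupNum)
FP-lookupNum = FP-foldr {num} {value} {num ⊠ value} {λ n (m , x) t → if sameNum n m then x else t}
    (FP-ite (FP-sameNum ∘FP ⟨ FP-proj₁ , FP-proj₁ ∘FP FP-proj₂ ∘FP FP-proj₂ ⟩)
      (FP-proj₂ ∘FP FP-proj₂ ∘FP FP-proj₂) (FP-proj₁ ∘FP FP-proj₂))
    var (λ n t ρ → ≤-trans (bound n t ρ) (m≤n+m _ (size {num} n)))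
  ∘FP ⟨ FP-proj₁ , ⟨ FP-const nothing , FP-proj₂ ⟩ ⟩
  where
  bound : ∀ n t ρ → size {value} (foldr (λ (m , x) t → if sameNum n m then x else t) t ρ) ≤ size {env} ρ + size {value} t
  bound n t [] = m≤n+m _ 1
  bound n t ((m , x) ∷ ρ) with sameNum n m
  ... | true  = ≤-trans (≤-trans (size-≤₂ {num} {value} m x) (size-head {num ⊠ value} (m , x) ρ)) (m≤m+n _ _)
  ... | false = ≤-trans (bound n t ρ) (+-monoˡ-≤ (size {value} t) (size-tail {num ⊠ value} (m , x) ρ))

FP-evalOp : FP {operation ⊠ list num ⊠ env} {value} (λ (o , ps , ρ) → evalOp o ps ρ)
FP-evalOp = FP-sum (FP-const nothing)
  (FP-list {f = λ (ps , o , ρ) → evalOp (inj₂ o) ps ρ} (FP-const nothing)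
    (FP-list {f = λ (qs , p , o , ρ) → evalOp (inj₂ o) (p ∷ qs) ρ} (FP-const nothing)
      (FP-maybe {f = λ (q , _ , p , o , ρ) → lookupNum p ρ} {g = λ (q , _ , p , o , ρ) x → maybe′ (λ y → applyP o x y) nothing (lookupNum q ρ)}
        (FP-lookupNum ∘FP ⟨ FP-proj₁ ∘FP FP-proj₂² , FP-proj₂² ∘FP FP-proj₂² ⟩)
        (FP-maybe {f = λ (_ , q , _ , p , o , ρ) → lookupNum q ρ} {g = λ (x , q , _ , p , o , ρ) y → applyP o x y}
          (FP-lookupNum ∘FP ⟨ FP-proj₁ ∘FP FP-proj₂ , FP-proj₂² ∘FP FP-proj₂² ∘FP FP-proj₂ ⟩)
          (FP-applyP ∘FP ⟨ FP-proj₁ ∘FP FP-proj₂² ∘FP FP-proj₂² ∘FP FP-proj₂ , ⟨ FP-proj₁ ∘FP FP-proj₂ , FP-proj₁ ⟩ ⟩)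
          (FP-const nothing))
        (FP-const nothing))
     ∘FP ⟨ FP-proj₁ ∘FP FP-proj₂ , ⟨ FP-proj₁ , FP-proj₂² ⟩ ⟩)
   ∘FP ⟨ FP-proj₁ ∘FP FP-proj₂ , ⟨ FP-proj₁ , FP-proj₂² ⟩ ⟩)
  where
  FP-proj₂² : ∀ {a b c} → FP {a ⊠ b ⊠ c} {c} (λ x → proj₂ (proj₂ x))
  FP-proj₂² = FP-proj₂ ∘FP FP-proj₂

FP-evalEntry : FP {entry ⊠ env} {value} (uncurry evalEntry)
FP-evalEntry = FP-sum {f = λ (l , ps , ρ) → evalGateCode l ps ρ} (FP-just ∘FP FP-proj₁) FP-evalOp
  ∘FP ⟨ FP-proj₁ ∘FP FP-proj₂ ∘FP FP-proj₁ , ⟨ FP-proj₂ ∘FP FP-proj₂ ∘FP FP-proj₁ , FP-proj₂ ⟩ ⟩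

-- Each gate adds at most one digit to the numbers occurring in the values

length-align : ∀ {A : Set} (xs ys : List A) {n} → length xs ≤ n → length ys ≤ n → length (align xs ys) ≤ n
length-align []       []       p       q       = z≤n
length-align []       (y ∷ ys) p       (s≤s q) = s≤s (length-align [] ys z≤n q)
length-align (x ∷ xs) []       (s≤s p) q       = s≤s (length-align xs [] p z≤n)
length-align (x ∷ xs) (y ∷ ys) (s≤s p) (s≤s q) = s≤s (length-align xs ys p q)

length-mealy : ∀ {S X Y : Set} (step : S → X → S × Y) t xs → length (proj₂ (mealy step t xs)) ≡ length xs
length-mealy step t []       = refl
length-mealy step t (x ∷ xs) = cong suc (length-mealy step (proj₁ (step t x)) xs)

length-add : ∀ xs ys {n} → length xs ≤ n → length ys ≤ n → length (add xs ys) ≤ suc n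
length-add xs ys p q = ≤-trans
  (≤-reflexive (trans (length-++ (proj₂ (mealy addBit false (align xs ys)))) (+-comm _ 1)))
  (s≤s (≤-trans (≤-reflexive (length-mealy addBit false (align xs ys))) (length-align xs ys p q)))

length-sub : ∀ xs ys {n} → length xs ≤ n → length ys ≤ n → length (proj₂ (sub xs ys)) ≤ n
length-sub xs ys p q = ≤-trans (≤-reflexive (length-mealy subBit false (align xs ys))) (length-align xs ys p q)

Short : ℕ → List Bool → Set
Short B x = length x ≤ B

-- Dimension and digit length are bounded separately. By total size, a sum of two points could only
-- be bounded by about the sum of both sizes, which would compound exponentially along the circuit;
-- the maximal digit length grows by at most 1.
VecIn : ℕ → ℕ → El vec → Set
VecIn D B v = length v ≤ D × All (Short B) v

PointIn : ℕ → ℕ → El point → Set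
PointIn D B (inj₁ v) = VecIn D B v
PointIn D B (inj₂ _) = ⊤

ValueIn : ℕ → ℕ → El value → Set
ValueIn D B nothing  = ⊤
ValueIn D B (just x) = PointIn D B x

EnvIn : ℕ → ℕ → El env → Set
EnvIn D B = All (λ (_ , x) → ValueIn D B x)

valueIn-weaken : ∀ {D B B′} x → B ≤ B′ → ValueIn D B x → ValueIn D B′ x
valueIn-weaken nothing         le _       = tt
valueIn-weaken (just (inj₁ v)) le (p , q) = p , All.map (λ h → ≤-trans h le) q
valueIn-weaken (just (inj₂ _)) le _       = tt

align-short : ∀ {B} {u v : El vec} → All (Short B) u → All (Short B) v →
  All (λ (x , y) → Short B (numOf x) × Short B (numOf y)) (align u v)
align-short []       []       = []
align-short []       (q ∷ qs) = (z≤n , q) ∷ align-short [] qs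
align-short (p ∷ ps) []       = (p , z≤n) ∷ align-short ps []
align-short (p ∷ ps) (q ∷ qs) = (p , q) ∷ align-short ps qs

vadd-in : ∀ {D B} u v → VecIn D B u → VecIn D B v → VecIn D (suc B) (vadd u v)
vadd-in u v (p , ps) (q , qs) =
    ≤-trans (≤-reflexive (length-map addNums (align u v))) (length-align u v p q)
  , All.map⁺ (All.map (λ {(x , y)} (h , h′) → length-add (numOf x) (numOf y) h h′) (align-short ps qs))

vsub-in : ∀ {D B} u v → VecIn D B u → VecIn D B v → VecIn D (suc B) (proj₂ (vsub u v))
vsub-in {B = B} u v (p , ps) (q , qs) =
    ≤-trans (≤-reflexive (length-mealy subNums true (align u v))) (length-align u v p q)
  , short true (align-short ps qs)
  where
  short : ∀ ok {zs} → All (λ (x , y) → Short B (numOf x) × Short B (numOf y)) zs →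
    All (Short (suc B)) (proj₂ (mealy subNums ok zs))
  short ok []                        = []
  short ok (_∷_ {(x , y)} (h , h′) hs) = m≤n⇒m≤1+n (length-sub (numOf x) (numOf y) h h′) ∷ short _ hs

applyP-in : ∀ {D B} o x y → PointIn D B x → PointIn D B y → ValueIn D (suc B) (applyP o x y)
applyP-in (false , false) x        y        p q = tt
applyP-in (false , true)  (inj₁ u) (inj₁ v) p q with proj₁ (vsub u v) ∧ proj₁ (vsub v u)
... | true  = valueIn-weaken (just (inj₁ u)) (n≤1+n _) p
... | false = tt
applyP-in (false , true)  (inj₁ u) (inj₂ _) p q = tt
applyP-in (false , true)  (inj₂ _) (inj₁ v) p q = tt
applyP-in (false , true)  (inj₂ _) (inj₂ _) p q = tt
applyP-in (true  , false) (inj₁ u) (inj₁ v) p q = vadd-in u v p q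
applyP-in (true  , false) (inj₁ u) (inj₂ _) p q = tt
applyP-in (true  , false) (inj₂ _) y        p q = tt
applyP-in (true  , true)  (inj₁ u) (inj₁ v) p q with proj₁ (vsub u v)
... | true  = vsub-in u v p q
... | false = tt
applyP-in (true  , true)  (inj₁ u) (inj₂ _) p q = tt
applyP-in (true  , true)  (inj₂ _) (inj₁ v) p q = tt
applyP-in (true  , true)  (inj₂ _) (inj₂ _) p q = tt

lookupNum-in : ∀ {D B} n {ρ} → EnvIn D B ρ → ValueIn D B (lookupNum n ρ)
lookupNum-in n [] = tt
lookupNum-in n (_∷_ {(m , x)} p ps) with sameNum n m
... | true  = p
... | false = lookupNum-in n ps

evalOp-in : ∀ {D B} o ps {ρ} → EnvIn D B ρ → ValueIn D (suc B) (evalOp o ps ρ)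
evalOp-in (inj₁ _) ps           h = tt
evalOp-in (inj₂ o) []           h = tt
evalOp-in (inj₂ o) (p ∷ [])     h = tt
evalOp-in (inj₂ o) (p ∷ q ∷ ps) {ρ} h with lookupNum p ρ | lookupNum-in p h | lookupNum q ρ | lookupNum-in q h
... | nothing | _  | _       | _  = tt
... | just x  | _  | nothing | _  = tt
... | just x  | h₁ | just y  | h₂ = applyP-in o x y h₁ h₂

bits≤size : ∀ (x : List Bool) → length x ≤ size {num} x
bits≤size x = ≤-trans (m≤m+n _ (length x + 0)) (≤-trans (n≤1+n _) (≤-reflexive (sym (size-bits x))))

vecIn-size : ∀ v {N} → size {vec} v ≤ N → VecIn N N v
vecIn-size v le = ≤-trans (≤-trans (n≤1+n _) (length≤size v)) le , shorts v le
  where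
  shorts : ∀ v {N} → size {vec} v ≤ N → All (Short N) v
  shorts []      le = []
  shorts (x ∷ v) le = ≤-trans (≤-trans (bits≤size x) (size-head {num} x v)) le ∷ shorts v (≤-trans (size-tail {num} x v) le)

pointIn-size : ∀ x {N} → size {point} x ≤ N → PointIn N N x
pointIn-size (inj₁ v) le = vecIn-size v (≤-trans (n≤1+n _) le)
pointIn-size (inj₂ _) le = tt

valueIn-size : ∀ x {N} → size {value} x ≤ N → ValueIn N N x
valueIn-size nothing  le = tt
valueIn-size (just x) le = pointIn-size x (≤-trans (n≤1+n _) le)

envIn-size : ∀ ρ {N} → size {env} ρ ≤ N → EnvIn N N ρ
envIn-size []            le = []
envIn-size ((m , x) ∷ ρ) le =
  valueIn-size x (≤-trans (≤-trans (size-≤₂ {num} {value} m x) (size-head {num ⊠ value} (m , x) ρ)) le)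
  ∷ envIn-size ρ (≤-trans (size-tail {num ⊠ value} (m , x) ρ) le)

-- A coordinate takes at most 1 + 2 B bits and a list marker; the 3 are the two tags and the
-- terminator of the vector.
size-valueIn : ∀ {D B} x → ValueIn D B x → size {value} x ≤ 3 + D * (2 + 2 * B)
size-valueIn nothing         _       = s≤s z≤n
size-valueIn (just (inj₂ _)) _       = s≤s (s≤s z≤n)
size-valueIn {D} {B} (just (inj₁ v)) (p , q) =
  s≤s (s≤s (≤-trans (size-vec v q) (s≤s (*-monoˡ-≤ (2 + 2 * B) p))))
  where
  size-vec : ∀ v → All (Short B) v → size {vec} v ≤ 1 + length v * (2 + 2 * B)
  size-vec []      []      = s≤s z≤n
  size-vec (x ∷ v) (h ∷ q) = ≤-trans (≤-reflexive (size-∷ {num} x v))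
    (s≤s (≤-trans (+-mono-≤ (≤-trans (≤-reflexive (size-bits x)) (s≤s (*-monoʳ-≤ 2 h))) (size-vec v q))
      (≤-reflexive (lemma B (length v * (2 + 2 * B))))))
    where
    lemma : ∀ b w → suc (2 * b) + (1 + w) ≡ 2 + 2 * b + w
    lemma = solve-∀

evalEntry-in : ∀ e ρ {N B} → size {entry} e ≤ N → N ≤ B → EnvIn N B ρ → ValueIn N (suc B) (evalEntry e ρ)
evalEntry-in (n , inj₁ x , ps) ρ le le′ h = valueIn-weaken (just x) (m≤n⇒m≤1+n le′)
  (pointIn-size x (≤-trans (≤-trans (n≤1+n _) (≤-trans (size-≤₁ {label} {list num} (inj₁ x) ps)
    (size-≤₂ {num} {label ⊠ list num} n (inj₁ x , ps)))) le))
evalEntry-in (n , inj₂ o , ps) ρ le le′ h = evalOp-in o ps h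

extends-in : ∀ {N} es ρ → size {list entry} es ≤ N → size {env} ρ ≤ N → EnvIn N (N + length es) (foldr extend ρ es)
extends-in {N} []       ρ le le′ = subst (λ B → EnvIn N B ρ) (sym (+-identityʳ N)) (envIn-size ρ le′)
extends-in {N} (e ∷ es) ρ le le′ = subst (λ B → EnvIn N B (foldr extend ρ (e ∷ es))) (sym (+-suc N (length es)))
  (evalEntry-in e _ (≤-trans (size-head {entry} e es) le) (m≤m+n N (length es)) ih
    ∷ All.map (λ {(_ , x)} → valueIn-weaken x (n≤1+n _)) ih)
  where ih = extends-in es ρ (≤-trans (size-tail {entry} e es) le) le′

size-extends : ∀ {N} es ρ → size {list entry} es ≤ N → size {env} ρ ≤ N →
  size {env} (foldr extend ρ es) ≤ size {env} ρ + (size {list entry} es + length es * (3 + N * (2 + 2 * (N + N))))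
size-extends {N} []       ρ le le′ = m≤m+n _ _
size-extends {N} (e ∷ es) ρ le le′ = begin
  size {env} (foldr extend ρ (e ∷ es))
    ≡⟨ trans (size-∷ {num ⊠ value} (proj₁ e , v) ρ′) (cong (λ n → suc (n + size {env} ρ′)) (size-× {num} {value} (proj₁ e) v)) ⟩
  suc (size {num} (proj₁ e) + size {value} v + size {env} ρ′)
    ≤⟨ s≤s (+-mono-≤ (+-mono-≤ (size-≤₁ {num} {label ⊠ list num} (proj₁ e) (proj₂ e)) (size-valueIn v v-in))
        (size-extends es ρ (≤-trans (size-tail {entry} e es) le) le′)) ⟩
  suc (size {entry} e + V + (size {env} ρ + (size {list entry} es + length es * V)))
    ≡⟨ lemma (size {entry} e) V (size {env} ρ) (size {list entry} es) (length es * V) ⟩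
  size {env} ρ + (suc (size {entry} e + size {list entry} es) + (V + length es * V))
    ≡⟨ cong (λ n → size {env} ρ + (n + (V + length es * V))) (size-∷ {entry} e es) ⟨
  size {env} ρ + (size {list entry} (e ∷ es) + length (e ∷ es) * V) ∎
  where
  open ≤-Reasoning
  V = 3 + N * (2 + 2 * (N + N))
  ρ′ = foldr extend ρ es
  v = evalEntry e ρ′
  -- Fewer than `N` gates are listed, so N + N bounds the digit length for all of them uniformly.
  v-in : ValueIn N (N + N) v
  v-in = valueIn-weaken v (≤-trans (≤-reflexive (sym (+-suc N (length es)))) (+-monoʳ-≤ N (≤-trans (n≤1+n _) (≤-trans (length≤size {entry} (e ∷ es)) le))))
    (evalEntry-in e ρ′ (≤-trans (size-head {entry} e es) le) (m≤m+n N (length es)) (extends-in es ρ (≤-trans (size-tail {entry} e es) le) le′))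
  lemma : ∀ a b c d e → suc (a + b + (c + (d + e))) ≡ c + (suc (a + d) + (b + e))
  lemma = solve-∀

FP-evalAll : FP {list entry} {env} evalAll
FP-evalAll = FP-foldr {unit} {env} {entry} {λ _ → extend}
    (FP-∷ ∘FP ⟨ ⟨ FP-proj₁ ∘FP FP-proj₁ , FP-evalEntry ⟩ , FP-proj₂ ⟩ ∘FP FP-swap ∘FP FP-proj₂)
    (var :+ (var :+ var :* (con 3 :+ var :* (con 2 :+ con 2 :* (var :+ var)))))
    (λ _ ρ es → bound es ρ)
  ∘FP ⟨ FP-const tt , ⟨ FP-const [] , FP-id ⟩ ⟩
  where
  bound : ∀ es ρ → let N = size {list entry} es + size {env} ρ in
    size {env} (foldr extend ρ es) ≤ N + (N + N * (3 + N * (2 + 2 * (N + N))))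
  bound es ρ = ≤-trans (size-extends {N} es ρ es≤N ρ≤N)
    (+-mono-≤ ρ≤N (+-mono-≤ es≤N (*-monoˡ-≤ _ (≤-trans (n≤1+n _) (≤-trans (length≤size {entry} es) es≤N)))))
    where
    N = size {list entry} es + size {env} ρ
    es≤N : size {list entry} es ≤ N
    es≤N = m≤m+n _ _
    ρ≤N : size {env} ρ ≤ N
    ρ≤N = m≤n+m _ _

-- Recognition of listings of circuits

memberNum : El num → List (El num) → Bool
memberNum d = any (sameNum d)

-- The second list only counts how many successors of d are looked for.
covers : List (El num) → El num → List (El num) → Bool
covers ds d []       = true
covers ds d (_ ∷ xs) = memberNum d ds ∧ covers ds (increment d) xs

gateNumbers : List (El entry) → List (El num)
gateNumbers = map proj₁

-- Predecessors have to occur below, whereas a reverse topological order only forbids them above.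
-- For a list of all gates of an acyclic circuit the two conditions agree, and the present one
-- yields acyclicity as well.
ordered : List (El entry) → Bool
ordered []                  = true
ordered ((_ , _ , ps) ∷ es) = all (λ p → memberNum p (gateNumbers es)) ps ∧ ordered es

-- `b ∨ c` excludes union. The second test, no borrow in `q` minus `p`, is the condition on the
-- operands of a binary gate that the first has the smaller or equal number.
shape : El label → List (El num) → Bool
shape (inj₁ _)              ps           = null ps
shape (inj₂ (inj₂ (b , c))) (p ∷ q ∷ []) = (b ∨ c) ∧ not (proj₁ (sub q p))
shape _                     _            = false

-- An operation gate is given ∞, which is a point in every dimension and so imposes no condition.
inputOf : El label → El point
inputOf (inj₁ x) = x
inputOf (inj₂ _) = inj₂ tt

points : List (El entry) → El point → List (El point)
points es b = b ∷ map (λ (_ , l , _) → inputOf l) es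

-- The first vector, which shows the dimension; if there is none, any dimension will do.
template : List (El point) → El vec
template = foldr (λ x t → [ id , (λ _ → t) ]′ x) ([] ∷ [])

bothJust : ∀ {A : Set} → Maybe A × Maybe A → Bool
bothJust (just _ , just _) = true
bothJust _                 = false

-- Equal dimension means that aligning leaves no gap. `canonical` is demanded because a number must
-- be written exactly as `digits` writes it.
pointOK : El vec → El point → Bool
pointOK t (inj₁ v) = all bothJust (align t v) ∧ all canonical v
pointOK t (inj₂ _) = true

pointsOK : List (El point) → Bool
pointsOK xs = not (null (template xs)) ∧ all (pointOK (template xs)) xs

-- `holds` uses `capP` as a comparison by value: the result at the output is intersected with {b}.
wellFormed holds decide : El circuit → Bool
wellFormed (es , out , b) = covers (gateNumbers es) [] (gateNumbers es) ∧ (memberNum out (gateNumbers es) ∧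
  (ordered es ∧ (all (λ (_ , l , ps) → shape l ps) es ∧ pointsOK (points es b))))
holds (es , out , b) = is-just (maybe′ (λ x → capP x b) nothing (lookupNum out (evalAll es)))
decide c = wellFormed c ∧ holds c

accept : List Bool → Bool
accept w = maybe′ (λ (c , r) → null r ∧ decide c) false (parse circuit w)

-- Polynomial time of the recognition

FP-memberNum : FP {num ⊠ list num} {bool} (uncurry memberNum)
FP-memberNum = FP-any FP-sameNum

-- The counter is the only part of the state that grows, by at most one digit and hence two bits per
-- round.
FP-covers : FP {list num} {bool} (λ ds → covers ds [] ds)
FP-covers = FP-cong (λ ds → cong proj₁ (folds ds true [] ds))
  (FP-proj₁ ∘FP FP-foldl {list num} {bool ⊠ num} {num} {step}
      ⟨ FP-∧ ∘FP ⟨ FP-proj₁ ∘FP FP-proj₁ ∘FP FP-proj₂ , FP-memberNum ∘FP ⟨ FP-proj₂ ∘FP FP-proj₁ ∘FP FP-proj₂ , FP-proj₁ ⟩ ⟩ ,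
        FP-increment ∘FP FP-proj₂ ∘FP FP-proj₁ ∘FP FP-proj₂ ⟩
      (con 2 :* var) (λ ds (ok , d) xs → bound ds ok d xs)
    ∘FP ⟨ FP-id , ⟨ FP-const (true , []) , FP-id ⟩ ⟩)
  where
  step : El (list num) → El (bool ⊠ num) → El num → El (bool ⊠ num)
  step ds (ok , d) _ = ok ∧ memberNum d ds , increment d
  shift-by : El num → List (El num) → El num
  shift-by d []       = d
  shift-by d (_ ∷ xs) = shift-by (increment d) xs
  folds : ∀ ds ok d xs → foldl (step ds) (ok , d) xs ≡ (ok ∧ covers ds d xs , shift-by d xs)
  folds ds ok d []       = cong (_, d) (sym (∧-identityʳ ok))
  folds ds ok d (x ∷ xs) = trans (folds ds (ok ∧ memberNum d ds) (increment d) xs)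
    (cong (_, shift-by (increment d) xs) (∧-assoc ok _ _))
  length-increment : ∀ d → length (increment d) ≤ suc (length d)
  length-increment []          = ≤-refl
  length-increment (false ∷ d) = n≤1+n _
  length-increment (true ∷ d)  = s≤s (length-increment d)
  size-increment : ∀ d → size {num} (increment d) ≤ 2 + size {num} d
  size-increment d = begin
    size {num} (increment d)          ≡⟨ size-bits (increment d) ⟩
    suc (2 * length (increment d))    ≤⟨ s≤s (*-monoʳ-≤ 2 (length-increment d)) ⟩
    suc (2 * suc (length d))          ≡⟨ cong suc (*-suc 2 (length d)) ⟩
    2 + suc (2 * length d)            ≡⟨ cong (2 +_) (size-bits d) ⟨
    2 + size {num} d                  ∎
    where open ≤-Reasoning
  size-shift : ∀ d xs → size {num} (shift-by d xs) ≤ 2 * length xs + size {num} d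
  size-shift d []       = ≤-refl
  size-shift d (_ ∷ xs) = ≤-trans (size-shift (increment d) xs)
    (≤-trans (+-monoʳ-≤ (2 * length xs) (size-increment d)) (≤-reflexive (lemma (length xs) (size {num} d))))
    where
    lemma : ∀ a b → 2 * a + (2 + b) ≡ 2 * suc a + b
    lemma = solve-∀
  bound : ∀ ds ok d xs → size {bool ⊠ num} (foldl (step ds) (ok , d) xs)
    ≤ 2 * (size {list num} ds + (size {list num} xs + size {bool ⊠ num} (ok , d)))
  bound ds ok d xs rewrite folds ds ok d xs = ≤-trans (s≤s (size-shift d xs))
    (≤-trans (≤-reflexive (sym (+-suc (2 * length xs) (size {num} d))))
    (≤-trans (+-mono-≤ (*-monoʳ-≤ 2 (≤-trans (n≤1+n _) (length≤size {num} xs))) (m≤n*m (suc (size {num} d)) 2))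
    (≤-trans (≤-reflexive (sym (*-distribˡ-+ 2 (size {list num} xs) (suc (size {num} d)))))
             (*-monoʳ-≤ 2 (m≤n+m _ (size {list num} ds))))))

-- `ordered` consults the gate numbers of the tail, so the fold carries them along as a second
-- component.
FP-ordered : FP {list entry} {bool} ordered
FP-ordered = FP-cong (λ es → cong proj₁ (folds es))
  (FP-proj₁ ∘FP FP-foldr {unit} {bool ⊠ list num} {entry} {λ _ → step}
      (⟨ FP-∧ ∘FP ⟨ FP-all {p = λ ns p → memberNum p ns} (FP-memberNum ∘FP FP-swap)
                     ∘FP ⟨ FP-proj₂ ∘FP FP-proj₁ , FP-proj₂ ∘FP FP-proj₂ ∘FP FP-proj₂ ⟩ , FP-proj₁ ∘FP FP-proj₁ ⟩ ,
        FP-∷ ∘FP ⟨ FP-proj₁ ∘FP FP-proj₂ , FP-proj₂ ∘FP FP-proj₁ ⟩ ⟩ ∘FP FP-proj₂)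
      var (λ _ (ok , ns) es → bound ok ns es)
    ∘FP ⟨ FP-const tt , ⟨ FP-const (true , []) , FP-id ⟩ ⟩)
  where
  step : El entry → El (bool ⊠ list num) → El (bool ⊠ list num)
  step (n , _ , ps) (ok , ns) = all (λ p → memberNum p ns) ps ∧ ok , n ∷ ns
  folds : ∀ es → foldr step (true , []) es ≡ (ordered es , gateNumbers es)
  folds []       = refl
  folds (e ∷ es) rewrite folds es = refl
  bound : ∀ ok ns es → size {bool ⊠ list num} (foldr step (ok , ns) es) ≤ size {list entry} es + size {bool ⊠ list num} (ok , ns)
  bound ok ns []       = n≤1+n _
  bound ok ns (e ∷ es) = ≤-trans (s≤s (≤-reflexive (size-∷ {num} (proj₁ e) (proj₂ (foldr step (ok , ns) es)))))
    (≤-trans (≤-reflexive (lemma (size {num} (proj₁ e)) (size {list num} (proj₂ (foldr step (ok , ns) es)))))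
    (≤-trans (s≤s (+-mono-≤ (size-≤₁ {num} {label ⊠ list num} (proj₁ e) (proj₂ e)) (bound ok ns es)))
    (≤-reflexive (trans (cong suc (sym (+-assoc (size {entry} e) _ _)))
      (cong (_+ size {bool ⊠ list num} (ok , ns)) (sym (size-∷ {entry} e es)))))))
    where
    lemma : ∀ a b → suc (suc (a + b)) ≡ suc (a + suc b)
    lemma = solve-∀

FP-null : ∀ {a} → FP {list a} {bool} null
FP-null = FP-cong (λ { [] → refl ; (_ ∷ _) → refl })
  (FP-list {f = λ (xs , _) → null xs} (FP-const true) (FP-const false) ∘FP ⟨ FP-id , FP-const tt ⟩)

FP-shape : FP {label ⊠ list num} {bool} (uncurry shape)
FP-shape = FP-sum (FP-null ∘FP FP-proj₂)
  (FP-sum {f = λ (o , ps) → shape (inj₂ o) ps} (FP-const false)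
    (FP-list {f = λ (ps , o) → shape (inj₂ (inj₂ o)) ps} (FP-const false)
      (FP-list {f = λ (ps , p , o) → shape (inj₂ (inj₂ o)) (p ∷ ps)} (FP-const false)
        (FP-list {f = λ (ps , q , p , o) → shape (inj₂ (inj₂ o)) (p ∷ q ∷ ps)}
          (FP-∧ ∘FP ⟨ FP-∨ ∘FP FP-proj₂ ∘FP FP-proj₂ , FP-not ∘FP FP-proj₁ ∘FP FP-sub ∘FP ⟨ FP-proj₁ , FP-proj₁ ∘FP FP-proj₂ ⟩ ⟩)
          (FP-const false)
         ∘FP ⟨ FP-proj₁ ∘FP FP-proj₂ , ⟨ FP-proj₁ , FP-proj₂ ∘FP FP-proj₂ ⟩ ⟩)
       ∘FP ⟨ FP-proj₁ ∘FP FP-proj₂ , ⟨ FP-proj₁ , FP-proj₂ ∘FP FP-proj₂ ⟩ ⟩)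
     ∘FP FP-swap))

FP-points : FP {list entry ⊠ point} {list point} (uncurry points)
FP-points = FP-∷ ∘FP ⟨ FP-proj₂ ,
  FP-map {unit} {f = λ _ (_ , l , _) → inputOf l} (ofLabel ∘FP FP-proj₁ ∘FP FP-proj₂ ∘FP FP-proj₂) ∘FP ⟨ FP-const tt , FP-proj₁ ⟩ ⟩
  where
  ofLabel : FP {label} {point} inputOf
  ofLabel = FP-cong (λ { (inj₁ _) → refl ; (inj₂ _) → refl })
    (FP-sum {f = λ (l , _) → inputOf l} FP-proj₁ (FP-const (inj₂ tt)) ∘FP ⟨ FP-id , FP-const tt ⟩)

FP-template : FP {list point} {vec} template
FP-template = FP-foldr {unit} {vec} {point} {λ _ → step}
    (FP-sum {f = λ (x , t) → step x t} FP-proj₁ FP-proj₂ ∘FP FP-swap ∘FP FP-proj₂)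
    var (λ _ → bound)
  ∘FP ⟨ FP-const tt , ⟨ FP-const ([] ∷ []) , FP-id ⟩ ⟩
  where
  step : El point → El vec → El vec
  step x t = [ id , (λ _ → t) ]′ x
  bound : ∀ t xs → size {vec} (foldr step t xs) ≤ size {list point} xs + size {vec} t
  bound t []            = n≤1+n _
  bound t (inj₁ v ∷ xs) = ≤-trans (≤-trans (n≤1+n _) (size-head {point} (inj₁ v) xs)) (m≤m+n _ _)
  bound t (inj₂ _ ∷ xs) = ≤-trans (bound t xs) (+-monoˡ-≤ (size {vec} t) (size-tail {point} (inj₂ tt) xs))

FP-bothJust : ∀ {u} → FP {opt u ⊠ opt u} {bool} bothJust
FP-bothJust = FP-opt (FP-const false)
  (FP-opt {f = λ (y , x) → bothJust (just x , y)} (FP-const false) (FP-const true) ∘FP FP-swap)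

FP-pointOK : FP {vec ⊠ point} {bool} (uncurry pointOK)
FP-pointOK = FP-sum {f = λ (x , t) → pointOK t x}
    (FP-∧ ∘FP ⟨ FP-all₀ FP-bothJust ∘FP FP-align ∘FP FP-swap , FP-all₀ FP-canonical ∘FP FP-proj₁ ⟩)
    (FP-const true)
  ∘FP FP-swap

FP-pointsOK : FP {list point} {bool} pointsOK
FP-pointsOK = FP-∧ ∘FP ⟨ FP-not ∘FP FP-null ∘FP FP-template , FP-all FP-pointOK ∘FP ⟨ FP-template , FP-id ⟩ ⟩

FP-wellFormed : FP {circuit} {bool} wellFormed
FP-wellFormed = FP-∧ ∘FP ⟨ FP-covers ∘FP numbers , FP-∧ ∘FP ⟨ FP-memberNum ∘FP ⟨ FP-proj₁ ∘FP FP-proj₂ , numbers ⟩ ,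
  FP-∧ ∘FP ⟨ FP-ordered ∘FP FP-proj₁ , FP-∧ ∘FP ⟨ FP-all₀ (FP-shape ∘FP FP-proj₂) ∘FP FP-proj₁ ,
  FP-pointsOK ∘FP FP-points ∘FP ⟨ FP-proj₁ , FP-proj₂ ∘FP FP-proj₂ ⟩ ⟩ ⟩ ⟩ ⟩
  where
  numbers : FP {circuit} {list num} (λ c → gateNumbers (proj₁ c))
  numbers = FP-map {unit} {f = λ _ → proj₁} (FP-proj₁ ∘FP FP-proj₂) ∘FP ⟨ FP-const tt , FP-proj₁ ⟩

FP-is-just : ∀ {a} → FP {opt a} {bool} is-just
FP-is-just = FP-cong (λ { nothing → refl ; (just _) → refl })
  (FP-opt {f = λ (x , _) → is-just x} (FP-const false) (FP-const true) ∘FP ⟨ FP-id , FP-const tt ⟩)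

FP-holds : FP {circuit} {bool} holds
FP-holds = FP-is-just ∘FP FP-maybe {f = λ (es , out , _) → lookupNum out (evalAll es)} {g = λ (_ , _ , b) x → capP x b}
  (FP-lookupNum ∘FP ⟨ FP-proj₁ ∘FP FP-proj₂ , FP-evalAll ∘FP FP-proj₁ ⟩)
  (FP-capP ∘FP ⟨ FP-proj₁ , FP-proj₂ ∘FP FP-proj₂ ∘FP FP-proj₂ ⟩)
  (FP-const nothing)

FP-decide : FP {circuit} {bool} decide
FP-decide = FP-∧ ∘FP ⟨ FP-wellFormed , FP-holds ⟩

FP-accept : FP {list bool} {bool} accept
FP-accept = FP-maybe {g = λ _ (c , r) → null r ∧ decide c} (FP-parse circuit)
  (FP-∧ ∘FP ⟨ FP-null ∘FP FP-proj₂ , FP-decide ∘FP FP-proj₁ ⟩ ∘FP FP-proj₁)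
  (FP-const false)

-- Correctness of the arithmetic

bit : Bool → ℕ
bit false = 0
bit true  = 1

val : List Bool → ℕ
val []       = 0
val (b ∷ bs) = bit b + (val bs + val bs)

val-digits : ∀ n → val (digits n) ≡ n
val-digits zero    = refl
val-digits (suc n) = trans (val-increment (digits n)) (cong suc (val-digits n))
  where
  val-increment : ∀ ds → val (increment ds) ≡ suc (val ds)
  val-increment []           = refl
  val-increment (false ∷ ds) = refl
  val-increment (true ∷ ds)  = trans (cong (λ n → n + n) (val-increment ds)) (cong suc (+-suc (val ds) (val ds)))

digits-injective : ∀ {m n} → digits m ≡ digits n → m ≡ n
digits-injective {m} {n} eq = trans (sym (val-digits m)) (trans (cong val eq) (val-digits n))

-- `digits` counts up by `increment`; these two recover the positional recursion on even and odd
-- numbers, each from the other by one increment.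
digits-odd : ∀ n → digits (suc (n + n)) ≡ true ∷ digits n
digits-even : ∀ n → digits (suc n + suc n) ≡ false ∷ digits (suc n)
digits-odd zero    = refl
digits-odd (suc n) = cong increment (digits-even n)
digits-even n = trans (cong (digits ∘ suc) (+-suc n n)) (cong increment (digits-odd n))

canonical-sound : ∀ ds → canonical ds ≡ true → digits (val ds) ≡ ds
canonical-sound []               _ = refl
canonical-sound (true ∷ [])      _ = refl
canonical-sound (true ∷ d ∷ ds)  c = trans (digits-odd (val (d ∷ ds))) (cong (true ∷_) (canonical-sound (d ∷ ds) c))
-- The rest cannot have value 0, because it is nonempty and `digits 0` is empty.
canonical-sound (false ∷ d ∷ ds) c with val (d ∷ ds) | canonical-sound (d ∷ ds) c
... | suc n | eq = trans (digits-even n) (cong (false ∷_) eq)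

canonical-digits : ∀ n → canonical (digits n) ≡ true
canonical-digits zero    = refl
canonical-digits (suc n) = canonical-increment (digits n) (canonical-digits n)
  where
  canonical-false : ∀ ds → canonical (increment ds) ≡ true → canonical (false ∷ increment ds) ≡ true
  canonical-false []           c = c
  canonical-false (false ∷ ds) c = c
  canonical-false (true ∷ ds)  c = c
  canonical-increment : ∀ ds → canonical ds ≡ true → canonical (increment ds) ≡ true
  canonical-increment []               _ = refl
  canonical-increment (false ∷ d ∷ ds) c = c
  canonical-increment (true ∷ [])      _ = refl
  canonical-increment (true ∷ d ∷ ds)  c = canonical-false (d ∷ ds) (canonical-increment (d ∷ ds) c)

leftVal rightVal : List (Maybe Bool × Maybe Bool) → ℕ
leftVal  = val ∘ map (bitOf ∘ proj₁)
rightVal = val ∘ map (bitOf ∘ proj₂)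

leftVal-align : ∀ xs ys → leftVal (align xs ys) ≡ val xs
leftVal-align []       []       = refl
leftVal-align []       (y ∷ ys) = cong (λ n → n + n) (leftVal-align [] ys)
leftVal-align (x ∷ xs) []       = cong (λ n → bit x + (n + n)) (leftVal-align xs [])
leftVal-align (x ∷ xs) (y ∷ ys) = cong (λ n → bit x + (n + n)) (leftVal-align xs ys)

rightVal-align : ∀ xs ys → rightVal (align xs ys) ≡ val ys
rightVal-align []       []       = refl
rightVal-align []       (y ∷ ys) = cong (λ n → bit y + (n + n)) (rightVal-align [] ys)
rightVal-align (x ∷ xs) []       = cong (λ n → n + n) (rightVal-align xs [])
rightVal-align (x ∷ xs) (y ∷ ys) = cong (λ n → bit y + (n + n)) (rightVal-align xs ys)

addBits : Bool → List (Maybe Bool × Maybe Bool) → List Bool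
addBits c ps = let (c′ , zs) = mealy addBit c ps in zs ∷ʳ c′

full-adder : ∀ a b c → bit ((a xor b) xor c) + (bit ((a ∧ b) ∨ (c ∧ (a ∨ b))) + bit ((a ∧ b) ∨ (c ∧ (a ∨ b)))) ≡ bit a + bit b + bit c
full-adder false false false = refl
full-adder false false true  = refl
full-adder false true  false = refl
full-adder false true  true  = refl
full-adder true  false false = refl
full-adder true  false true  = refl
full-adder true  true  false = refl
full-adder true  true  true  = refl

-- Both sides without subtraction: a + 2 borrow = digit + b + c.
full-subtractor : ∀ a b c → bit a + (bit ((b ∧ c) ∨ (not a ∧ (b ∨ c))) + bit ((b ∧ c) ∨ (not a ∧ (b ∨ c)))) ≡ bit ((a xor b) xor c) + bit b + bit c
full-subtractor false false false = refl
full-subtractor false false true  = refl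
full-subtractor false true  false = refl
full-subtractor false true  true  = refl
full-subtractor true  false false = refl
full-subtractor true  false true  = refl
full-subtractor true  true  false = refl
full-subtractor true  true  true  = refl

bit≤1 : ∀ b → bit b ≤ 1
bit≤1 false = z≤n
bit≤1 true  = ≤-refl

val-addBits : ∀ c ps → val (addBits c ps) ≡ leftVal ps + rightVal ps + bit c
val-addBits c [] = +-identityʳ (bit c)
val-addBits c ((x , y) ∷ ps) = begin
  bit s + (val (addBits c′ ps) + val (addBits c′ ps))
    ≡⟨ cong (λ n → bit s + (n + n)) (val-addBits c′ ps) ⟩
  bit s + (l + r + bit c′ + (l + r + bit c′))
    ≡⟨ lemma₁ (bit s) l r (bit c′) ⟩
  bit s + (bit c′ + bit c′) + (l + l + (r + r))
    ≡⟨ cong (_+ (l + l + (r + r))) (full-adder (bitOf x) (bitOf y) c) ⟩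
  bit (bitOf x) + bit (bitOf y) + bit c + (l + l + (r + r))
    ≡⟨ lemma₂ (bit (bitOf x)) (bit (bitOf y)) (bit c) l r ⟩
  bit (bitOf x) + (l + l) + (bit (bitOf y) + (r + r)) + bit c ∎
  where
  open ≡-Reasoning
  c′ = proj₁ (addBit c (x , y))
  s = proj₂ (addBit c (x , y))
  l = leftVal ps
  r = rightVal ps
  lemma₁ : ∀ s l r c → s + (l + r + c + (l + r + c)) ≡ s + (c + c) + (l + l + (r + r))
  lemma₁ = solve-∀
  lemma₂ : ∀ a b c l r → a + b + c + (l + l + (r + r)) ≡ a + (l + l) + (b + (r + r)) + c
  lemma₂ = solve-∀

val-add : ∀ xs ys → val (add xs ys) ≡ val xs + val ys
val-add xs ys = trans (val-addBits false (align xs ys))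
  (trans (+-identityʳ _) (cong₂ _+_ (leftVal-align xs ys) (rightVal-align xs ys)))

-- Additive, so that the induction over the digits avoids truncated subtraction. After a final
-- borrow the digits are meaningless and only the comparison is kept.
Difference : ℕ → ℕ → Bool × List Bool → Set
Difference m n (false , zs) = val zs + n ≡ m
Difference m n (true  , zs) = m < n

difference-step : ∀ a b c c′ s {l r} res → a + (bit c′ + bit c′) ≡ bit s + b + c → Difference l (r + bit c′) res →
  Difference (a + (l + l)) (b + (r + r) + c) (proj₁ res , s ∷ proj₂ res)
difference-step a b c c′ s {l} {r} (false , zs) eq refl =
  trans (lemma₁ (bit s) b c (val zs) r) (trans (cong (_+ (val zs + val zs + (r + r))) (sym eq)) (lemma₂ a (bit c′) (val zs) r))
  where
  lemma₁ : ∀ s b c v r → s + (v + v) + (b + (r + r) + c) ≡ s + b + c + (v + v + (r + r))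
  lemma₁ = solve-∀
  lemma₂ : ∀ a d v r → a + (d + d) + (v + v + (r + r)) ≡ a + (v + (r + d) + (v + (r + d)))
  lemma₂ = solve-∀
-- Doubling the strict inequality gains 2; the digit `s` may use up 1, which leaves a strict
-- inequality.
difference-step a b c c′ s {l} {r} (true , zs) eq lt = ≤-pred (begin
  2 + (a + (l + l))                  ≡⟨ lemma₁ a l ⟩
  a + (suc l + suc l)                ≤⟨ +-monoʳ-≤ a (+-mono-≤ lt lt) ⟩
  a + (r + bit c′ + (r + bit c′))    ≡⟨ lemma₂ a r (bit c′) ⟩
  a + (bit c′ + bit c′) + (r + r)    ≡⟨ cong (_+ (r + r)) eq ⟩
  bit s + b + c + (r + r)            ≤⟨ +-monoˡ-≤ (r + r) (+-monoˡ-≤ c (+-monoˡ-≤ b (bit≤1 s))) ⟩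
  1 + b + c + (r + r)                ≡⟨ lemma₃ b c r ⟩
  suc (b + (r + r) + c)              ∎)
  where
  open ≤-Reasoning
  lemma₁ : ∀ a l → 2 + (a + (l + l)) ≡ a + (suc l + suc l)
  lemma₁ = solve-∀
  lemma₂ : ∀ a r d → a + (r + d + (r + d)) ≡ a + (d + d) + (r + r)
  lemma₂ = solve-∀
  lemma₃ : ∀ b c r → 1 + b + c + (r + r) ≡ suc (b + (r + r) + c)
  lemma₃ = solve-∀

val-subBits : ∀ c ps → Difference (leftVal ps) (rightVal ps + bit c) (mealy subBit c ps)
val-subBits false [] = refl
val-subBits true  [] = s≤s z≤n
val-subBits c ((x , y) ∷ ps) = difference-step (bit (bitOf x)) (bit (bitOf y)) (bit c) c′ (proj₂ (subBit c (x , y)))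
  (mealy subBit c′ ps) (full-subtractor (bitOf x) (bitOf y) c) (val-subBits c′ ps)
  where c′ = proj₁ (subBit c (x , y))

val-sub : ∀ xs ys → Difference (val xs) (val ys) (sub xs ys)
val-sub xs ys = subst₂ (λ m n → Difference m n (sub xs ys)) (leftVal-align xs ys)
  (trans (+-identityʳ _) (rightVal-align xs ys)) (val-subBits false (align xs ys))

sub-spec : ∀ xs ys → not (proj₁ (sub xs ys)) ≡ does (val ys ≤? val xs) ×
  (not (proj₁ (sub xs ys)) ≡ true → val (proj₂ (sub xs ys)) ≡ val xs ∸ val ys)
sub-spec xs ys with sub xs ys | val-sub xs ys
... | false , zs | eq = sym (dec-true (val ys ≤? val xs) (subst (val ys ≤_) eq (m≤n+m _ _))) ,
  λ _ → trans (sym (m+n∸n≡m (val zs) (val ys))) (cong (_∸ val ys) eq)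
... | true  , zs | lt = sym (dec-false (val ys ≤? val xs) (<⇒≱ lt)) , λ ()

∧-true : ∀ {a b} → a ∧ b ≡ true → a ≡ true × b ≡ true
∧-true {true} {true} _ = refl , refl

sameNum-sound : ∀ xs ys → sameNum xs ys ≡ true → xs ≡ ys
sameNum-sound []           []           _  = refl
sameNum-sound (true ∷ xs)  (true ∷ ys)  eq = cong (true ∷_) (sameNum-sound xs ys eq)
sameNum-sound (false ∷ xs) (false ∷ ys) eq = cong (false ∷_) (sameNum-sound xs ys eq)

sameNum-refl : ∀ xs → sameNum xs xs ≡ true
sameNum-refl []           = refl
sameNum-refl (true ∷ xs)  = sameNum-refl xs
sameNum-refl (false ∷ xs) = sameNum-refl xs

-- Correctness of the operations on points

data RepVec : ∀ {k} → El vec → Vec ℕ k → Set where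
  []  : RepVec [] []
  _∷_ : ∀ {k x xs n} {v : Vec ℕ k} → val x ≡ n → RepVec xs v → RepVec (x ∷ xs) (n ∷ v)

data RepPoint {k} : El point → ℕ∞ k → Set where
  fin : ∀ {xs v} → RepVec xs v → RepPoint (inj₁ xs) (fin v)
  ∞   : RepPoint (inj₂ tt) ∞

data RepMaybe {k} : El value → Maybe (ℕ∞ k) → Set where
  nothing : RepMaybe nothing nothing
  just    : ∀ {x a} → RepPoint x a → RepMaybe (just x) (just a)

vadd-rep : ∀ {k xs ys} {u v : Vec ℕ k} → RepVec xs u → RepVec ys v → RepVec (vadd xs ys) (Vec.zipWith _+_ u v)
vadd-rep []       []       = []
vadd-rep (_∷_ {x = x} refl p) (_∷_ {x = y} refl q) = val-add x y ∷ vadd-rep p q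

-- Generalised over the initial state for the induction. A true final state forces every coordinate
-- to fit, and only then are the computed digits those of the difference.
subNums-rep : ∀ ok {k xs ys} {u v : Vec ℕ k} → RepVec xs u → RepVec ys v →
  let (ok′ , zs) = mealy subNums ok (align xs ys) in
  ok′ ≡ ok ∧ does (decidable _≤?_ v u) × (ok′ ≡ true → RepVec zs (Vec.zipWith _∸_ u v))
subNums-rep ok [] [] = sym (∧-identityʳ ok) , λ _ → []
subNums-rep ok {u = u} {v} (_∷_ {x = x} {xs = xs} {v = u′} refl p) (_∷_ {x = y} {xs = ys} {v = v′} refl q)
  with (fits , diff) ← sub-spec x y
  with (eq , rep) ← subNums-rep (ok ∧ not (proj₁ (sub x y))) p q =
    trans eq (trans (∧-assoc ok _ _) (cong (λ b → ok ∧ (b ∧ does (decidable _≤?_ v′ u′))) fits))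
  , λ t → diff (proj₂ (∧-true {ok} (proj₁ (∧-true {ok ∧ not (proj₁ (sub x y))} (trans (sym eq) t))))) ∷ rep t

vsub-rep : ∀ {k xs ys} {u v : Vec ℕ k} → RepVec xs u → RepVec ys v →
  proj₁ (vsub xs ys) ≡ does (decidable _≤?_ v u) × (proj₁ (vsub xs ys) ≡ true → RepVec (proj₂ (vsub xs ys)) (Vec.zipWith _∸_ u v))
vsub-rep = subNums-rep true

≤-pointwise-antisym : ∀ {k} {u v : Vec ℕ k} → Pointwise _≤_ u v → Pointwise _≤_ v u → u ≡ v
≤-pointwise-antisym []       []       = refl
≤-pointwise-antisym (p ∷ ps) (q ∷ qs) = cong₂ _∷_ (≤-antisym p q) (≤-pointwise-antisym ps qs)

≤-pointwise-refl : ∀ {k} (u : Vec ℕ k) → Pointwise _≤_ u u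
≤-pointwise-refl []      = []
≤-pointwise-refl (_ ∷ u) = ≤-refl ∷ ≤-pointwise-refl u

does-true : ∀ {A : Set} (d : Dec A) → does d ≡ true → A
does-true (yes a) _ = a

data CapSpec {k} (a b : ℕ∞ k) : El value → Set where
  same : ∀ {x} → RepPoint x a → a ≡ b → CapSpec a b (just x)
  diff : a ≢ b → CapSpec a b nothing

capP-spec : ∀ {k x y} {a b : ℕ∞ k} → RepPoint x a → RepPoint y b → CapSpec a b (capP x y)
capP-spec ∞ ∞ = same ∞ refl
capP-spec ∞ (fin _) = diff λ ()
capP-spec (fin _) ∞ = diff λ ()
capP-spec (fin {xs} {u} p) (fin {ys} {v} q) with proj₁ (vsub xs ys) ∧ proj₁ (vsub ys xs) in eq
... | true = same (fin p) (cong fin (≤-pointwise-antisym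
  (does-true (decidable _≤?_ u v) (trans (sym (proj₁ (vsub-rep q p))) (proj₂ (∧-true {proj₁ (vsub xs ys)} eq))))
  (does-true (decidable _≤?_ v u) (trans (sym (proj₁ (vsub-rep p q))) (proj₁ (∧-true eq))))))
... | false = diff λ { refl → contradiction (trans (sym eq) (cong₂ _∧_
    (trans (proj₁ (vsub-rep p q)) (dec-true (decidable _≤?_ u u) (≤-pointwise-refl u)))
    (trans (proj₁ (vsub-rep q p)) (dec-true (decidable _≤?_ u u) (≤-pointwise-refl u))))) λ () }

plusP-rep : ∀ {k x y} {a b : ℕ∞ k} → RepPoint x a → RepPoint y b → RepMaybe (plusP x y) (just (a +∞ b))
plusP-rep (fin p) (fin q) = just (fin (vadd-rep p q))
plusP-rep (fin _) ∞       = just ∞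
plusP-rep ∞       _       = just ∞

minusP-rep : ∀ {k x y} {a b : ℕ∞ k} → RepPoint x a → RepPoint y b → RepMaybe (minusP x y) (a -∞ b)
minusP-rep (fin {xs} {u} p) (fin {ys} {v} q) with proj₁ (vsub xs ys) | vsub-rep p q
... | true  | eq , rep rewrite sym eq = just (fin (rep refl))
... | false | eq , rep rewrite sym eq = nothing
minusP-rep (fin _) ∞       = nothing
minusP-rep ∞       (fin _) = just ∞
minusP-rep ∞       ∞       = nothing

-- Uniqueness is part of the second clause: an element of a sum or difference comes with arbitrary
-- operands, which must be identified with the represented ones.
Denotes : ∀ {k} → Subset k → El value → Set
Denotes A nothing  = ∀ c → ¬ A c
Denotes A (just x) = ∃[ a ] (RepPoint x a × A a × ∀ c → A c → c ≡ a)

-- The form to which `evalOp` reduces on two predecessors.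
bothValues : (El point → El point → El value) → El value → El value → El value
bothValues f m n = maybe′ (λ x → maybe′ (λ y → f x y) nothing n) nothing m

capP-denotes : ∀ {k} {A B : Subset k} m n → Denotes A m → Denotes B n → Denotes (⟦ cap ⟧ A B) (bothValues capP m n)
capP-denotes nothing  n        ¬A _ = λ c (a , _) → ¬A c a
capP-denotes (just x) nothing  _ ¬B = λ c (_ , b) → ¬B c b
capP-denotes {A = A} {B} (just x) (just y) (a , p , a∈A , onlyA) (b , q , b∈B , onlyB)
  with capP x y | capP-spec p q
... | _ | same r refl = a , r , (a∈A , b∈B) , λ c (c∈A , _) → onlyA c c∈A
... | _ | diff a≢b    = λ c (c∈A , c∈B) → a≢b (trans (sym (onlyA c c∈A)) (onlyB c c∈B))

plusP-denotes : ∀ {k} {A B : Subset k} m n → Denotes A m → Denotes B n → Denotes (⟦ plus ⟧ A B) (bothValues plusP m n)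
plusP-denotes nothing  n        ¬A _ = λ c (a , _ , a∈A , _) → ¬A a a∈A
plusP-denotes (just x) nothing  _ ¬B = λ c (_ , b , _ , b∈B , _) → ¬B b b∈B
plusP-denotes (just x) (just y) (a , p , a∈A , onlyA) (b , q , b∈B , onlyB)
  with plusP x y | plusP-rep p q
... | _ | just r = _ , r , (a , b , a∈A , b∈B , refl) ,
  λ { c (a′ , b′ , a′∈A , b′∈B , eq) → trans (sym eq) (cong₂ _+∞_ (onlyA a′ a′∈A) (onlyB b′ b′∈B)) }

minusP-denotes : ∀ {k} {A B : Subset k} m n → Denotes A m → Denotes B n → Denotes (⟦ minus ⟧ A B) (bothValues minusP m n)
minusP-denotes nothing  n        ¬A _ = λ c (a , _ , a∈A , _) → ¬A a a∈A
minusP-denotes (just x) nothing  _ ¬B = λ c (_ , b , _ , b∈B , _) → ¬B b b∈B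
minusP-denotes (just x) (just y) (a , p , a∈A , onlyA) (b , q , b∈B , onlyB)
  with minusP x y | a -∞ b in eq | minusP-rep p q
... | _ | _ | nothing = λ { c (a′ , b′ , a′∈A , b′∈B , eq′) →
  case trans (sym eq′) (trans (cong₂ _-∞_ (onlyA a′ a′∈A) (onlyB b′ b′∈B)) eq) of λ () }
... | _ | just d | just r = d , r , (a , b , a∈A , b∈B , eq) ,
  λ { c (a′ , b′ , a′∈A , b′∈B , eq′) →
    just-injective (trans (sym eq′) (trans (cong₂ _-∞_ (onlyA a′ a′∈A) (onlyB b′ b′∈B)) eq)) }

-- The code of a circuit listed in a given order

Ops : List Op
Ops = bin cap ∷ bin plus ∷ bin minus ∷ []

rawVec : ∀ {k} → Vec ℕ k → El vec
rawVec v = map digits (toList v)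

rawPoint : ∀ {k} → ℕ∞ k → El point
rawPoint (fin v) = inj₁ (rawVec v)
rawPoint ∞       = inj₂ tt

rawOp : BinOp → Bool × Bool
rawOp cup   = false , false
rawOp cap   = false , true
rawOp plus  = true , false
rawOp minus = true , true

rawFin : ∀ {n} → Fin n → El num
rawFin g = digits (toℕ g)

rawFin-injective : ∀ {n} {g h : Fin n} → rawFin g ≡ rawFin h → g ≡ h
rawFin-injective eq = toℕ-injective (digits-injective eq)

rawLabel : ∀ {O k n} → Gate O k n → El label
rawLabel (input x)          = inj₁ (rawPoint x)
rawLabel (unary _ _)        = inj₂ (inj₁ tt)
rawLabel (binary σ _ _ _ _) = inj₂ (inj₂ (rawOp σ))

rawPreds : ∀ {O k n} → Gate O k n → List (El num)
rawPreds G = map rawFin (preds G)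

rawEntry : ∀ {O k n} → (Fin n → Gate O k n) → Fin n → El entry
rawEntry gate g = rawFin g , rawLabel (gate g) , rawPreds (gate g)

rawCircuit : ∀ {O k} (C : Circuit O k) → List (Fin (Circuit.size C)) → ℕ∞ k → El circuit
rawCircuit C order b = map (rawEntry (Circuit.gate C)) order , rawFin (Circuit.output C) , rawPoint b

encodeList-map : ∀ {A B : Set} {e : B → List Bool} {e′ : A → List Bool} (f : A → B) → (∀ x → e (f x) ≡ e′ x) →
  ∀ xs → encodeList e (map f xs) ≡ encodeList e′ xs
encodeList-map f eq []       = refl
encodeList-map f eq (x ∷ xs) = cong (true ∷_) (cong₂ _++_ (eq x) (encodeList-map f eq xs))

enc-num : ∀ (ds : El num) → enc {num} ds ≡ encodeList (_∷ []) ds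
enc-num []       = refl
enc-num (d ∷ ds) = cong (λ bs → true ∷ d ∷ bs) (enc-num ds)

enc-rawPoint : ∀ {k} (x : ℕ∞ k) → enc {point} (rawPoint x) ≡ encodeℕ∞ x
enc-rawPoint (fin v) = cong (false ∷_) (encodeList-map digits (λ n → enc-num (digits n)) (toList v))
enc-rawPoint ∞       = refl

enc-rawLabel : ∀ {O k n} (G : Gate O k n) → enc {label} (rawLabel G) ≡ encodeLabel G
enc-rawLabel (input x)              = cong (false ∷_) (enc-rawPoint x)
enc-rawLabel (unary _ _)            = refl
enc-rawLabel (binary cup _ _ _ _)   = refl
enc-rawLabel (binary cap _ _ _ _)   = refl
enc-rawLabel (binary plus _ _ _ _)  = refl
enc-rawLabel (binary minus _ _ _ _) = refl

enc-rawCircuit : ∀ {O k} (C : Circuit O k) order b → enc {circuit} (rawCircuit C order b) ≡ encode C order b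
enc-rawCircuit C order b = cong₂ _++_ (encodeList-map (rawEntry gate) enc-entry order)
    (cong₂ _++_ (enc-num (rawFin output)) (enc-rawPoint b))
  where
  open Circuit C
  enc-entry : ∀ g → enc {entry} (rawEntry gate g) ≡ encodeEntry C g
  enc-entry g = cong₂ _++_ (enc-num (rawFin g))
    (cong₂ _++_ (enc-rawLabel (gate g)) (encodeList-map rawFin (λ h → enc-num (rawFin h)) (preds (gate g))))

-- Correctness of the evaluation

rawVec-rep : ∀ {k} (v : Vec ℕ k) → RepVec (rawVec v) v
rawVec-rep []      = []
rawVec-rep (n ∷ v) = val-digits n ∷ rawVec-rep v

rawPoint-rep : ∀ {k} (x : ℕ∞ k) → RepPoint (rawPoint x) x
rawPoint-rep (fin v) = fin (rawVec-rep v)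
rawPoint-rep ∞       = ∞

-- The propositional form of `ordered`. Evaluation, accessibility and reverse topological order are
-- all derived from it by induction.
data Closed {O k n} (gate : Fin n → Gate O k n) : List (Fin n) → Set where
  []  : Closed gate []
  _∷_ : ∀ {g gs} → All (_∈ gs) (preds (gate g)) → Closed gate gs → Closed gate (g ∷ gs)

evalGate-denotes : ∀ {k} (C : Circuit Ops k) ρ (G : Gate Ops k (Circuit.size C)) (I : ∀ {h} → h ∈ preds G → Subset k) →
  (∀ {h} (m : h ∈ preds G) → Denotes (I m) (lookupNum (rawFin h) ρ)) →
  Denotes (Circuit.evalGate C G I) (evalGateCode (rawLabel G) (rawPreds G) ρ)
evalGate-denotes C ρ (input x) I H = x , rawPoint-rep x , refl , λ c eq → sym eq
evalGate-denotes C ρ (unary (there (there (there ()))) _) I H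
evalGate-denotes C ρ (binary cup (there (there (there ()))) _ _ _) I H
evalGate-denotes C ρ (binary cap _ g h _) I H =
  capP-denotes (lookupNum (rawFin g) ρ) (lookupNum (rawFin h) ρ) (H (here refl)) (H (there (here refl)))
evalGate-denotes C ρ (binary plus _ g h _) I H =
  plusP-denotes (lookupNum (rawFin g) ρ) (lookupNum (rawFin h) ρ) (H (here refl)) (H (there (here refl)))
evalGate-denotes C ρ (binary minus _ g h _) I H =
  minusP-denotes (lookupNum (rawFin g) ρ) (lookupNum (rawFin h) ρ) (H (here refl)) (H (there (here refl)))

lookup-head : ∀ n x ρ → lookupNum n ((n , x) ∷ ρ) ≡ x
lookup-head n x ρ rewrite sameNum-refl n = refl

lookup-tail : ∀ n m x ρ → n ≢ m → lookupNum n ((m , x) ∷ ρ) ≡ lookupNum n ρ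
lookup-tail n m x ρ n≢m with sameNum n m in eq
... | true  = contradiction (sameNum-sound n m eq) n≢m
... | false = refl

module _ {k} (C : Circuit Ops k) where
  open Circuit C

  -- Stated for every accessibility proof, because `resultAcc` descends along the proofs stored in
  -- the given one and not along `⟶-wellFounded`.
  evalAll-denotes : ∀ {gs} → Closed gate gs → ∀ {g} → g ∈ gs → (a : Acc _⟶_ g) →
    Denotes (resultAcc g a) (lookupNum (rawFin g) (evalAll (map (rawEntry gate) gs)))
  evalAll-denotes {g ∷ gs} (ps ∷ closed) {h} m a with h Fin.≟ g
  evalAll-denotes {g ∷ gs} (ps ∷ closed) m (Acc.acc rs) | yes refl =
    subst (Denotes (resultAcc g (Acc.acc rs))) (sym (lookup-head (rawFin g) _ (evalAll (map (rawEntry gate) gs))))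
      (evalGate-denotes C _ (gate g) _ λ p → evalAll-denotes closed (All.lookup ps p) (rs p))
  evalAll-denotes {g ∷ gs} (ps ∷ closed) (here h≡g) a | no h≢g = contradiction h≡g h≢g
  evalAll-denotes {g ∷ gs} (ps ∷ closed) {h} (there m) a | no h≢g =
    subst (Denotes (resultAcc h a)) (sym (lookup-tail (rawFin h) (rawFin g) _ (evalAll (map (rawEntry gate) gs)) (h≢g ∘ rawFin-injective)))
      (evalAll-denotes closed m a)

  holds-correct : ∀ {order} → Closed gate order → output ∈ order → ∀ b →
    holds (rawCircuit C order b) ≡ true ⇔ resultSet C b
  holds-correct {order} closed m b
    with lookupNum (rawFin output) (evalAll (map (rawEntry gate) order)) | evalAll-denotes closed m (⟶-wellFounded output)
  ... | nothing | empty = mk⇔ (λ ()) (λ b∈C → contradiction b∈C (empty b))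
  ... | just x  | a , p , a∈C , only with capP x (rawPoint b) | capP-spec p (rawPoint-rep b)
  ...   | _ | same _ refl = mk⇔ (λ _ → a∈C) (λ _ → refl)
  ...   | _ | diff a≢b    = mk⇔ (λ ()) (λ b∈C → contradiction (sym (only b b∈C)) a≢b)

-- Correctness of the recognition

all⁻ : ∀ {A : Set} {p : A → Bool} xs → all p xs ≡ true → All (λ x → p x ≡ true) xs
all⁻ []       _  = []
all⁻ (x ∷ xs) eq with (h , t) ← ∧-true eq = h ∷ all⁻ xs t

all⁺ : ∀ {A : Set} {p : A → Bool} {xs} → All (λ x → p x ≡ true) xs → all p xs ≡ true
all⁺ []       = refl
all⁺ (h ∷ hs) = cong₂ _∧_ h (all⁺ hs)

memberNum⁻ : ∀ d ds → memberNum d ds ≡ true → d ∈ ds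
memberNum⁻ d (e ∷ ds) eq with sameNum d e in eq′
... | true  = here (sameNum-sound d e eq′)
... | false = there (memberNum⁻ d ds eq)

memberNum⁺ : ∀ {d ds} → d ∈ ds → memberNum d ds ≡ true
memberNum⁺ {d} (here refl) rewrite sameNum-refl d = refl
memberNum⁺ {d} {e ∷ ds} (there m) with sameNum d e
... | true  = refl
... | false = memberNum⁺ m

covers⁻ : ∀ ds i xs → covers ds (digits i) xs ≡ true → ∀ {j} → j < length xs → digits (i + j) ∈ ds
covers⁻ ds i (x ∷ xs) eq {zero} lt rewrite +-identityʳ i = memberNum⁻ (digits i) ds (proj₁ (∧-true eq))
covers⁻ ds i (x ∷ xs) eq {suc j} (s≤s lt) rewrite +-suc i j =
  covers⁻ ds (suc i) xs (proj₂ (∧-true {memberNum (digits i) ds} eq)) lt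

covers⁺ : ∀ ds i xs → (∀ {j} → j < length xs → digits (i + j) ∈ ds) → covers ds (digits i) xs ≡ true
covers⁺ ds i []       h = refl
covers⁺ ds i (x ∷ xs) h = cong₂ _∧_ (memberNum⁺ (subst (λ n → digits n ∈ ds) (+-identityʳ i) (h (s≤s z≤n))))
  (covers⁺ ds (suc i) xs λ {j} lt → subst (λ n → digits n ∈ ds) (+-suc i j) (h (s≤s lt)))

-- The pigeonhole principle: deleting `x` from both lists preserves the hypotheses, the inclusion
-- because `x` does not recur in `xs`.
unique⇒↭ : ∀ {A : Set} {xs ys : List A} → Unique xs → All (_∈ ys) xs → length ys ≤ length xs → xs ↭ ys
unique⇒↭ {ys = []} [] [] le = ↭-reflexive refl
unique⇒↭ {xs = x ∷ xs} (x∉xs ∷ unique) (x∈ys ∷ xs⊆ys) le with as , bs , refl ← ∈-∃++ x∈ys =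
  ↭-trans (prep x (unique⇒↭ unique (rest x∉xs xs⊆ys)
    (≤-pred (≤-trans (≤-reflexive (sym (↭-length (↭-shift x as bs)))) le)))) (↭-sym (↭-shift x as bs))
  where
  rest : ∀ {zs} → All (x ≢_) zs → All (_∈ as ++ x ∷ bs) zs → All (_∈ as ++ bs) zs
  rest []           []       = []
  rest (x≢z ∷ ne) (m ∷ ms) with ∈-resp-↭ (↭-shift x as bs) m
  ... | here z≡x = contradiction (sym z≡x) x≢z
  ... | there m′ = m′ ∷ rest ne ms

numbers-↭ : ∀ ds → covers ds [] ds ≡ true → map rawFin (allFin (length ds)) ↭ ds
numbers-↭ ds eq = unique⇒↭ (Unique.map⁺ rawFin-injective (Unique.allFin⁺ (length ds)))
  (All.map⁺ (All.universal (λ g → covers⁻ ds 0 ds eq (toℕ<n g)) (allFin (length ds))))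
  (≤-reflexive (sym (trans (length-map rawFin (allFin (length ds))) (length-tabulate {n = length ds} id))))

module _ {O k n} (gate : Fin n → Gate O k n) where

  gateNumbers-raw : ∀ gs → gateNumbers (map (rawEntry gate) gs) ≡ map rawFin gs
  gateNumbers-raw gs = sym (map-∘ gs)

  ordered⁻ : ∀ gs → ordered (map (rawEntry gate) gs) ≡ true → Closed gate gs
  ordered⁻ []       _  = []
  ordered⁻ (g ∷ gs) eq with (h , t) ← ∧-true eq =
    All.map (λ {p} m → later p (memberNum⁻ (rawFin p) (gateNumbers (map (rawEntry gate) gs)) m)) (All.map⁻ (all⁻ (rawPreds (gate g)) h)) ∷ ordered⁻ gs t
    where
    later : ∀ p → rawFin p ∈ gateNumbers (map (rawEntry gate) gs) → p ∈ gs
    later p m with q , q∈gs , eq ← ∈-map⁻ rawFin (subst (rawFin p ∈_) (gateNumbers-raw gs) m)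
      rewrite rawFin-injective {g = p} {q} eq = q∈gs

  ordered⁺ : ∀ {gs} → Closed gate gs → ordered (map (rawEntry gate) gs) ≡ true
  ordered⁺ []                   = refl
  ordered⁺ {g ∷ gs} (ps ∷ closed) = cong₂ _∧_
    (all⁺ (All.map⁺ (All.map (λ m → memberNum⁺ (subst (_ ∈_) (sym (gateNumbers-raw gs)) (∈-map⁺ rawFin m))) ps)))
    (ordered⁺ closed)

  Edge : Fin n → Fin n → Set
  Edge h g = h ∈ preds (gate g)

  closed-preds : ∀ {gs} → Closed gate gs → ∀ {g} → g ∈ gs → ∀ {p} → Edge p g → p ∈ gs
  closed-preds (ps ∷ closed) (here refl) e = there (All.lookup ps e)
  closed-preds (ps ∷ closed) (there m)   e = there (closed-preds closed m e)

  -- The source of acyclicity: a predecessor lies in a shorter tail of the listing, so the recursion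
  -- follows the list.
  closed-acc : ∀ {gs} → Closed gate gs → ∀ {g} → g ∈ gs → Acc Edge g
  closed-acc (ps ∷ closed) (here refl) = Acc.acc λ e → closed-acc closed (All.lookup ps e)
  closed-acc (ps ∷ closed) (there m)   = closed-acc closed m

  -- If `g` were a predecessor of a later gate, it would be listed again below that gate, against
  -- uniqueness.
  closed-pairs : ∀ {gs} → Unique gs → Closed gate gs → AllPairs (λ g h → ¬ Edge g h) gs
  closed-pairs []                 []            = []
  closed-pairs (g∉gs ∷ unique) (ps ∷ closed) =
    All.tabulate (λ m e → All.lookup g∉gs (closed-preds closed m e) refl) ∷ closed-pairs unique closed

  -- A predecessor of the first gate is listed somewhere and differs from that gate, hence is below
  -- it. Nor is the first gate a predecessor of a later one, so the tail still contains all its own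
  -- predecessors.
  pairs-closed : ∀ {gs} → (∀ g → ¬ Edge g g) → AllPairs (λ g h → ¬ Edge g h) gs →
    (∀ {g} → g ∈ gs → ∀ {p} → Edge p g → p ∈ gs) → Closed gate gs
  pairs-closed irr [] _ = []
  pairs-closed {g ∷ gs} irr (later ∷ pairs) h =
    All.tabulate (λ e → case h (here refl) e of λ { (here refl) → contradiction e (irr g) ; (there m) → m })
    ∷ pairs-closed irr pairs λ m e → case h (there m) e of λ { (here refl) → contradiction e (All.lookup later m) ; (there m′) → m′ }

acc⇒irrefl : ∀ {A : Set} {_<_ : A → A → Set} {x} → Acc _<_ x → ¬ x < x
acc⇒irrefl (Acc.acc rs) x<x = acc⇒irrefl (rs x<x) x<x

shape⁺ : ∀ {k n} (G : Gate Ops k n) → shape (rawLabel G) (rawPreds G) ≡ true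
shape⁺ (input _) = refl
shape⁺ (unary (there (there (there ()))) _)
shape⁺ (binary σ m g h g≤h) = cong₂ _∧_ (notCup σ m) (trans (proj₁ (sub-spec (rawFin h) (rawFin g)))
    (dec-true (val (rawFin g) ≤? val (rawFin h)) (subst₂ _≤_ (sym (val-digits (toℕ g))) (sym (val-digits (toℕ h))) g≤h)))
  where
  notCup : ∀ σ → bin σ ∈ Ops → proj₁ (rawOp σ) ∨ proj₂ (rawOp σ) ≡ true
  notCup cup   (there (there (there ())))
  notCup cap   _ = refl
  notCup plus  _ = refl
  notCup minus _ = refl

decodeOp : ∀ b c → b ∨ c ≡ true → ∃[ σ ] (bin σ ∈ Ops × (b , c) ≡ rawOp σ)
decodeOp false true  _ = cap , here refl , refl
decodeOp true  false _ = plus , there (here refl) , refl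
decodeOp true  true  _ = minus , there (there (here refl)) , refl

-- The tests supply just what the constructors of `Gate` demand: an operation in `Ops` and ordered
-- operands. The hypothesis on `inputOf` supplies the typed point of an input gate.
shape⁻ : ∀ {k n} l ps → shape l ps ≡ true → (∃[ x ] inputOf l ≡ rawPoint {k} x) →
  All (λ p → ∃[ g ] p ≡ rawFin {n} g) ps → Σ[ G ∈ Gate Ops k n ] (l , ps) ≡ (rawLabel G , rawPreds G)
shape⁻ (inj₁ _) [] _ (x , refl) [] = input x , refl
shape⁻ (inj₂ (inj₂ (b , c))) (_ ∷ _ ∷ []) eq _ ((g , refl) ∷ (h , refl) ∷ [])
  with (op , le) ← ∧-true {b ∨ c} eq with σ , m , refl ← decodeOp b c op =
  binary σ m g h (subst₂ _≤_ (val-digits (toℕ g)) (val-digits (toℕ h))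
    (does-true (val (rawFin g) ≤? val (rawFin h)) (trans (sym (proj₁ (sub-spec (rawFin h) (rawFin g)))) le))) , refl

vector⁻ : ∀ (t v : El vec) → all bothJust (align t v) ≡ true → All (λ d → canonical d ≡ true) v → ∃[ u ] v ≡ rawVec {length t} u
vector⁻ []      []      _  _        = [] , refl
vector⁻ (_ ∷ t) (d ∷ v) eq (c ∷ cs) with u , eq′ ← vector⁻ t v eq cs =
  val d ∷ u , cong₂ _∷_ (sym (canonical-sound d c)) eq′

pointOK⁻ : ∀ t x → pointOK t x ≡ true → ∃[ a ] x ≡ rawPoint {length t} a
pointOK⁻ t (inj₂ _) _  = ∞ , refl
pointOK⁻ t (inj₁ v) eq with (len , can) ← ∧-true {all bothJust (align t v)} eq
  with u , refl ← vector⁻ t v len (all⁻ v can) = fin u , refl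

-- Without a vector among the points the template has length 1 in place of `k`; but then every point
-- is ∞, which passes for any template.
template-raw : ∀ {k} (xs : List (ℕ∞ k)) →
  length (template (map rawPoint xs)) ≡ k ⊎ template (map rawPoint xs) ≡ ([] ∷ []) × All (_≡ ∞) xs
template-raw []           = inj₂ (refl , [])
template-raw (fin v ∷ xs) = inj₁ (length-rawVec v)
  where
  length-rawVec : ∀ {k} (v : Vec ℕ k) → length (rawVec v) ≡ k
  length-rawVec []      = refl
  length-rawVec (_ ∷ v) = cong suc (length-rawVec v)
template-raw (∞ ∷ xs) with template-raw xs
... | inj₁ eq         = inj₁ eq
... | inj₂ (eq , eqs) = inj₂ (eq , refl ∷ eqs)

pointOK⁺ : ∀ {k} t (x : ℕ∞ k) → length t ≡ k → pointOK t (rawPoint x) ≡ true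
pointOK⁺ t ∞       _    = refl
pointOK⁺ t (fin v) refl = cong₂ _∧_ (len t v) (all⁺ (All.map⁺ (All.universal canonical-digits (toList v))))
  where
  len : ∀ t (v : Vec ℕ (length t)) → all bothJust (align t (rawVec v)) ≡ true
  len []      []      = refl
  len (_ ∷ t) (_ ∷ v) = len t v

pointsOK⁺ : ∀ {k} → 1 ≤ k → (xs : List (ℕ∞ k)) → pointsOK (map rawPoint xs) ≡ true
pointsOK⁺ 1≤k xs with template (map rawPoint xs) | template-raw xs
... | t     | inj₂ (refl , eqs) = all⁺ (All.map⁺ (All.map (λ { refl → refl }) eqs))
... | _ ∷ t | inj₁ eq           = all⁺ (All.map⁺ (All.universal (λ x → pointOK⁺ (_ ∷ t) x eq) xs))
pointsOK⁺ () xs | [] | inj₁ refl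

inputPoint : ∀ {O k n} → Gate O k n → ℕ∞ k
inputPoint (input x) = x
inputPoint _         = ∞

inputOf-raw : ∀ {O k n} (G : Gate O k n) → inputOf (rawLabel G) ≡ rawPoint (inputPoint G)
inputOf-raw (input _)          = refl
inputOf-raw (unary _ _)        = refl
inputOf-raw (binary _ _ _ _ _) = refl

module _ {k} (C : Circuit Ops k) where
  open Circuit C renaming (size to gateCount)

  order-complete : ∀ {order} → ReverseTopological order → ∀ g → g ∈ order
  order-complete (perm , _) g = ∈-resp-↭ (↭-sym perm) (∈-allFin g)

  order-closed : ∀ {order} → ReverseTopological order → Closed gate order
  order-closed rt = pairs-closed gate (λ g e → acyclic g ⁺.[ e ]) (proj₂ rt) (λ _ _ → order-complete rt _)

  wellFormed-complete : ∀ {order} → 1 ≤ k → ReverseTopological order → ∀ b → wellFormed (rawCircuit C order b) ≡ true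
  wellFormed-complete {order} 1≤k rt b = cong₂ _∧_ covered (cong₂ _∧_ (memberNum⁺ (listed output))
      (cong₂ _∧_ (ordered⁺ gate (order-closed rt)) (cong₂ _∧_ shaped
        (trans (cong pointsOK points≡) (pointsOK⁺ 1≤k (b ∷ map (λ g → inputPoint (gate g)) order))))))
    where
    entries : List (El entry)
    entries = map (rawEntry gate) order
    count : length (gateNumbers entries) ≡ gateCount
    count = trans (length-map proj₁ entries) (trans (length-map (rawEntry gate) order)
      (trans (↭-length (proj₁ rt)) (length-tabulate {n = gateCount} id)))
    listed : ∀ g → rawFin g ∈ gateNumbers entries
    listed g = subst (rawFin g ∈_) (sym (gateNumbers-raw gate order)) (∈-map⁺ rawFin (order-complete rt g))
    number : ∀ {j} → j < gateCount → digits j ∈ gateNumbers entries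
    number lt = subst (λ n → digits n ∈ gateNumbers entries) (toℕ-fromℕ< lt) (listed (fromℕ< lt))
    covered : covers (gateNumbers entries) [] (gateNumbers entries) ≡ true
    covered = covers⁺ (gateNumbers entries) 0 (gateNumbers entries) λ {j} lt → number (subst (j <_) count lt)
    shaped : all (λ (_ , l , ps) → shape l ps) entries ≡ true
    shaped = all⁺ (All.map⁺ {f = rawEntry gate} (All.universal (λ g → shape⁺ (gate g)) order))
    points≡ : points entries (rawPoint b) ≡ map rawPoint (b ∷ map (λ g → inputPoint (gate g)) order)
    points≡ = cong (rawPoint b ∷_) (trans (sym (map-∘ {g = λ (_ , l , _) → inputOf l} {f = rawEntry gate} order))
      (trans (map-cong (λ g → inputOf-raw (gate g)) order) (map-∘ {g = rawPoint} {f = λ g → inputPoint (gate g)} order)))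

-- Reconstruction of a circuit from a well-formed listing

GateFor : ∀ {k n} → Fin n → El entry → Set
GateFor {k} {n} g e = Σ[ G ∈ Gate Ops k n ] e ≡ (rawFin g , rawLabel G , rawPreds G)

gatesFor : ∀ {k n} gs es → gateNumbers es ≡ map rawFin gs →
  All (λ (_ , e) → Σ[ G ∈ Gate Ops k n ] e ≡ (rawLabel G , rawPreds G)) es → Listwise.Pointwise (GateFor {k} {n}) gs es
gatesFor []       []             _  _                = Listwise.[]
gatesFor (g ∷ gs) ((m , e) ∷ es) eq ((G , eq′) ∷ Gs) =
  (G , cong₂ _,_ (proj₁ (∷-injective eq)) eq′) Listwise.∷ gatesFor gs es (proj₂ (∷-injective eq)) Gs

-- The gates are found in listing order, but a circuit wants a function of the gate number; the
-- position of the number in the listing mediates.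
select : ∀ {k n gs es} → Listwise.Pointwise (GateFor {k} {n}) gs es → ∀ {g} → g ∈ gs → Gate Ops k n
select ((G , _) Listwise.∷ Gs) (here _)  = G
select (_       Listwise.∷ Gs) (there m) = select Gs m

select-entries : ∀ {k n gs es} (Gs : Listwise.Pointwise (GateFor {k} {n}) gs es) (gate : Fin n → Gate Ops k n) →
  (∀ {g} (m : g ∈ gs) → gate g ≡ select Gs m) → map (rawEntry gate) gs ≡ es
select-entries Listwise.[] gate eq = refl
select-entries ((G , refl) Listwise.∷ Gs) gate eq =
  cong₂ _∷_ (cong (λ H → _ , rawLabel H , rawPreds H) (eq (here refl))) (select-entries Gs gate (λ m → eq (there m)))

-- Breaks a circularity: `ordered⁻` presupposes a function `gate`, and building one requires that
-- all predecessors be gate numbers.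
ordered-listed : ∀ es → ordered es ≡ true → All (λ (_ , _ , ps) → All (_∈ gateNumbers es) ps) es
ordered-listed [] _ = []
ordered-listed ((_ , _ , ps) ∷ es) eq with (h , t) ← ∧-true eq =
  All.map (λ {p} m → there (memberNum⁻ p (gateNumbers es) m)) (all⁻ ps h)
  ∷ All.map (All.map there) (ordered-listed es t)

module Rebuild (es : List (El entry)) (out : El num) (b : El point) (wf : wellFormed (es , out , b) ≡ true) where

  numbers : List (El num)
  numbers = gateNumbers es

  n k : ℕ
  n = length numbers
  -- Equal to 1 if no vector occurs, by the default of `template`.
  k = length (template (points es b))

  covered : covers numbers [] numbers ≡ true × _
  covered = ∧-true wf

  output-listed : memberNum out numbers ≡ true × _
  output-listed = ∧-true (proj₂ covered)

  in-order : ordered es ≡ true × _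
  in-order = ∧-true (proj₂ output-listed)

  shaped : all (λ (_ , l , ps) → shape l ps) es ≡ true × pointsOK (points es b) ≡ true
  shaped = ∧-true (proj₂ in-order)

  k-positive : 1 ≤ k
  k-positive = positive (template (points es b)) (proj₁ (∧-true (proj₂ shaped)))
    where
    positive : ∀ (t : El vec) → not (null t) ≡ true → 1 ≤ length t
    positive (_ ∷ _) _ = s≤s z≤n

  all-points : All (λ x → ∃[ a ] x ≡ rawPoint {k} a) (points es b)
  all-points = All.map (λ {x} → pointOK⁻ (template (points es b)) x)
    (all⁻ (points es b) (proj₂ (∧-true {not (null (template (points es b)))} (proj₂ shaped))))

  listing : ∃[ gs ] (numbers ≡ map rawFin gs × allFin n ↭ gs)
  listing = ↭-map-inv rawFin (numbers-↭ numbers (proj₁ covered))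

  order : List (Fin n)
  order = proj₁ listing

  listed : ∀ g → g ∈ order
  listed g = ∈-resp-↭ (proj₂ (proj₂ listing)) (∈-allFin g)

  unique : Unique order
  unique = Permutationₛ.Unique-resp-↭ (setoid (Fin n)) (↭⇒↭ₛ (proj₂ (proj₂ listing))) (Unique.allFin⁺ n)

  numbered : ∀ {p} → p ∈ numbers → ∃[ g ] p ≡ rawFin {n} g
  numbered {p} m with g , _ , eq ← ∈-map⁻ rawFin (subst (p ∈_) (proj₁ (proj₂ listing)) m) = g , eq

  gates : All (λ (_ , e) → Σ[ G ∈ Gate Ops k n ] e ≡ (rawLabel G , rawPreds G)) es
  gates = All.zipWith (λ {(_ , l , ps)} (sh , x , ns) → shape⁻ l ps sh x (All.map numbered ns))
    (all⁻ es (proj₁ shaped) , All.zip (All.map⁻ (All.tail all-points) , ordered-listed es (proj₁ in-order)))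

  Gs : Listwise.Pointwise (GateFor {k} {n}) order es
  Gs = gatesFor order es (proj₁ (proj₂ listing)) gates

  gate : Fin n → Gate Ops k n
  gate g = select Gs (listed g)

  entries≡ : map (rawEntry gate) order ≡ es
  -- Each gate is listed once, so `select` does not depend on the membership proof.
  entries≡ = select-entries Gs gate (λ m → cong (select Gs) (unique⇒irrelevant unique _ m))

  closed : Closed gate order
  closed = ordered⁻ gate order (subst (λ es → ordered es ≡ true) (sym entries≡) (proj₁ in-order))

  output : ∃[ g ] out ≡ rawFin {n} g
  output = numbered (memberNum⁻ out numbers (proj₁ output-listed))

  C : Circuit Ops k
  C = record
    { size    = n
    ; gate    = gate
    ; output  = proj₁ output
    -- The transitive closure of a well-founded relation is well-founded, hence irreflexive.
    ; acyclic = λ g → acc⇒irrefl (⁺.wellFounded (Edge gate) (λ g → closed-acc gate closed (listed g)) g)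
    }

  reverseTopological : Circuit.ReverseTopological C order
  reverseTopological = ↭-sym (proj₂ (proj₂ listing)) , closed-pairs gate unique closed

  listing≡ : (es , out , b) ≡ rawCircuit C order (proj₁ (All.head all-points))
  listing≡ = cong₂ _,_ (sym entries≡) (cong₂ _,_ (proj₂ output) (proj₂ (All.head all-points)))

-- Accepted strings and positive instances

wellFormed-sound : ∀ c → wellFormed c ≡ true → ∃[ k ] (1 ≤ k × Σ[ C ∈ Circuit Ops k ] ∃[ b ] ∃[ order ]
  (Circuit.ReverseTopological C order × c ≡ rawCircuit C order b))
wellFormed-sound (es , out , b) wf = k , k-positive , C , _ , order , reverseTopological , listing≡
  where open Rebuild es out b wf

decide-correct : ∀ {k} (C : Circuit Ops k) {order} → Circuit.ReverseTopological C order → ∀ b →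
  holds (rawCircuit C order b) ≡ true ⇔ resultSet C b
decide-correct C rt = holds-correct C (order-closed C rt) (order-complete C rt _)

accepted : ∀ (m : Maybe (El circuit × List Bool)) → maybe′ (λ (c , r) → null r ∧ decide c) false m ≡ true →
  ∃[ c ] (m ≡ just (c , []) × decide c ≡ true)
accepted (just (c , [])) eq = c , refl , eq

-- Completeness works with the given circuit, soundness with the one that `Rebuild` reads off the
-- string. In both cases the string is the code of a `rawCircuit`, for which `holds` agrees with
-- membership.
accept-correct : ∀ w → MC* Ops w ⇔ accept w ≡ true
accept-correct w = mk⇔ complete sound
  where
  complete : MC* Ops w → accept w ≡ true
  complete (k , 1≤k , C , b , (order , rt , eq) , b∈C) = trans
    (cong (maybe′ (λ (c , r) → null r ∧ decide c) false) (subst (λ w → parse circuit w ≡ just (rawCircuit C order b , []))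
      (trans (++-identityʳ _) (trans (enc-rawCircuit C order b) (sym eq))) (parse-complete circuit (rawCircuit C order b) [])))
    (cong₂ _∧_ (wellFormed-complete C 1≤k rt b) (Equivalence.from (decide-correct C rt b) b∈C))
  sound : accept w ≡ true → MC* Ops w
  sound eq =
    let (c , parsed , decided) = accepted (parse circuit w) eq
        (wf , h) = ∧-true {wellFormed c} decided
        (k , 1≤k , C , b , order , rt , c≡) = wellFormed-sound c wf
    in k , 1≤k , C , b , (order , rt , trans (parse-sound circuit w parsed) (trans (++-identityʳ (enc c))
         (trans (cong enc c≡) (enc-rawCircuit C order b)))) ,
       Equivalence.to (decide-correct C rt b) (subst (λ c → holds c ≡ true) c≡ h)

theorem5 : InP (MC* (bin cap ∷ bin plus ∷ bin minus ∷ []))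
theorem5 = FP→InP FP-accept accept-correct
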